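{- For every simple signed permutation $\pi$ of size $n$, $$psrd(\pi)= n+1+c(BG(\pi))-2c_1(BG(\pi))+t(\pi)-\begin{cases}0 & \text{if } \pi_1=1,\\ 2 & \text{otherwise,}\end{cases}$$ where $t(\pi)=1$ if $\pi_1\neq 1$ and the leftmost component of $BG(\pi)$ is nonoriented, and $t(\pi)=0$ otherwise.
   Context: A signed permutation of size $n$ is a sequence $\pi=\langle\pi_1\ \cdots\ \pi_n\rangle$ of nonzero integers such that $(|\pi_1|,\ldots,|\pi_n|)$ is a permutation of $\{1,\ldots,n\}$; the identity is $\iota=\langle 1\ 2\ \cdots\ n\rangle$ (all signs positive). "$\pi_1=1$" means the first entry is $1$ with positive sign. For $1\le j\le n$, the prefix signed reversal $\overline{\rho}(1,j)$ transforms $\pi$ into $\langle -\pi_j\ \cdots\ -\pi_1\ \pi_{j+1}\ \cdots\ \pi_n\rangle$. $psrd(\pi)$ is the minimum number of prefix signed reversals whose successive application transforms $\pi$ into $\iota$. Breakpoint graph: let $\pi'=(\pi'_0,\ldots,\pi'_{2n+1})$ with $\pi'_0=0$, $\pi'_{2n+1}=2n+1$ and, for $1\le i\le n$, $(\pi'_{2i-1},\pi'_{2i})=(2\pi_i-1,2\pi_i)$ if $\pi_i>0$ and $(2|\pi_i|,2|\pi_i|-1)$ if $\pi_i<0$. $BG(\pi)$ has one vertex per position $p\in\{0,\ldots,2n+1\}$ (labelled $\pi'_p$); black edges join positions $2i$ and $2i+1$ ($0\le i\le n$); grey edges join the vertices labelled $2k$ and $2k+1$ ($0\le k\le n$). $BG(\pi)$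 decomposes uniquely into alternating cycles; $c(BG(\pi))$ is their number, the length of a cycle is its number of black edges, and $c_1(BG(\pi))$ is the number of cycles of length $1$. $\pi$ is simple if every cycle of $BG(\pi)$ has length at most $2$. The support of a grey edge joining positions $i<j$ is the interval of positions $[i,j]$; the grey edge is oriented if $j-i+1$ is odd, nonoriented otherwise; a cycle is oriented if it contains an oriented grey edge. Two distinct grey edges interleave if their supports overlap but neither contains the other; two cycles interleave if some grey edge of one interleaves with some grey edge of the other. A component of $BG(\pi)$ is a connected component of the graph whose vertices are the cycles of $BG(\pi)$, two cycles being adjacent when they interleave; a component is oriented if it contains an oriented cycle, nonoriented otherwise. The leftmost cycle is the cycle containing the black edge joining positions $0$ and $1$, and the leftmost component is the component containing it. -}

module Defs where

open import Data.Nat using (ℕ; zero; suc; _+_; _*_; _∸_; _≤_; _⊓_; _⊔_; _%_; _≡ᵇ_)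
open import Data.Integer as ℤ using (ℤ; +_; -[1+_]; ∣_∣)
open import Data.List using (List; []; _∷_; _++_; map; concatMap; upTo; length; reverse; take; drop; head)
open import Data.Bool.ListAction using (all; any)
open import Data.List.Relation.Unary.All using (All)
open import Data.List.Relation.Binary.Permutation.Propositional using (_↭_)
open import Data.Maybe using (just)
open import Data.Bool using (Bool; true; false; if_then_else_; not; T)
open import Data.Product using (_×_; ∃-syntax)
open import Data.Sum using (_⊎_)
open import Relation.Nullary using (¬_)
open import Relation.Binary.PropositionalEquality using (_≡_; _≢_)
open import Relation.Binary.Construct.Closure.ReflexiveTransitive using (Star)

IsSignedPerm : ℕ → List ℤ → Set
IsSignedPerm n π = map ∣_∣ π ↭ map suc (upTo n)

ι : ℕ → List ℤ
ι n = map (λ i → + suc i) (upTo n)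

FirstIsOne : List ℤ → Set
FirstIsOne π = head π ≡ just (+ 1)

prefixRev : ℕ → List ℤ → List ℤ
prefixRev j π = map ℤ.-_ (reverse (take j π)) ++ drop j π

applyAll : List ℕ → List ℤ → List ℤ
applyAll []       π = π
applyAll (j ∷ js) π = applyAll js (prefixRev j π)

Sorts : List ℤ → List ℕ → Set
Sorts π js = All (λ j → 1 ≤ j × j ≤ length π) js × applyAll js π ≡ ι (length π)

IsPsrd : List ℤ → ℕ → Set
IsPsrd π d = (∃[ js ] (Sorts π js × length js ≡ d))
           × (∀ js → Sorts π js → d ≤ length js)

partner : ℕ → ℕ
partner zero          = 1
partner (suc zero)    = 0
partner (suc (suc m)) = suc (suc (partner m))

expand : ℤ → List ℕ
expand (+ m)     = (2 * m ∸ 1) ∷ 2 * m ∷ []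
expand -[1+ m ]  = 2 * suc m ∷ (2 * suc m ∸ 1) ∷ []

ext : List ℤ → List ℕ
ext π = 0 ∷ concatMap expand π ++ (2 * length π + 1) ∷ []

at : List ℕ → ℕ → ℕ
at []       _       = 0
at (x ∷ xs) zero    = x
at (x ∷ xs) (suc i) = at xs i

indexOf : ℕ → List ℕ → ℕ
indexOf v []       = 0
indexOf v (x ∷ xs) = if v ≡ᵇ x then 0 else suc (indexOf v xs)

label : List ℤ → ℕ → ℕ
label π p = at (ext π) p

position : List ℤ → ℕ → ℕ
position π ℓ = indexOf ℓ (ext π)

-- black edges join positions 2i and 2i+1
blackNbr : ℕ → ℕ
blackNbr = partner

greyNbr : List ℤ → ℕ → ℕ
greyNbr π p = position π (partner (label π p))

next : List ℤ → ℕ → ℕ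
next π p = greyNbr π (blackNbr p)

iter : ℕ → (ℕ → ℕ) → ℕ → ℕ
iter zero    f x = x
iter (suc k) f x = f (iter k f x)

-- vertices (positions) of the alternating cycle through position p,
-- obtained by walking it alternately along black and grey edges
-- (2n+2 steps suffice since there are 2n+2 vertices)
cycleVerts : List ℤ → ℕ → List ℕ
cycleVerts π p = concatMap (λ k → iter k (next π) p ∷ blackNbr (iter k (next π) p) ∷ [])
                           (upTo (2 * length π + 2))

inCycle : List ℤ → ℕ → ℕ → Bool
inCycle π p q = any (λ v → v ≡ᵇ q) (cycleVerts π p)

countB : (ℕ → Bool) → List ℕ → ℕ
countB f []       = 0
countB f (x ∷ xs) = if f x then suc (countB f xs) else countB f xs

-- length (number of black edges) of the cycle containing black edge i
cycLen : List ℤ → ℕ → ℕ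
cycLen π i = countB (λ j → inCycle π (2 * i) (2 * j)) (upTo (suc (length π)))

-- c(BG(π)) : number of cycles (one representative: the least black edge)
cyc : List ℤ → ℕ
cyc π = countB (λ i → all (λ j → not (inCycle π (2 * i) (2 * j))) (upTo i))
               (upTo (suc (length π)))

cyc₁ : List ℤ → ℕ
cyc₁ π = countB (λ i → cycLen π i ≡ᵇ 1) (upTo (suc (length π)))

Simple : List ℤ → Set
Simple π = ∀ i → i ≤ length π → cycLen π i ≤ 2

-- Grey edges (indexed by k ∈ {0..n}, joining labels 2k and 2k+1),
-- orientation, interleaving, components

gLo gHi : List ℤ → ℕ → ℕ
gLo π k = position π (2 * k) ⊓ position π (2 * k + 1)
gHi π k = position π (2 * k) ⊔ position π (2 * k + 1)

OrientedGrey : List ℤ → ℕ → Set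
OrientedGrey π k = (gHi π k ∸ gLo π k + 1) % 2 ≡ 1

Contains : List ℤ → ℕ → ℕ → Set
Contains π k l = gLo π k ≤ gLo π l × gHi π l ≤ gHi π k

Overlap : List ℤ → ℕ → ℕ → Set
Overlap π k l = gLo π k ≤ gHi π l × gLo π l ≤ gHi π k

Interleave : List ℤ → ℕ → ℕ → Set
Interleave π k l = k ≢ l × Overlap π k l × ¬ Contains π k l × ¬ Contains π l k

SameCycleGrey : List ℤ → ℕ → ℕ → Set
SameCycleGrey π k l = T (inCycle π (position π (2 * k)) (position π (2 * l)))

-- one step in the component graph, lifted to grey edges: the cycles of
-- k and l coincide, or k and l interleave (hence their cycles interleave)
Link : List ℤ → ℕ → ℕ → Set
Link π k l = k ≤ length π × l ≤ length π × (SameCycleGrey π k l ⊎ Interleave π k l)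

-- The leftmost cycle contains position 0 (label 0), hence grey edge 0.
-- The leftmost component is nonoriented iff no grey edge of a cycle in it
-- is oriented.
LeftmostNonoriented : List ℤ → Set
LeftmostNonoriented π = ∀ k → Star (Link π) 0 k → ¬ OrientedGrey π k

-- Labels are fixed; a flip only changes the black edges, which form an involution β on labels: it
-- replaces the edges {0,u} and {e,f} by {0,e} and {u,f}.
--
-- Lower bound. Give the leftmost cycle of length k the weight k - 1, every other cycle of length
-- k ≥ 2 the weight k + 1, and cycles of length 1 the weight 0. A flip lowers the total by at most
-- one, and does so only if it splits a 1-cycle off the front of the leftmost cycle or merges it
-- with another cycle. If the leftmost component is nonoriented, its edges can be directed from the
-- left to the right, and these two kinds of flips respect the direction as long as the cycle
-- through 0 and 1 is not resolved; but they cannot resolve it, since that would require walking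
-- against the direction. So one more flip is needed.
--
-- Upper bound. An oriented 2-cycle can be resolved by reversing the segment between its black
-- edges (three flips, or one if it is the leftmost cycle), and two crossing nonoriented ones by a
-- block interchange (six flips). A nonoriented 2-cycle is always crossed by another cycle, so this
-- sorts every simple permutation with π₁ = 1. Otherwise resolve the oriented cycles along a
-- shortest path from the leftmost cycle until that one is oriented itself; if it has no path to an
-- oriented cycle, one flip that turns the leftmost cycle makes the cycles crossing it oriented.
module Submission where

open import Defs
open import Data.Bool using (Bool; true; false; not; T)
open import Data.Bool.ListAction using (all)
open import Data.Bool.Properties using (¬-not; not-¬; not-involutive) renaming (_≟_ to _≟ᵇ_)
open import Data.Empty using (⊥; ⊥-elim)
open import Data.Integer as ℤ using (ℤ; +_; -[1+_]; ∣_∣)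
open import Data.Integer.Properties using (∣-i∣≡∣i∣; neg-involutive)
open import Data.List using (List; []; _∷_; _++_; [_]; _∷ʳ_; map; concat; concatMap; filter; length; reverse; take; drop; upTo; applyUpTo)
open import Data.List.Properties
open import Data.List.Membership.Propositional using (_∈_; _∉_; lose; find)
open import Data.List.Membership.Propositional.Properties
open import Data.List.Relation.Unary.All as All using (All; []; _∷_)
import Data.List.Relation.Unary.All.Properties as All
open import Data.List.Relation.Unary.AllPairs using ([]; _∷_)
open import Data.List.Relation.Unary.Any as Any using (here; there)
import Data.List.Relation.Unary.Any.Properties as Any
open import Data.List.Relation.Unary.Unique.Propositional using (Unique)
import Data.List.Relation.Unary.Unique.Propositional.Properties as Unique
open import Data.List.Relation.Binary.Permutation.Propositional using (_↭_; ↭-refl; ↭-sym; ↭-trans; ↭-reflexive; ↭⇒↭ₛ; prep)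
import Data.List.Relation.Binary.Permutation.Propositional as Perm↭
import Data.List.Relation.Binary.Permutation.Propositional.Properties as ↭
import Data.List.Relation.Binary.Permutation.Setoid.Properties as ↭ₛ
open import Data.Product using (_×_; _,_; proj₁; proj₂; ∃; ∃₂; ∃-syntax; map₂)
open import Data.Sum as Sum using (_⊎_; inj₁; inj₂)
open import Data.Unit using (tt)
open import Function using (_∘_; id)
open import Relation.Nullary
open import Relation.Nullary.Decidable using (¬?; _×-dec_; map′; decidable-stable; ¬¬-excluded-middle) renaming (T? to dec-T)
open import Relation.Binary.Definitions using (tri<; tri≈; tri>)
open import Relation.Binary.Construct.Closure.ReflexiveTransitive using (Star; _◅_; _◅◅_) renaming (ε to nil)
open import Relation.Binary.PropositionalEquality hiding ([_])

-- If there are m cycles of length 2, then n + 1 + c - 2c₁ = 3m. A 2-cycle weighs 3 and the leftmost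
-- one only 1, so the weight is 3m if π₁ = 1 and 3m - 2 otherwise, which is the formula without
-- t(π).
--
-- Flips do not preserve simplicity, so the two bounds describe cycles differently. The lower bound
-- lists the labels along cycles of any length. The upper bound looks at permutations only between
-- groups of one, three or six flips; there they are simple, and a cycle is at most four labels
-- related by two commuting involutions.
--
-- The direction in the strict lower bound is frozen: which end of a grey edge is incoming, and
-- which region a label lies in, are read off the given permutation and stay attached to the labels
-- while flips move these about. Only the compatibility of the black edges with these data is
-- carried along.
--
-- The proof does not decide whether the leftmost component is nonoriented. The distance is settled
-- by a finite search, and the component is consulted only under double negation.

module Positions where
  open import Data.Nat
  open import Data.Nat.Properties

  -- Positions, their parity, and the reversal of an interval of positions.

  dbl : ℕ → ℕ
  dbl zero    = zero
  dbl (suc n) = suc (suc (dbl n))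

  odd : ℕ → Bool
  odd zero    = false
  odd (suc n) = not (odd n)

  partner-involutive : ∀ x → partner (partner x) ≡ x
  partner-involutive zero          = refl
  partner-involutive (suc zero)    = refl
  partner-involutive (suc (suc x)) = cong (suc ∘ suc) (partner-involutive x)

  partner≢ : ∀ x → partner x ≢ x
  partner≢ zero          ()
  partner≢ (suc zero)    ()
  partner≢ (suc (suc x)) e = partner≢ x (suc-injective (suc-injective e))

  partner-swap : ∀ {x y} → partner x ≡ y → x ≡ partner y
  partner-swap e = trans (sym (partner-involutive _)) (cong partner e)

  partner-injective : ∀ {x y} → partner x ≡ partner y → x ≡ y
  partner-injective e = trans (partner-swap e) (partner-involutive _)

  partner-dbl : ∀ k → partner (dbl k) ≡ suc (dbl k)
  partner-dbl zero    = refl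
  partner-dbl (suc k) = cong (suc ∘ suc) (partner-dbl k)

  partner-sdbl : ∀ k → partner (suc (dbl k)) ≡ dbl k
  partner-sdbl zero    = refl
  partner-sdbl (suc k) = cong (suc ∘ suc) (partner-sdbl k)

  odd-partner : ∀ x → odd (partner x) ≡ not (odd x)
  odd-partner zero          = refl
  odd-partner (suc zero)    = refl
  odd-partner (suc (suc x)) = cong (not ∘ not) (odd-partner x)

  odd-dbl : ∀ k → odd (dbl k) ≡ false
  odd-dbl zero    = refl
  odd-dbl (suc k) = cong (not ∘ not) (odd-dbl k)

  half-dbl : ∀ k → ⌊ dbl k /2⌋ ≡ k
  half-dbl zero    = refl
  half-dbl (suc k) = cong suc (half-dbl k)

  half-sdbl : ∀ k → ⌊ suc (dbl k) /2⌋ ≡ k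
  half-sdbl zero    = refl
  half-sdbl (suc k) = cong suc (half-sdbl k)

  half-partner : ∀ x → ⌊ partner x /2⌋ ≡ ⌊ x /2⌋
  half-partner zero          = refl
  half-partner (suc zero)    = refl
  half-partner (suc (suc x)) = cong suc (half-partner x)

  dbl-half : ∀ p → p ≡ dbl ⌊ p /2⌋ ⊎ p ≡ suc (dbl ⌊ p /2⌋)
  dbl-half zero          = inj₁ refl
  dbl-half (suc zero)    = inj₂ refl
  dbl-half (suc (suc p)) = Sum.map (cong (suc ∘ suc)) (cong (suc ∘ suc)) (dbl-half p)

  half-≡ : ∀ x y → ⌊ x /2⌋ ≡ ⌊ y /2⌋ → x ≡ y ⊎ x ≡ partner y
  half-≡ x y e with dbl-half x | dbl-half y
  ... | inj₁ p | inj₁ q = inj₁ (trans p (trans (cong dbl e) (sym q)))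
  ... | inj₂ p | inj₂ q = inj₁ (trans p (trans (cong (suc ∘ dbl) e) (sym q)))
  ... | inj₁ p | inj₂ q =
    inj₂ (trans p (trans (cong dbl e) (trans (sym (partner-sdbl _)) (cong partner (sym q)))))
  ... | inj₂ p | inj₁ q =
    inj₂ (trans p (trans (cong (suc ∘ dbl) e) (trans (sym (partner-dbl _)) (cong partner (sym q)))))

  dbl-+ : ∀ i j → dbl i + dbl j ≡ dbl (i + j)
  dbl-+ zero    j = refl
  dbl-+ (suc i) j = cong (suc ∘ suc) (dbl-+ i j)

  dbl-mono-≤ : ∀ {i j} → i ≤ j → dbl i ≤ dbl j
  dbl-mono-≤ z≤n     = z≤n
  dbl-mono-≤ (s≤s p) = s≤s (s≤s (dbl-mono-≤ p))

  dbl-mono-< : ∀ {i j} → i < j → suc (dbl i) < dbl j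
  dbl-mono-< p = dbl-mono-≤ p

  dbl-injective : ∀ {i j} → dbl i ≡ dbl j → i ≡ j
  dbl-injective {i} {j} e = trans (sym (half-dbl i)) (trans (cong ⌊_/2⌋ e) (half-dbl j))

  dbl≢sdbl : ∀ {i j} → dbl i ≢ suc (dbl j)
  dbl≢sdbl {i} {j} e with trans (sym (odd-dbl i)) (trans (cong odd e) (cong not (odd-dbl j)))
  ... | ()

  2*≡dbl : ∀ k → 2 * k ≡ dbl k
  2*≡dbl zero    = refl
  2*≡dbl (suc k) = cong suc (trans (+-suc k (k + 0)) (cong suc (2*≡dbl k)))

  partner-≤ : ∀ x → partner x ≤ suc x
  partner-≤ zero          = ≤-refl
  partner-≤ (suc zero)    = z≤n
  partner-≤ (suc (suc x)) = s≤s (s≤s (partner-≤ x))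

  partner-< : ∀ {p} k → p < dbl k → partner p < dbl k
  partner-< {zero}          (suc k) _             = s≤s (s≤s z≤n)
  partner-< {suc zero}      (suc k) _             = s≤s z≤n
  partner-< {suc (suc p)}   (suc k) (s≤s (s≤s l)) = s≤s (s≤s (partner-< k l))

  partner-≥ : ∀ {p} k → dbl k ≤ p → dbl k ≤ partner p
  partner-≥ {p} k l with dbl k ≤? partner p
  ... | yes q = q
  ... | no q  = ⊥-elim (<⇒≱ (subst (_< dbl k) (partner-involutive p) (partner-< k (≰⇒> q))) l)

  -- Since p and q have different parity, `partner` raises one of them and lowers the other. So a
  -- reflection with odd constant maps black edges to black edges.
  partner-sum : ∀ p q m → p + q ≡ suc (dbl m) → partner p + partner q ≡ suc (dbl m)
  partner-sum zero .(suc (dbl m)) m refl = cong suc (partner-sdbl m)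
  partner-sum (suc zero) q m e = trans (cong partner (suc-injective e)) (partner-dbl m)
  partner-sum (suc (suc p)) q zero ()
  partner-sum (suc (suc p)) q (suc m) e =
    cong (suc ∘ suc) (partner-sum p q m (suc-injective (suc-injective e)))

  -- The positions 2i+1, …, 2j of the elements π_{i+1}, …, π_j.
  In : ℕ → ℕ → ℕ → Set
  In i j p = dbl i < p × p ≤ dbl j

  in? : ∀ i j p → Dec (In i j p)
  in? i j p with dbl i <? p | p ≤? dbl j
  ... | yes a | yes b = yes (a , b)
  ... | no a  | _     = no (a ∘ proj₁)
  ... | yes _ | no b  = no (b ∘ proj₂)

  abstract
    -- The reflection constant 2i + 2j + 1 is the sum of the outermost positions 2i + 1 and 2j of
    -- the interval.
    rev : ℕ → ℕ → ℕ → ℕ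
    rev i j p with in? i j p
    ... | yes _ = suc (dbl i + dbl j) ∸ p
    ... | no _  = p

    rev-in : ∀ {i j p} → In i j p → rev i j p ≡ suc (dbl i + dbl j) ∸ p
    rev-in {i} {j} {p} h with in? i j p
    ... | yes _ = refl
    ... | no n  = ⊥-elim (n h)

    rev-out : ∀ {i j p} → ¬ In i j p → rev i j p ≡ p
    rev-out {i} {j} {p} h with in? i j p
    ... | yes y = ⊥-elim (h y)
    ... | no _  = refl

  private
    top : ∀ i j → suc (dbl i + dbl j) ∸ dbl j ≡ suc (dbl i)
    top i j = m+n∸n≡m (suc (dbl i)) (dbl j)

    in≤ : ∀ {i j p} → In i j p → p ≤ suc (dbl i + dbl j)
    in≤ {i} {j} h = ≤-trans (proj₂ h) (≤-trans (m≤n+m (dbl j) (dbl i)) (n≤1+n _))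

  rev-In : ∀ {i j p} → In i j p → In i j (rev i j p)
  rev-In {i} {j} {p} h rewrite rev-in h =
      subst (_≤ suc (dbl i + dbl j) ∸ p) (top i j) (∸-monoʳ-≤ (suc (dbl i + dbl j)) (proj₂ h))
    , subst (suc (dbl i + dbl j) ∸ p ≤_) (m+n∸m≡n (dbl i) (dbl j))
            (∸-monoʳ-≤ (suc (dbl i + dbl j)) (proj₁ h))

  rev-¬In : ∀ {i j p} → ¬ In i j p → ¬ In i j (rev i j p)
  rev-¬In h = subst (¬_ ∘ In _ _) (sym (rev-out h)) h

  rev-sum : ∀ {i j p} → In i j p → rev i j p + p ≡ suc (dbl (i + j))
  rev-sum {i} {j} {p} h =
    trans (cong (_+ p) (rev-in h)) (trans (m∸n+n≡m (in≤ h)) (cong suc (dbl-+ i j)))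

  rev-involutive : ∀ i j p → rev i j (rev i j p) ≡ p
  rev-involutive i j p with in? i j p
  ... | no n  = trans (cong (rev i j) (rev-out n)) (rev-out n)
  ... | yes y = trans (rev-in (rev-In y))
                  (trans (cong (suc (dbl i + dbl j) ∸_) (rev-in y)) (m∸[m∸n]≡n (in≤ y)))

  rev-anti : ∀ {i j p q} → In i j p → In i j q → p < q → rev i j q < rev i j p
  rev-anti {i} {j} {p} {q} hp hq l rewrite rev-in hp | rev-in hq = ∸-monoʳ-< l (in≤ hq)

  odd-sum : ∀ p q m → p + q ≡ suc (dbl m) → odd p ≡ not (odd q)
  odd-sum zero .(suc (dbl m)) m refl = sym (trans (not-involutive (odd (dbl m))) (odd-dbl m))
  odd-sum (suc zero) q m e = cong not (sym (trans (cong odd (suc-injective e)) (odd-dbl m)))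
  odd-sum (suc (suc p)) q zero ()
  odd-sum (suc (suc p)) q (suc m) e =
    trans (not-involutive (odd p)) (odd-sum p q m (suc-injective (suc-injective e)))

  odd-rev : ∀ {i j p} → In i j p → odd (rev i j p) ≡ not (odd p)
  odd-rev {i} {j} {p} h = odd-sum (rev i j p) p (i + j) (rev-sum h)

  partner-In : ∀ {i j p} → In i j p → p ≢ suc (dbl i) → p ≢ dbl j → In i j (partner p)
  partner-In {i} {j} (a , b) ≢a ≢b =
    <⇒≤ (partner-≥ (suc i) (≤∧≢⇒< a (≢a ∘ sym))) , <⇒≤ (partner-< j (≤∧≢⇒< b ≢b))

  partner-¬In : ∀ {i j p} → ¬ In i j p → p ≢ dbl i → p ≢ suc (dbl j) → ¬ In i j (partner p)
  partner-¬In {i} {j} {p} n ≢a ≢b y =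
    n (subst (In i j) (partner-involutive p)
        (partner-In y
          (λ e → ≢a (partner-injective (trans e (sym (partner-dbl i)))))
          (λ e → ≢b (partner-injective (trans e (sym (partner-sdbl j)))))))

  left-In : ∀ {i j} → i < j → In i j (suc (dbl i))
  left-In l = ≤-refl , <⇒≤ (dbl-mono-< l)

  right-In : ∀ {i j} → i < j → In i j (dbl j)
  right-In l = <⇒≤ (dbl-mono-< l) , ≤-refl

  left-¬In : ∀ i j → ¬ In i j (dbl i)
  left-¬In _ _ (a , _) = <-irrefl refl a

  right-¬In : ∀ i j → ¬ In i j (suc (dbl j))
  right-¬In _ _ (_ , b) = <-irrefl refl b

  rev-left : ∀ {i j} → i < j → rev i j (suc (dbl i)) ≡ dbl j
  rev-left {i} {j} l = trans (rev-in (left-In l)) (m+n∸m≡n (dbl i) (dbl j))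

  rev-right : ∀ {i j} → i < j → rev i j (dbl j) ≡ suc (dbl i)
  rev-right {i} {j} l = trans (rev-in (right-In l)) (top i j)

  -- The four exceptions are the ends of the black edges at the two cuts. Every other black edge
  -- lies wholly inside or wholly outside the block, and the reflection permutes those inside.
  rev-partner : ∀ {i j} p → p ≢ dbl i → p ≢ suc (dbl i) → p ≢ dbl j → p ≢ suc (dbl j) →
    rev i j (partner (rev i j p)) ≡ partner p
  rev-partner {i} {j} p n₁ n₂ n₃ n₄ with in? i j p
  ... | no n = trans (cong (rev i j ∘ partner) (rev-out n)) (rev-out (partner-¬In n n₁ n₄))
  ... | yes y = trans (cong (rev i j) (trans (cong partner (rev-in y)) (sym flipped))) (rev-involutive i j (partner p))
    where
    y′ = partner-In y n₂ n₃
    s = suc (dbl i + dbl j)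
    flipped : rev i j (partner p) ≡ partner (s ∸ p)
    flipped = begin
      rev i j (partner p)
        ≡⟨ rev-in y′ ⟩
      s ∸ partner p
        ≡⟨ cong (λ z → suc z ∸ partner p) (dbl-+ i j) ⟩
      suc (dbl (i + j)) ∸ partner p
        ≡⟨ cong (_∸ partner p) (partner-sum (s ∸ p) p (i + j)
             (trans (m∸n+n≡m (in≤ y)) (cong suc (dbl-+ i j)))) ⟨
      partner (s ∸ p) + partner p ∸ partner p
        ≡⟨ m+n∸n≡m _ (partner p) ⟩
      partner (s ∸ p) ∎
      where open ≡-Reasoning

  -- ε joins the two labels 2k - 1 and 2k of an element k, and fixes 0.
  ε : ℕ → ℕ
  ε zero    = zero
  ε (suc x) = suc (partner x)

  -- A signed permutation, read as a bijection between all positions and all labels that is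
  -- the identity beyond the last position, so that no bounds need to be tracked.
  record Cfg : Set where
    field
      lab pos : ℕ → ℕ
      lab-pos : ∀ x → lab (pos x) ≡ x
      pos-lab : ∀ p → pos (lab p) ≡ p
      lab-0   : lab 0 ≡ 0
      lab-ε   : ∀ p → lab (ε p) ≡ ε (lab p)

    β : ℕ → ℕ
    β x = lab (partner (pos x))

    pos-injective : ∀ {x y} → pos x ≡ pos y → x ≡ y
    pos-injective {x} {y} e = trans (sym (lab-pos x)) (trans (cong lab e) (lab-pos y))

    lab-injective : ∀ {p q} → lab p ≡ lab q → p ≡ q
    lab-injective {p} {q} e = trans (sym (pos-lab p)) (trans (cong pos e) (pos-lab q))

    pos-0 : pos 0 ≡ 0
    pos-0 = trans (cong pos (sym lab-0)) (pos-lab 0)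

    pos-β : ∀ x → pos (β x) ≡ partner (pos x)
    pos-β x = pos-lab _

    β-lab : ∀ p → β (lab p) ≡ lab (partner p)
    β-lab p = cong (lab ∘ partner) (pos-lab p)

    β-involutive : ∀ x → β (β x) ≡ x
    β-involutive x = trans (cong (lab ∘ partner) (pos-β x))
                       (trans (cong lab (partner-involutive (pos x))) (lab-pos x))

    β-dbl : ∀ i → β (lab (dbl i)) ≡ lab (suc (dbl i))
    β-dbl i = trans (β-lab (dbl i)) (cong lab (partner-dbl i))

    β-sdbl : ∀ i → β (lab (suc (dbl i))) ≡ lab (dbl i)
    β-sdbl i = trans (β-lab (suc (dbl i))) (cong lab (partner-sdbl i))

  RevOf : Cfg → Cfg → ℕ → ℕ → Set
  RevOf C C' i j = ∀ p → Cfg.lab C' p ≡ Cfg.lab C (rev i j p)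

  -- The analysis of how a prefix flip splits and merges cycles sees the flip only through this
  -- record.
  record Swap (β β' : ℕ → ℕ) (a b c d : ℕ) : Set where
    field
      βa    : β a ≡ b
      βc    : β c ≡ d
      at-a  : β' a ≡ c
      at-b  : β' b ≡ d
      at-c  : β' c ≡ a
      at-d  : β' d ≡ b
      other : ∀ x → x ≢ a → x ≢ b → x ≢ c → x ≢ d → β' x ≡ β x

  module _ {C C' : Cfg} {i j : ℕ} (R : RevOf C C' i j) where
    private
      module C  = Cfg C
      module C' = Cfg C'

    pos-rev : ∀ x → C'.pos x ≡ rev i j (C.pos x)
    pos-rev x = C'.lab-injective (trans (C'.lab-pos x) (sym
      (trans (R _) (trans (cong C.lab (rev-involutive i j (C.pos x))) (C.lab-pos x)))))

    private
      β' : ∀ p → C'.β (C.lab p) ≡ C.lab (rev i j (partner (rev i j p)))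
      β' p = trans (R _) (cong (C.lab ∘ rev i j ∘ partner)
                           (trans (pos-rev (C.lab p)) (cong (rev i j) (C.pos-lab p))))

    swap-rev : i < j → Swap C.β C'.β (C.lab (dbl i)) (C.lab (suc (dbl i)))
                                     (C.lab (dbl j)) (C.lab (suc (dbl j)))
    swap-rev l = record
      { βa = C.β-dbl i ; βc = C.β-dbl j
      ; at-a = trans (β' _) (cong C.lab (trans (cong (rev i j ∘ partner) (rev-out (left-¬In i j)))
                 (trans (cong (rev i j) (partner-dbl i)) (rev-left l))))
      ; at-b = trans (β' _) (cong C.lab (trans (cong (rev i j ∘ partner) (rev-left l))
                 (trans (cong (rev i j) (partner-dbl j)) (rev-out (right-¬In i j)))))
      ; at-c = trans (β' _) (cong C.lab (trans (cong (rev i j ∘ partner) (rev-right l))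
                 (trans (cong (rev i j) (partner-sdbl i)) (rev-out (left-¬In i j)))))
      ; at-d = trans (β' _) (cong C.lab (trans (cong (rev i j ∘ partner) (rev-out (right-¬In i j)))
                 (trans (cong (rev i j) (partner-sdbl j)) (rev-right l))))
      ; other = λ x ≢a ≢b ≢c ≢d → subst (λ z → C'.β z ≡ C.β z) (C.lab-pos x)
          (trans (β' (C.pos x)) (trans
            (cong C.lab (rev-partner (C.pos x) (≢a ∘ at-pos x) (≢b ∘ at-pos x) (≢c ∘ at-pos x) (≢d ∘ at-pos x)))
            (sym (C.β-lab (C.pos x)))))
      }
      where
      at-pos : ∀ x {p} → C.pos x ≡ p → x ≡ C.lab p
      at-pos x e = trans (sym (C.lab-pos x)) (cong C.lab e)

open Positions

-- Signed permutations as lists, and the bijections they define.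

module Labels where
  open import Data.Nat
  open import Data.Nat.Properties
  open import Data.Nat.Tactic.RingSolver using (solve-∀)

  unique-↭ : ∀ {A : Set} {xs ys : List A} → xs ↭ ys → Unique xs → Unique ys
  unique-↭ p = ↭ₛ.Unique-resp-↭ (setoid _) (↭⇒↭ₛ p)

  at-++ˡ : ∀ xs {ys} q → q < length xs → at (xs ++ ys) q ≡ at xs q
  at-++ˡ (x ∷ xs) zero    _       = refl
  at-++ˡ (x ∷ xs) (suc q) (s≤s l) = at-++ˡ xs q l

  at-++ʳ : ∀ xs {ys} q → at (xs ++ ys) (length xs + q) ≡ at ys q
  at-++ʳ []       q = refl
  at-++ʳ (x ∷ xs) q = at-++ʳ xs q

  at-reverse : ∀ xs q → q < length xs → at (reverse xs) q ≡ at xs (length xs ∸ suc q)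
  at-reverse (x ∷ xs) q (s≤s l) rewrite unfold-reverse x xs with m≤n⇒m<n∨m≡n l
  ... | inj₁ q< = begin
      at (reverse xs ∷ʳ x) q
        ≡⟨ at-++ˡ (reverse xs) q (subst (q <_) (sym (length-reverse xs)) q<) ⟩
      at (reverse xs) q
        ≡⟨ at-reverse xs q q< ⟩
      at (x ∷ xs) (suc (length xs ∸ suc q))
        ≡⟨ cong (at (x ∷ xs)) (+-∸-assoc 1 q<) ⟨
      at (x ∷ xs) (length xs ∸ q) ∎
    where open ≡-Reasoning
  ... | inj₂ refl = begin
      at (reverse xs ∷ʳ x) (length xs)
        ≡⟨ cong (at (reverse xs ∷ʳ x)) (trans (sym (length-reverse xs)) (sym (+-identityʳ _))) ⟩
      at (reverse xs ∷ʳ x) (length (reverse xs) + 0)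
        ≡⟨ at-++ʳ (reverse xs) 0 ⟩
      x
        ≡⟨ cong (at (x ∷ xs)) (n∸n≡0 (length xs)) ⟨
      at (x ∷ xs) (length xs ∸ length xs) ∎
    where open ≡-Reasoning

  at-∈ : ∀ xs q → q < length xs → at xs q ∈ xs
  at-∈ (x ∷ xs) zero    _       = here refl
  at-∈ (x ∷ xs) (suc q) (s≤s l) = there (at-∈ xs q l)

  at-injective : ∀ {xs} p q → Unique xs → p < length xs → q < length xs → at xs p ≡ at xs q → p ≡ q
  at-injective zero    zero    _        _       _       _ = refl
  at-injective {x ∷ xs} zero (suc q) (a ∷ _) _ (s≤s l) e = ⊥-elim (All.lookup a (at-∈ xs q l) e)
  at-injective {x ∷ xs} (suc p) zero (a ∷ _) (s≤s l) _ e = ⊥-elim (All.lookup a (at-∈ xs p l) (sym e))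
  at-injective {x ∷ xs} (suc p) (suc q) (_ ∷ u) (s≤s k) (s≤s l) e =
    cong suc (at-injective p q u k l e)

  T-true : ∀ {b} → b ≡ true → T b
  T-true refl = tt

  indexOf-∈ : ∀ {v xs} → v ∈ xs → at xs (indexOf v xs) ≡ v × indexOf v xs < length xs
  indexOf-∈ {v} {x ∷ xs} h with v ≡ᵇ x in eq
  ... | true = sym (≡ᵇ⇒≡ v x (T-true eq)) , s≤s z≤n
  indexOf-∈ {v} {x ∷ xs} (here e)  | false = ⊥-elim (subst T eq (≡⇒≡ᵇ v x e))
  indexOf-∈ {v} {x ∷ xs} (there h) | false = map₂ s≤s (indexOf-∈ h)

  Perm : List ℤ → Set
  Perm σ = IsSignedPerm (length σ) σ

  pair : ℕ → List ℕ
  pair k = (2 * k ∸ 1) ∷ 2 * k ∷ []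

  expand-↭ : ∀ z → expand z ↭ pair ∣ z ∣
  expand-↭ (+ m)    = ↭-refl
  expand-↭ -[1+ m ] = Perm↭.swap _ _ ↭-refl

  concatMap-expand-↭ : ∀ σ → concatMap expand σ ↭ concatMap pair (map ∣_∣ σ)
  concatMap-expand-↭ []      = ↭-refl
  concatMap-expand-↭ (z ∷ σ) = ↭.++⁺ (expand-↭ z) (concatMap-expand-↭ σ)

  concatMap-pair-↭ : ∀ {xs ys} → xs ↭ ys → concatMap pair xs ↭ concatMap pair ys
  concatMap-pair-↭ Perm↭.refl         = ↭-refl
  concatMap-pair-↭ (prep x p)  = ↭.++⁺ ↭-refl (concatMap-pair-↭ p)
  concatMap-pair-↭ (Perm↭.swap x y p) =
    ↭-trans (↭.shifts (pair x) (pair y)) (↭.++⁺ (↭-refl {x = pair y}) (↭.++⁺ (↭-refl {x = pair x}) (concatMap-pair-↭ p)))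
  concatMap-pair-↭ (Perm↭.trans p q) = ↭-trans (concatMap-pair-↭ p) (concatMap-pair-↭ q)

  ascend : ℕ → ℕ → List ℕ
  ascend k zero    = []
  ascend k (suc n) = k ∷ ascend (suc k) n

  applyUpTo-ascend : ∀ f k n → (∀ i → f i ≡ k + i) → applyUpTo f n ≡ ascend k n
  applyUpTo-ascend f k zero    h = refl
  applyUpTo-ascend f k (suc n) h = cong₂ _∷_ (trans (h 0) (+-identityʳ k))
    (applyUpTo-ascend (f ∘ suc) (suc k) n (λ i → trans (h (suc i)) (+-suc k i)))

  upTo-ascend : ∀ n → upTo n ≡ ascend 0 n
  upTo-ascend n = applyUpTo-ascend id 0 n (λ _ → refl)

  concatMap-pair-ascend : ∀ k n → concatMap pair (map suc (ascend k n)) ≡ ascend (suc (dbl k)) (dbl n)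
  concatMap-pair-ascend k zero    = refl
  concatMap-pair-ascend k (suc n) =
    cong₂ (λ a z → (a ∸ 1) ∷ a ∷ z) (2*≡dbl (suc k)) (concatMap-pair-ascend (suc k) n)

  ascend-∷ʳ : ∀ k n → ascend k n ∷ʳ (k + n) ≡ ascend k (suc n)
  ascend-∷ʳ k zero    = cong [_] (+-identityʳ k)
  ascend-∷ʳ k (suc n) = cong (k ∷_) (trans (cong (ascend (suc k) n ∷ʳ_) (+-suc k n)) (ascend-∷ʳ (suc k) n))

  last-label : ∀ n → 2 * n + 1 ≡ suc (dbl n)
  last-label n = trans (+-comm (2 * n) 1) (cong suc (2*≡dbl n))

  ext-↭ : ∀ {σ} → Perm σ → ext σ ↭ upTo (dbl (suc (length σ)))
  ext-↭ {σ} P = begin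
      ext σ
        ↭⟨ prep 0 (↭.++⁺ (concatMap-expand-↭ σ) ↭-refl) ⟩
      0 ∷ concatMap pair (map ∣_∣ σ) ++ [ 2 * n + 1 ]
        ↭⟨ prep 0 (↭.++⁺ (concatMap-pair-↭ P) ↭-refl) ⟩
      0 ∷ concatMap pair (map suc (upTo n)) ++ [ 2 * n + 1 ]
        ≡⟨ cong₂ (λ a b → 0 ∷ concatMap pair (map suc a) ++ [ b ]) (upTo-ascend n) (last-label n) ⟩
      0 ∷ concatMap pair (map suc (ascend 0 n)) ++ [ suc (dbl n) ]
        ≡⟨ cong (λ a → 0 ∷ a ∷ʳ suc (dbl n)) (concatMap-pair-ascend 0 n) ⟩
      0 ∷ ascend 1 (dbl n) ∷ʳ suc (dbl n)
        ≡⟨ cong (0 ∷_) (ascend-∷ʳ 1 (dbl n)) ⟩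
      ascend 0 (dbl (suc n))
        ≡⟨ upTo-ascend _ ⟨
      upTo (dbl (suc n)) ∎
    where
    n = length σ
    open Perm↭.PermutationReasoning

  length-expand : ∀ σ → length (concatMap expand σ) ≡ dbl (length σ)
  length-expand []            = refl
  length-expand (+ m ∷ σ)     = cong (suc ∘ suc) (length-expand σ)
  length-expand (-[1+ m ] ∷ σ) = cong (suc ∘ suc) (length-expand σ)

  length-ext : ∀ σ → length (ext σ) ≡ dbl (suc (length σ))
  length-ext σ = cong suc (trans (length-++ (concatMap expand σ))
    (trans (+-comm _ 1) (cong suc (length-expand σ))))

  expand-neg : ∀ z → expand (ℤ.- z) ≡ reverse (expand z)
  expand-neg (+ zero)  = refl
  expand-neg (+ suc m) = refl
  expand-neg -[1+ m ]  = refl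

  neg : ℤ → ℤ
  neg z = ℤ.- z

  flip : List ℤ → List ℤ
  flip σ = map neg (reverse σ)

  concatMap-expand-++ : ∀ σ τ → concatMap expand (σ ++ τ) ≡ concatMap expand σ ++ concatMap expand τ
  concatMap-expand-++ []      τ = refl
  concatMap-expand-++ (z ∷ σ) τ = trans (cong (expand z ++_) (concatMap-expand-++ σ τ))
    (sym (++-assoc (expand z) (concatMap expand σ) (concatMap expand τ)))

  flip-∷ : ∀ z σ → flip (z ∷ σ) ≡ flip σ ∷ʳ (ℤ.- z)
  flip-∷ z σ = trans (cong (map neg) (unfold-reverse z σ)) (map-++ neg (reverse σ) [ z ])

  concatMap-expand-flip : ∀ σ → concatMap expand (flip σ) ≡ reverse (concatMap expand σ)
  concatMap-expand-flip []      = refl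
  concatMap-expand-flip (z ∷ σ) = begin
      concatMap expand (flip (z ∷ σ))
        ≡⟨ cong (concatMap expand) (flip-∷ z σ) ⟩
      concatMap expand (flip σ ∷ʳ (ℤ.- z))
        ≡⟨ concatMap-expand-++ (flip σ) _ ⟩
      concatMap expand (flip σ) ++ (expand (ℤ.- z) ++ [])
        ≡⟨ cong₂ _++_ (concatMap-expand-flip σ) (trans (++-identityʳ _) (expand-neg z)) ⟩
      reverse (concatMap expand σ) ++ reverse (expand z)
        ≡⟨ reverse-++ (expand z) (concatMap expand σ) ⟨
      reverse (concatMap expand (z ∷ σ)) ∎
    where open ≡-Reasoning

  length-flip : ∀ σ → length (flip σ) ≡ length σ
  length-flip σ = trans (length-map neg (reverse σ)) (length-reverse σ)

  map-∣flip∣ : ∀ σ → map ∣_∣ (flip σ) ↭ map ∣_∣ σ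
  map-∣flip∣ σ = ↭-trans
    (↭-reflexive (trans (sym (map-∘ (reverse σ))) (map-cong ∣-i∣≡∣i∣ (reverse σ))))
    (↭.map⁺ ∣_∣ (↭.↭-reverse σ))

  length-flip-mid : ∀ A B {R} → length (A ++ flip B ++ R) ≡ length (A ++ B ++ R)
  length-flip-mid A B {R} = trans (length-++ A) (trans (cong (_+_ (length A))
    (trans (length-++ (flip B)) (trans (cong (_+ length R) (length-flip B)) (sym (length-++ B)))))
    (sym (length-++ A)))

  Perm-flip : ∀ A B {R} → Perm (A ++ B ++ R) → Perm (A ++ flip B ++ R)
  Perm-flip A B {R} P rewrite length-flip-mid A B {R} = ↭-trans
    (subst₂ _↭_ (sym (split (flip B))) (sym (split B))
      (↭.++⁺ (↭-refl {x = map ∣_∣ A}) (↭.++⁺ (map-∣flip∣ B) (↭-refl {x = map ∣_∣ R})))) P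
    where
    split : ∀ B′ → map ∣_∣ (A ++ B′ ++ R) ≡ map ∣_∣ A ++ map ∣_∣ B′ ++ map ∣_∣ R
    split B′ = trans (map-++ ∣_∣ A (B′ ++ R)) (cong (map ∣_∣ A ++_) (map-++ ∣_∣ B′ R))

  abstract
    labOf posOf : List ℤ → ℕ → ℕ
    labOf σ p with p <? dbl (suc (length σ))
    ... | yes _ = label σ p
    ... | no _  = p
    posOf σ x with x <? dbl (suc (length σ))
    ... | yes _ = position σ x
    ... | no _  = x

    labOf-< : ∀ {σ p} → p < dbl (suc (length σ)) → labOf σ p ≡ label σ p
    labOf-< {σ} {p} l with p <? dbl (suc (length σ))
    ... | yes _ = refl
    ... | no n  = ⊥-elim (n l)

    posOf-< : ∀ {σ x} → x < dbl (suc (length σ)) → posOf σ x ≡ position σ x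
    posOf-< {σ} {p} l with p <? dbl (suc (length σ))
    ... | yes _ = refl
    ... | no n  = ⊥-elim (n l)

    labOf-≮ : ∀ {σ p} → ¬ p < dbl (suc (length σ)) → labOf σ p ≡ p
    labOf-≮ {σ} {p} n with p <? dbl (suc (length σ))
    ... | yes l = ⊥-elim (n l)
    ... | no _  = refl

    posOf-≮ : ∀ {σ x} → ¬ x < dbl (suc (length σ)) → posOf σ x ≡ x
    posOf-≮ {σ} {p} n with p <? dbl (suc (length σ))
    ... | yes l = ⊥-elim (n l)
    ... | no _  = refl

  labOf-0 : ∀ σ → labOf σ 0 ≡ 0
  labOf-0 σ = labOf-< {σ} (s≤s z≤n)

  -- `ε` pairs the last position 2n + 1 with 2n + 2, which lies beyond the end. For `lab-ε` the
  -- labels must therefore be known to be fixed from 2n + 1 on.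
  labOf-≥ : ∀ {σ p} → dbl (length σ) ≤ p → labOf σ (suc p) ≡ suc p
  labOf-≥ {σ} {p} l with suc p <? dbl (suc (length σ))
  ... | no n  = labOf-≮ {σ} n
  ... | yes m@(s≤s (s≤s k)) with ≤-antisym k l
  ... | refl = trans (labOf-< {σ} m) (begin
      at (concatMap expand σ ++ [ 2 * length σ + 1 ]) (dbl (length σ))
        ≡⟨ cong (at (concatMap expand σ ++ [ 2 * length σ + 1 ]))
             (trans (sym (length-expand σ)) (sym (+-identityʳ _))) ⟩
      at (concatMap expand σ ++ [ 2 * length σ + 1 ]) (length (concatMap expand σ) + 0)
        ≡⟨ at-++ʳ (concatMap expand σ) 0 ⟩
      2 * length σ + 1
        ≡⟨ last-label (length σ) ⟩
      suc (dbl (length σ)) ∎)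
    where open ≡-Reasoning

  ε-odd : ∀ m → 2 * suc m ≡ ε (2 * suc m ∸ 1)
  ε-odd m = subst (λ z → z ≡ ε (z ∸ 1)) (sym (2*≡dbl (suc m))) (cong suc (sym (partner-dbl m)))

  ε-even : ∀ m → 2 * suc m ∸ 1 ≡ ε (2 * suc m)
  ε-even m = subst (λ z → z ∸ 1 ≡ ε z) (sym (2*≡dbl (suc m))) (cong suc (sym (partner-sdbl m)))

  at-expand-partner : ∀ σ {ys} q → q < dbl (length σ) →
    at (concatMap expand σ ++ ys) (partner q) ≡ ε (at (concatMap expand σ ++ ys) q)
  at-expand-partner (+ zero ∷ σ)   zero       _ = refl
  at-expand-partner (+ zero ∷ σ)   (suc zero) _ = refl
  at-expand-partner (+ suc m ∷ σ)  zero       _ = ε-odd m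
  at-expand-partner (+ suc m ∷ σ)  (suc zero) _ = ε-even m
  at-expand-partner (-[1+ m ] ∷ σ) zero       _ = ε-even m
  at-expand-partner (-[1+ m ] ∷ σ) (suc zero) _ = ε-odd m
  at-expand-partner (+ m ∷ σ)      (suc (suc q)) (s≤s (s≤s l)) = at-expand-partner σ q l
  at-expand-partner (-[1+ m ] ∷ σ) (suc (suc q)) (s≤s (s≤s l)) = at-expand-partner σ q l

  module _ {σ} (P : Perm σ) where
    private
      N = dbl (suc (length σ))

    ext-unique : Unique (ext σ)
    ext-unique = unique-↭ (↭-sym (ext-↭ P)) (Unique.upTo⁺ N)

    label-< : ∀ {p} → p < N → label σ p < N
    label-< {p} l = ∈-upTo⁻ (↭.∈-resp-↭ (ext-↭ P)
      (at-∈ (ext σ) p (subst (p <_) (sym (length-ext σ)) l)))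

    position-< : ∀ {x} → x < N → label σ (position σ x) ≡ x × position σ x < N
    position-< {x} l = map₂ (subst (position σ x <_) (length-ext σ))
      (indexOf-∈ (↭.∈-resp-↭ (↭-sym (ext-↭ P)) (∈-upTo⁺ l)))

    position-label : ∀ {p} → p < N → position σ (label σ p) ≡ p
    position-label {p} l = at-injective _ p ext-unique (len (proj₂ r)) (len l) (proj₁ r)
      where
      r = position-< (label-< l)
      len : ∀ {q} → q < N → q < length (ext σ)
      len {q} = subst (q <_) (sym (length-ext σ))

    cfg : Cfg
    cfg = record
      { lab = labOf σ ; pos = posOf σ ; lab-pos = lab-pos′ ; pos-lab = pos-lab′
      ; lab-0 = labOf-0 σ ; lab-ε = lab-ε′ }
      where
      lab-pos′ : ∀ x → labOf σ (posOf σ x) ≡ x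
      lab-pos′ x with x <? N
      ... | yes l = trans (cong (labOf σ) (posOf-< {σ} l))
                      (trans (labOf-< {σ} (proj₂ (position-< l))) (proj₁ (position-< l)))
      ... | no n  = trans (cong (labOf σ) (posOf-≮ {σ} n)) (labOf-≮ {σ} n)

      pos-lab′ : ∀ p → posOf σ (labOf σ p) ≡ p
      pos-lab′ p with p <? N
      ... | yes l = trans (cong (posOf σ) (labOf-< {σ} l))
                      (trans (posOf-< {σ} (label-< l)) (position-label l))
      ... | no n  = trans (cong (posOf σ) (labOf-≮ {σ} n)) (posOf-≮ {σ} n)

      lab-ε′ : ∀ p → labOf σ (ε p) ≡ ε (labOf σ p)
      lab-ε′ zero = trans (labOf-0 σ) (sym (cong ε (labOf-0 σ)))
      lab-ε′ (suc q) with q <? dbl (length σ)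
      ... | yes l = trans (labOf-< {σ} (s≤s (<-≤-trans (partner-< (length σ) l) (n≤1+n _))))
        (trans (at-expand-partner σ q l) (cong ε (sym (labOf-< {σ} (s≤s (<-≤-trans l (n≤1+n _)))))))
      ... | no n = trans (labOf-≥ {σ} (partner-≥ (length σ) (≮⇒≥ n))) (cong ε (sym (labOf-≥ {σ} (≮⇒≥ n))))

  rev-at : ∀ (xs ys : List ℕ) {zs} q q′ → q + suc q′ ≡ length ys →
    at (xs ++ reverse ys ++ zs) (length xs + q) ≡ at (xs ++ ys ++ zs) (length xs + q′)
  rev-at xs ys {zs} q q′ e = begin
      at (xs ++ reverse ys ++ zs) (length xs + q)
        ≡⟨ at-++ʳ xs q ⟩
      at (reverse ys ++ zs) q
        ≡⟨ at-++ˡ (reverse ys) q (subst (q <_) (sym (length-reverse ys)) q<) ⟩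
      at (reverse ys) q
        ≡⟨ at-reverse ys q q< ⟩
      at ys (length ys ∸ suc q)
        ≡⟨ cong (at ys) (trans (cong (_∸ suc q) (trans (sym e) (+-suc q q′))) (m+n∸m≡n (suc q) q′)) ⟩
      at ys q′
        ≡⟨ at-++ˡ ys q′ (subst (q′ <_) e (m≤n+m (suc q′) q)) ⟨
      at (ys ++ zs) q′
        ≡⟨ at-++ʳ xs q′ ⟨
      at (xs ++ ys ++ zs) (length xs + q′) ∎
    where
    open ≡-Reasoning
    q< : q < length ys
    q< = subst (suc q ≤_) (trans (sym (+-suc q q′)) e) (s≤s (m≤m+n q q′))

  at-outside : ∀ (xs ys : List ℕ) {zs} q → q < length xs ⊎ length xs + length ys ≤ q →
    at (xs ++ reverse ys ++ zs) q ≡ at (xs ++ ys ++ zs) q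
  at-outside xs ys q (inj₁ l) = trans (at-++ˡ xs q l) (sym (at-++ˡ xs q l))
  at-outside xs ys {zs} q (inj₂ l) = begin
      at (xs ++ reverse ys ++ zs) q
        ≡⟨ cong₂ at (++-assoc xs (reverse ys) zs) (trans (cong (_+ r) (cong (λ z → length xs + z) (length-reverse ys))) e) ⟨
      at ((xs ++ reverse ys) ++ zs) (length xs + length (reverse ys) + r)
        ≡⟨ cong (λ z → at ((xs ++ reverse ys) ++ zs) (z + r)) (length-++ xs) ⟨
      at ((xs ++ reverse ys) ++ zs) (length (xs ++ reverse ys) + r)
        ≡⟨ at-++ʳ (xs ++ reverse ys) r ⟩
      at zs r
        ≡⟨ at-++ʳ (xs ++ ys) r ⟨
      at ((xs ++ ys) ++ zs) (length (xs ++ ys) + r)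
        ≡⟨ cong (λ z → at ((xs ++ ys) ++ zs) (z + r)) (length-++ xs) ⟩
      at ((xs ++ ys) ++ zs) (length xs + length ys + r)
        ≡⟨ cong₂ at (++-assoc xs ys zs) e ⟩
      at (xs ++ ys ++ zs) q ∎
    where
    open ≡-Reasoning
    r = q ∸ (length xs + length ys)
    e : length xs + length ys + r ≡ q
    e = m+[n∸m]≡n l

  -- Stated for a block in any place: an empty A gives the prefix flips, a nonempty A the reversals
  -- that cost three of them.
  revOf-flip : ∀ A B {R} (P : Perm (A ++ B ++ R)) (P′ : Perm (A ++ flip B ++ R)) →
    RevOf (cfg P) (cfg P′) (length A) (length A + length B)
  revOf-flip A B {R} P P′ zero = trans (labOf-0 (A ++ flip B ++ R)) (sym
    (trans (cong (labOf (A ++ B ++ R)) (rev-out {length A} {length A + length B} (λ { (() , _) })))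
           (labOf-0 (A ++ B ++ R))))
  revOf-flip A B {R} P P′ (suc q) = go (suc q <? N) (in? i j (suc q))
    where
    σ  = A ++ B ++ R
    σ′ = A ++ flip B ++ R
    i  = length A
    j  = length A + length B
    N  = dbl (suc (length σ))
    a  = concatMap expand A
    b  = concatMap expand B
    Z  = concatMap expand R ++ [ 2 * length σ + 1 ]

    j≤ : j ≤ length σ
    j≤ = subst (j ≤_) (sym (trans (length-++ A) (cong (_+_ i) (length-++ B))))
           (+-monoʳ-≤ i (m≤m+n (length B) (length R)))

    <N : ∀ {p} → p ≤ dbl j → p < N
    <N l = ≤-<-trans (≤-trans l (dbl-mono-≤ j≤)) (m<n⇒m<1+n ≤-refl)

    labσ : ∀ {r} → suc r < N → labOf σ (suc r) ≡ at (a ++ b ++ Z) r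
    labσ {r} l = trans (labOf-< {σ} l) (cong (λ z → at z r) body)
      where
      body : concatMap expand σ ++ [ 2 * length σ + 1 ] ≡ a ++ b ++ Z
      body = trans (cong (_++ [ 2 * length σ + 1 ]) (trans (concatMap-expand-++ A (B ++ R))
               (cong (a ++_) (concatMap-expand-++ B R))))
             (trans (++-assoc a _ _) (cong (a ++_) (++-assoc b _ _)))

    labσ′ : ∀ {r} → suc r < N → labOf σ′ (suc r) ≡ at (a ++ reverse b ++ Z) r
    labσ′ {r} l = trans
      (labOf-< {σ′} (subst (λ z → suc r < dbl (suc z)) (sym (length-flip-mid A B)) l))
      (cong (λ z → at z r) body)
      where
      body : concatMap expand σ′ ++ [ 2 * length σ′ + 1 ] ≡ a ++ reverse b ++ Z
      body = trans (cong₂ (λ s t → s ++ [ 2 * t + 1 ])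
               (trans (concatMap-expand-++ A (flip B ++ R)) (cong (a ++_)
                 (trans (concatMap-expand-++ (flip B) R)
                   (cong (_++ concatMap expand R) (concatMap-expand-flip B)))))
               (length-flip-mid A B))
             (trans (++-assoc a _ _) (cong (a ++_) (++-assoc (reverse b) _ _)))

    go : Dec (suc q < N) → Dec (In i j (suc q)) → labOf σ′ (suc q) ≡ labOf σ (rev i j (suc q))
    go (no n) _ = trans (labOf-≥ {σ′} (subst (λ z → dbl z ≤ q) (sym (length-flip-mid A B)) n≤q))
      (sym (trans (cong (labOf σ) (rev-out (n ∘ <N ∘ proj₂))) (labOf-≥ {σ} n≤q)))
      where
      n≤q : dbl (length σ) ≤ q
      n≤q = ≤-pred (≤-trans (n≤1+n _) (≮⇒≥ n))
    go (yes l) (no n) = trans (labσ′ l) (trans (at-outside a b q out)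
      (sym (trans (cong (labOf σ) (rev-out n)) (labσ l))))
      where
      out : q < length a ⊎ length a + length b ≤ q
      out rewrite length-expand A | length-expand B | dbl-+ (length A) (length B)
        with q <? dbl i
      ... | yes k = inj₁ k
      ... | no k  = inj₂ (≮⇒≥ (λ m → n (s≤s (≮⇒≥ k) , m)))
    go (yes l) (yes h) = begin
        labOf σ′ (suc q)
          ≡⟨ labσ′ l ⟩
        at (a ++ reverse b ++ Z) q
          ≡⟨ cong (at (a ++ reverse b ++ Z)) (trans (sym q≡) (cong (_+ q₁) (sym (length-expand A)))) ⟩
        at (a ++ reverse b ++ Z) (length a + q₁)
          ≡⟨ rev-at a b q₁ q₂ (trans sum (sym (length-expand B))) ⟩
        at (a ++ b ++ Z) (length a + q₂)
          ≡⟨ cong (λ z → at (a ++ b ++ Z) (z + q₂)) (length-expand A) ⟩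
        at (a ++ b ++ Z) (dbl i + q₂)
          ≡⟨ labσ (subst (_< N) rev≡ (<N (proj₂ (rev-In h)))) ⟨
        labOf σ (suc (dbl i + q₂))
          ≡⟨ cong (labOf σ) rev≡ ⟨
        labOf σ (rev i j (suc q)) ∎
      where
      open ≡-Reasoning
      -- q₁ is the offset of the position within the block, counted from 0, and q₂ that of its
      -- mirror image.
      q₁ = q ∸ dbl i
      q₂ = dbl (length B) ∸ suc q₁
      q≡ : dbl i + q₁ ≡ q
      q≡ = m+[n∸m]≡n (≤-pred (proj₁ h))
      q₁< : suc q₁ ≤ dbl (length B)
      q₁< = +-cancelˡ-≤ (dbl i) _ _ (subst₂ _≤_ (trans (cong suc (sym q≡)) (sym (+-suc (dbl i) q₁)))
              (sym (dbl-+ (length A) (length B))) (proj₂ h))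
      sum : q₁ + suc q₂ ≡ dbl (length B)
      sum = trans (+-suc q₁ q₂) (m+[n∸m]≡n q₁<)
      regroup : ∀ a s t → suc (a + t) + suc (a + s) ≡ suc (a + (a + (s + suc t)))
      regroup = solve-∀
      rev≡ : rev i j (suc q) ≡ suc (dbl i + q₂)
      rev≡ = +-cancelʳ-≡ (suc q) _ _ (trans (rev-sum h) (sym (begin
        suc (dbl i + q₂) + suc q
          ≡⟨ cong (λ z → suc (dbl i + q₂) + suc z) q≡ ⟨
        suc (dbl i + q₂) + suc (dbl i + q₁)
          ≡⟨ regroup (dbl i) q₁ q₂ ⟩
        suc (dbl i + (dbl i + (q₁ + suc q₂)))
          ≡⟨ cong (λ z → suc (dbl i + (dbl i + z))) sum ⟩
        suc (dbl i + (dbl i + dbl (length B)))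
          ≡⟨ cong (λ z → suc (dbl i + z)) (dbl-+ (length A) (length B)) ⟩
        suc (dbl i + dbl j)
          ≡⟨ cong suc (dbl-+ i j) ⟩
        suc (dbl (i + j)) ∎)))

open Labels

-- Lists of the labels along the cycles, and the effect of one prefix flip on them.

module CycleLists where
  open import Data.Nat
  open import Data.Nat.Properties
  open import Data.Nat.Tactic.RingSolver using (solve-∀)
  open import Data.Nat.ListAction using (sum)
  open import Data.List.Membership.DecPropositional _≟_ using (_∈?_)

  -- A label stands for the grey edge it lies on, numbered by κ.
  κ : ℕ → ℕ
  κ = ⌊_/2⌋

  sep : ∀ xs {ys a b} → Unique (map κ (xs ++ ys)) → a ∈ xs → b ∈ ys → κ a ≢ κ b
  sep (x ∷ xs) (p ∷ _) (here refl) k = All.lookup p (∈-map⁺ κ (∈-++⁺ʳ xs k))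
  sep (x ∷ xs) (_ ∷ u) (there h)   k = sep xs u h k

  uniq-++ʳ : ∀ xs {ys} → Unique (map κ (xs ++ ys)) → Unique (map κ ys)
  uniq-++ʳ []       u       = u
  uniq-++ʳ (x ∷ xs) (_ ∷ u) = uniq-++ʳ xs u

  uniq-++ˡ : ∀ xs {ys} → Unique (map κ (xs ++ ys)) → Unique (map κ xs)
  uniq-++ˡ []       u       = []
  uniq-++ˡ (x ∷ xs) {ys} (p ∷ u) =
    All.++⁻ˡ (map κ xs) (subst (All _) (map-++ κ xs ys) p) ∷ uniq-++ˡ xs u

  inj-on : ∀ {xs a b} → Unique (map κ xs) → a ∈ xs → b ∈ xs → κ a ≡ κ b → a ≡ b
  inj-on u       (here refl) (here refl) e = refl
  inj-on (p ∷ u) (here refl) (there k)   e = ⊥-elim (All.lookup p (∈-map⁺ κ k) e)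
  inj-on (p ∷ u) (there h)   (here refl) e = ⊥-elim (All.lookup p (∈-map⁺ κ h) (sym e))
  inj-on (p ∷ u) (there h)   (there k)   e = inj-on u h k e

  not-both : ∀ {xs a} → Unique (map κ xs) → a ∈ xs → partner a ∈ xs → ⊥
  not-both {a = a} u h k = partner≢ a (inj-on u k h (half-partner a))

  -- Walking along a cycle: from label x, cross the grey edge at x, then the black edge at
  -- partner x. Run β x l y says that the walk from x visits exactly l and then reaches y.
  data Run (β : ℕ → ℕ) : ℕ → List ℕ → ℕ → Set where
    done : ∀ {x} → Run β x [] x
    step : ∀ {x l y} → Run β (β (partner x)) l y → Run β x (x ∷ l) y

  module _ {β : ℕ → ℕ} where
    run-++ : ∀ {x l m k y} → Run β x l m → Run β m k y → Run β x (l ++ k) y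
    run-++ done     s = s
    run-++ (step r) s = step (run-++ r s)

    run-split : ∀ {x} l {k y} → Run β x (l ++ k) y → ∃ λ m → Run β x l m × Run β m k y
    run-split []      r        = _ , done , r
    run-split (z ∷ l) (step r) with run-split l r
    ... | m , r₁ , r₂ = m , step r₁ , r₂

    run-nil : ∀ {x y} → Run β x [] y → x ≡ y
    run-nil done = refl

    run-head : ∀ {x z l y} → Run β x (z ∷ l) y → x ≡ z
    run-head (step r) = refl

    run-first : ∀ {x l y} → Run β x l y → x ∈ 0 ∷ l ⊎ x ≡ y
    run-first done     = inj₂ refl
    run-first (step r) = inj₁ (there (here refl))

    -- The walk enters y by the black edge from `partner b`, where b is the last label visited. On a
    -- cycle through e this puts the other end f of the black edge of e on the same cycle.
    run-last : (∀ x → β (β x) ≡ x) → ∀ {x z l y} → Run β x (z ∷ l) y → ∃ λ b → b ∈ z ∷ l × partner b ≡ β y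
    run-last inv {l = []}    (step done) = _ , here refl , sym (inv _)
    run-last inv {l = _ ∷ _} (step r) with run-last inv r
    ... | b , h , e = b , there h , e

    -- The backward walk meets every grey edge at its other end.
    run-reverse : (∀ x → β (β x) ≡ x) → ∀ {x l y} → Run β x l y →
      Run β (β y) (map partner (reverse l)) (β x)
    run-reverse inv done = done
    run-reverse inv {x} {_ ∷ l} {y} (step r) =
      subst (λ z → Run β (β y) z (β x))
        (sym (trans (cong (map partner) (unfold-reverse x l)) (map-++ partner (reverse l) [ x ])))
        (run-++ (run-reverse inv r)
          (subst₂ (λ s t → Run β s [ partner x ] t) (sym (inv _)) (cong β (partner-involutive x)) (step done)))

    rotate : ∀ {x D e} → Run β x D x → e ∈ D → ∃ λ Q → Run β e (e ∷ Q) e × e ∷ Q ↭ D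
    rotate {x} {D} {e} r h with ∈-∃++ h
    ... | P , Q , refl with run-split P r
    ... | m , r₁ , r₂ with run-head r₂
    ... | refl = Q ++ P , run-++ r₂ r₁ , ↭.++-comm (e ∷ Q) P

  Closed : (ℕ → ℕ) → List ℕ → Set
  Closed β D = (∃ λ x → Run β x D x) × 2 ≤ length D

  -- One label for each grey edge of the listed cycles; 0 stands for the label 1 that ends the
  -- leftmost cycle, since both lie on the same grey edge.
  support : List ℕ → List (List ℕ) → List ℕ
  support l rest = 0 ∷ l ++ concat rest

  -- The leftmost cycle is β 0 ∷ l followed by 1; the list l leaves out its last label 1.
  -- rest lists the other cycles of length at least 2.
  record Decomp (β : ℕ → ℕ) (l : List ℕ) (rest : List (List ℕ)) : Set where
    field
      lead   : Run β (β 0) l 1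
      closed : All (Closed β) rest
      unique : Unique (map κ (support l rest))
      cover  : ∀ x → κ x ∉ map κ (support l rest) → β x ≡ partner x

  weights : List (List ℕ) → ℕ
  weights rest = sum (map (suc ∘ length) rest)

  weight : List ℕ → List (List ℕ) → ℕ
  weight l rest = length l + weights rest

  -- With β equal to `partner` every walk stays where it is, so a second label on a cycle would
  -- repeat a grey edge.
  weight-partner : ∀ {β l rest} → (∀ x → β x ≡ partner x) → Decomp β l rest → weight l rest ≡ 0
  weight-partner {β} {l} {rest} triv d = go l rest lead closed unique
    where
    open Decomp d
    stay : ∀ x → β (partner x) ≡ x
    stay x = trans (triv _) (partner-involutive x)
    go : ∀ l rest → Run β (β 0) l 1 → All (Closed β) rest → Unique (map κ (support l rest)) →
      weight l rest ≡ 0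
    go (z ∷ l) rest r _ (u ∷ _) with run-head r
    ... | e = ⊥-elim (All.lookup u (here refl) (sym (cong κ (trans (sym e) (triv 0)))))
    go [] [] _ _ _ = refl
    go [] ((a ∷ []) ∷ _) _ ((_ , s≤s ()) ∷ _) _
    go [] ((a ∷ b ∷ D) ∷ rest) _ (((_ , step (step {x = _} r)) , _) ∷ _) (_ ∷ u ∷ _) =
      ⊥-elim (All.lookup u (here refl) (sym (cong κ (stay a))))

  module Flip {β β′ : ℕ → ℕ} {u e f : ℕ} (S : Swap β β′ 0 u e f)
              (inv : ∀ x → β (β x) ≡ x) (e≢0 : e ≢ 0) (e≢u : e ≢ u) where
    open Swap S renaming (βa to β0; βc to βe)

    βu : β u ≡ 0
    βu = trans (cong β (sym β0)) (inv 0)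

    βf : β f ≡ e
    βf = trans (cong β (sym βe)) (inv e)

    Off : ℕ → Set
    Off z = z ≢ 0 × z ≢ u × z ≢ e × z ≢ f

    off-κ : ∀ {z} → κ z ≢ κ 0 → κ z ≢ κ u → κ z ≢ κ e → κ z ≢ κ f → Off z
    off-κ a b c d = a ∘ cong κ , b ∘ cong κ , c ∘ cong κ , d ∘ cong κ

    off-β : ∀ {z} → Off z → Off (β z)
    off-β {z} (a , b , c , d) =
      (λ h → b (flip′ h β0)) , (λ h → a (flip′ h βu)) , (λ h → d (flip′ h βe)) , (λ h → c (flip′ h βf))
      where
      flip′ : ∀ {s t} → β z ≡ s → β s ≡ t → z ≡ t
      flip′ h k = trans (sym (inv z)) (trans (cong β h) k)

    β′-off : ∀ {z} → Off z → β′ z ≡ β z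
    β′-off (a , b , c , d) = other _ a b c d

    -- The black edges inside the walk end in the labels `zs`, which avoid the four changed labels.
    -- The last one departs from `β y`, so under β′ the walk ends in `β′ (β y)`.
    transfer : ∀ {x z zs y} → Run β x (z ∷ zs) y → All Off zs → Run β′ x (z ∷ zs) (β′ (β y))
    transfer {x} (step done) [] = step (subst (Run β′ _ []) (cong β′ (sym (inv _))) done)
    transfer {y = y} (step r@(step _)) (o ∷ os) =
      step (subst (λ s → Run β′ s _ (β′ (β y))) (sym (β′-off (subst Off (inv _) (off-β o)))) (transfer r os))

    exit-e : β′ (β e) ≡ u
    exit-e = trans (cong β′ βe) at-d

    exit-0 : β′ (β 0) ≡ f
    exit-0 = trans (cong β′ β0) at-b

    exit-off : ∀ {y} → Off y → β′ (β y) ≡ y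
    exit-off o = trans (β′-off (off-β o)) (inv _)

    transfer-to : ∀ {x z zs y y′} → Run β x (z ∷ zs) y → All Off zs → β′ (β y) ≡ y′ → Run β′ x (z ∷ zs) y′
    transfer-to {x} {z} {zs} r os h = subst (Run β′ x (z ∷ zs)) h (transfer r os)

    transfer-closed : ∀ {D} → All Off D → Closed β D → Closed β′ D
    transfer-closed {z ∷ zs} (o ∷ os) ((x , r) , h) with run-head r
    ... | refl = (x , transfer-to r os (exit-off o)) , h

    transfer-rest : ∀ {rest} → All Off (concat rest) → All (Closed β) rest → All (Closed β′) rest
    transfer-rest {[]}       _ []       = []
    transfer-rest {D ∷ rest} o (c ∷ cs) =
      transfer-closed (All.++⁻ˡ D o) c ∷ transfer-rest (All.++⁻ʳ D o) cs

    -- u is the first label of the leftmost cycle; if l is empty, it is 1, represented by 0.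
    κu-lead : ∀ {l} → Run β (β 0) l 1 → ∃ λ w → w ∈ 0 ∷ l × κ u ≡ κ w
    κu-lead {[]}    r = 0 , here refl , cong κ (trans (sym β0) (run-nil r))
    κu-lead {z ∷ l} r = z , there (here refl) , cong κ (trans (sym β0) (run-head r))

    lead-β′ : ∀ {l} → Run β′ e l 1 → Run β′ (β′ 0) l 1
    lead-β′ = subst (λ s → Run β′ s _ 1) (sym at-a)

    cover-β′ : ∀ {l rest L} → Decomp β l rest →
      (∀ x → κ x ∉ L → κ x ∉ map κ (support l rest)) → κ 0 ∈ L → κ u ∈ L → κ e ∈ L → κ f ∈ L →
      ∀ x → κ x ∉ L → β′ x ≡ partner x
    cover-β′ {L = L} d sub k0 ku ke kf x n =
      trans (β′-off (off-κ (miss k0) (miss ku) (miss ke) (miss kf))) (Decomp.cover d x (sub x n))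
      where
      miss : ∀ {k} → k ∈ L → κ x ≢ k
      miss h q = n (subst (_∈ L) (sym q) h)

    -- The second effect is a 1-cycle split off the front, the third a merge with a listed cycle.
    -- They record, besides the weight, what is needed to carry `Coherent` across the flip.
    record Outcome (l : List ℕ) (rest : List (List ℕ)) : Set where
      constructor outcome
      field
        {l′}    : List ℕ
        {rest′} : List (List ℕ)
        decomp  : Decomp β′ l′ rest′
        effect  : weight l rest ≤ weight l′ rest′
                ⊎ weight l rest ≡ suc (weight l′ rest′) × l ≡ u ∷ l′ × f ≡ partner u × κ e ∈ map κ (0 ∷ l)
                ⊎ weight l rest ≡ suc (weight l′ rest′) × ∃ λ D → l′ ≡ D ++ l × κ e ∈ map κ D × κ f ∈ map κ D

    -- After the flip the walk from 0 goes round the cycle of e and then, through the new edge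
    -- {f,u}, along l. The list `rest′` is a parameter because the cycle of e may be a 1-cycle,
    -- which `rest` does not contain.
    module Join {l rest rest′ Q} (d : Decomp β l rest) (r : Run β e (e ∷ Q) e)
                (U : Unique (map κ (support ((e ∷ Q) ++ l) rest′))) (cs : All (Closed β) rest′)
                (sub : ∀ x → κ x ∉ map κ (support ((e ∷ Q) ++ l) rest′) → κ x ∉ map κ (support l rest))
                where
      private
        E = e ∷ Q
        C = concat rest′

        U₁ : Unique (map κ (0 ∷ E ++ (l ++ C)))
        U₁ = subst (λ z → Unique (map κ (0 ∷ z))) (++-assoc E l C) U
        U₂ = uniq-++ʳ [ 0 ] U₁
        U₃ = uniq-++ʳ E U₂

        b = proj₁ (run-last inv r)
        b∈ : b ∈ E
        b∈ = proj₁ (proj₂ (run-last inv r))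
        b≡ : partner b ≡ f
        b≡ = trans (proj₂ (proj₂ (run-last inv r))) βe
        κf : κ f ≡ κ b
        κf = trans (cong κ (sym b≡)) (half-partner b)

        E≢0 : ∀ {z} → z ∈ E → κ z ≢ κ 0
        E≢0 h q = sep [ 0 ] U₁ (here refl) (∈-++⁺ˡ h) (sym q)

        E≢u : ∀ {z} → z ∈ E → κ z ≢ κ u
        E≢u h q with κu-lead (Decomp.lead d)
        ... | w , here refl , q′ = E≢0 h (trans q q′)
        ... | w , there k , q′   = sep E U₂ h (∈-++⁺ˡ k) (trans q q′)

        -- f is `partner b` with b on E, and E meets each grey edge only once, so f is not on E.
        off-Q : All Off Q
        off-Q = All.tabulate λ h → (E≢0 (there h) ∘ cong κ) , (E≢u (there h) ∘ cong κ)
          , (λ q → sep [ e ] U₂ (here refl) (∈-++⁺ˡ h) (cong κ (sym q)))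
          , (λ q → not-both (uniq-++ˡ E U₂) b∈ (subst (_∈ E) (trans q (sym b≡)) (there h)))

        lC≢ : ∀ {w} → w ∈ l ++ C → κ w ≢ κ 0 × κ w ≢ κ e × κ w ≢ κ f
        lC≢ k = (λ q → sep [ 0 ] U₁ (here refl) (∈-++⁺ʳ E k) (sym q))
          , (λ q → sep E U₂ (here refl) k (sym q)) , (λ q → sep E U₂ b∈ k (sym (trans q κf)))

        off-C : All Off C
        off-C = All.tabulate off
          where
          off : ∀ {w} → w ∈ C → Off w
          off k with lC≢ (∈-++⁺ʳ l k) | κu-lead (Decomp.lead d)
          ... | n0 , ne , nf | _ , here refl , q = off-κ n0 (λ q′ → n0 (trans q′ q)) ne nf
          ... | n0 , ne , nf | _ , there h , q   = off-κ n0 (λ q′ → sep l U₃ h k (sym (trans q′ q))) ne nf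

        lead-l : ∀ {l₀} → l ≡ l₀ → Run β (β 0) l₀ 1 → Run β′ u l₀ 1
        lead-l {[]} _ r₀ = subst (λ s → Run β′ s [] 1) (trans (sym (run-nil r₀)) β0) done
        lead-l {z ∷ l₀} refl r₀ with trans (sym β0) (run-head r₀)
        ... | refl = transfer-to (subst (λ s → Run β s _ 1) β0 r₀) off-l (exit-off off-1)
          where
          off-l : All Off l₀
          off-l = All.tabulate λ h → let n0 , ne , nf = lC≢ (∈-++⁺ˡ (there h)) in
            off-κ n0 (λ q → sep [ z ] U₃ (here refl) (∈-++⁺ˡ h) (sym q)) ne nf
          off-1 : Off 1
          off-1 = (λ ()) , (λ q → proj₁ (lC≢ (here refl)) (cong κ (sym q)))
            , (λ q → E≢0 (here refl) (cong κ (sym q)))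
            , (λ q → E≢0 b∈ (trans (sym κf) (cong κ (sym q))))

      join : Decomp β′ (E ++ l) rest′
      join = record
        { lead   = lead-β′ (run-++ (transfer-to r off-Q exit-e) (lead-l refl (Decomp.lead d)))
        ; closed = transfer-rest off-C cs
        ; unique = U
        ; cover  = cover-β′ d sub (here refl) ku (there (here refl))
                     (subst (_∈ L) (sym κf) (∈-map⁺ κ (∈-++⁺ʳ [ 0 ] (∈-++⁺ˡ (∈-++⁺ˡ b∈)))))
        }
        where
        L = map κ (support (E ++ l) rest′)
        ku : κ u ∈ L
        ku with κu-lead (Decomp.lead d)
        ... | w , here refl , q = here q
        ... | w , there k , q   = subst (_∈ L) (sym q) (∈-map⁺ κ (∈-++⁺ʳ [ 0 ] (∈-++⁺ˡ (∈-++⁺ʳ E k))))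

      κe∈ : κ e ∈ map κ E
      κe∈ = here refl

      κf∈ : κ f ∈ map κ E
      κf∈ = subst (_∈ map κ E) (sym κf) (∈-map⁺ κ b∈)

    -- The walk along the leftmost cycle arrives at e through the black edge from f. The flip leads
    -- 0 straight to e, while the part before e closes up through {f,u}.
    module Split {rest A B} (d : Decomp β ((u ∷ A) ++ B) rest)
                 (r : Run β u (u ∷ A) e) (s : Run β e B 1) where
      private
        uA = u ∷ A
        C = concat rest

        U₁ : Unique (map κ (0 ∷ uA ++ (B ++ C)))
        U₁ = subst (λ z → Unique (map κ (0 ∷ z))) (++-assoc uA B C) (Decomp.unique d)
        U₂ = uniq-++ʳ [ 0 ] U₁
        U₃ = uniq-++ʳ uA U₂

        b = proj₁ (run-last inv r)
        b∈ : b ∈ uA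
        b∈ = proj₁ (proj₂ (run-last inv r))
        b≡ : partner b ≡ f
        b≡ = trans (proj₂ (proj₂ (run-last inv r))) βe
        κf : κ f ≡ κ b
        κf = trans (cong κ (sym b≡)) (half-partner b)

        e∈ : e ∈ 0 ∷ B ⊎ e ≡ 1
        e∈ = run-first s

        ≢0 : ∀ {z} → z ∈ uA ++ (B ++ C) → κ z ≢ κ 0
        ≢0 h q = sep [ 0 ] U₁ (here refl) h (sym q)

        A≢e : ∀ {z} → z ∈ uA → κ z ≢ κ e
        A≢e h q with e∈
        ... | inj₁ (here refl) = e≢0 refl
        ... | inj₁ (there k)   = sep uA U₂ h (∈-++⁺ˡ k) q
        ... | inj₂ refl        = ≢0 (∈-++⁺ˡ h) q

        off-A : All Off A
        off-A = All.tabulate λ h → (≢0 (∈-++⁺ˡ (there h)) ∘ cong κ)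
          , (λ q → sep [ u ] U₂ (here refl) (∈-++⁺ˡ h) (cong κ (sym q)))
          , (A≢e (there h) ∘ cong κ)
          , (λ q → not-both (uniq-++ˡ uA U₂) b∈ (subst (_∈ uA) (trans q (sym b≡)) (there h)))

        BC≢ : ∀ {w} → w ∈ B ++ C → κ w ≢ κ 0 × κ w ≢ κ u × κ w ≢ κ f
        BC≢ k = ≢0 (∈-++⁺ʳ uA k) , (λ q → sep uA U₂ (here refl) k (sym q))
          , (λ q → sep uA U₂ b∈ k (sym (trans q κf)))

        off-C : All Off C
        off-C = All.tabulate off
          where
          off : ∀ {w} → w ∈ C → Off w
          off k with BC≢ (∈-++⁺ʳ B k) | e∈
          ... | n0 , nu , nf | inj₁ (here refl) = ⊥-elim (e≢0 refl)
          ... | n0 , nu , nf | inj₁ (there h)   = off-κ n0 nu (λ q → sep B U₃ h k (sym q)) nf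
          ... | n0 , nu , nf | inj₂ refl        = off-κ n0 nu n0 nf

        lead-B : ∀ {B₀} → B ≡ B₀ → Run β e B₀ 1 → Run β′ e B₀ 1
        lead-B {[]} _ s₀ = subst (λ t → Run β′ t [] 1) (sym (run-nil s₀)) done
        lead-B {z ∷ B₀} refl s₀ with run-head s₀
        ... | refl = transfer-to s₀ off-B (exit-off off-1)
          where
          off-B : All Off B₀
          off-B = All.tabulate λ h → let n0 , nu , nf = BC≢ (∈-++⁺ˡ (there h)) in
            off-κ n0 nu (λ q → sep [ z ] U₃ (here refl) (∈-++⁺ˡ h) (sym q)) nf
          off-1 : Off 1
          off-1 = (λ ()) , (λ q → ≢0 (here refl) (cong κ (sym q)))
            , (λ q → proj₁ (BC≢ (here refl)) (cong κ (sym q)))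
            , (λ q → ≢0 (∈-++⁺ˡ b∈) (trans (sym κf) (cong κ (sym q))))

        lead′ : Run β′ (β′ 0) B 1
        lead′ = lead-β′ (lead-B refl s)

        κe∈ : ∀ L → κ e ∈ map κ (0 ∷ B ++ L)
        κe∈ L with e∈
        ... | inj₁ (here refl) = here refl
        ... | inj₁ (there k)   = there (∈-map⁺ κ (∈-++⁺ˡ k))
        ... | inj₂ refl        = here refl

      -- The part cut off is a 1-cycle. It leaves the lists, so its grey edge must be shown to be
      -- accounted for by `cover`.
      split₁ : A ≡ [] → Outcome (uA ++ B) rest
      split₁ refl = outcome (record
          { lead = lead′ ; closed = transfer-rest off-C (Decomp.closed d)
          ; unique = unique′ U₁ ; cover = cover′ })
        (inj₂ (inj₁ (refl , refl , f≡ , κe′)))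
        where
        b≡u : b ≡ u
        b≡u with b∈
        ... | here q = q
        f≡ : f ≡ partner u
        f≡ = trans (sym b≡) (cong partner b≡u)
        κe′ : κ e ∈ map κ (0 ∷ u ∷ B)
        κe′ with e∈
        ... | inj₁ (here refl) = here refl
        ... | inj₁ (there k)   = there (there (∈-map⁺ κ k))
        ... | inj₂ refl        = here refl
        unique′ : Unique (map κ (0 ∷ u ∷ B ++ C)) → Unique (map κ (0 ∷ B ++ C))
        unique′ ((_ ∷ p) ∷ _ ∷ q) = p ∷ q
        cover′ : ∀ x → κ x ∉ map κ (support B rest) → β′ x ≡ partner x
        cover′ x n with κ x ≟ κ u
        ... | yes q with half-≡ x u q
        ... | inj₁ refl = trans at-b f≡
        ... | inj₂ refl = trans (cong β′ (sym f≡)) (trans at-d (sym (partner-involutive u)))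
        cover′ x n | no q = trans
          (β′-off (off-κ (n ∘ here) q (λ q′ → n (subst (_∈ _) (sym q′) (κe∈ C)))
            (λ q′ → q (trans q′ (trans κf (cong κ b≡u))))))
          (Decomp.cover d x λ { (here h) → n (here h) ; (there (here h)) → q h
                              ; (there (there h)) → n (there h) })

      -- A part of k labels, k ≥ 2, costs the leftmost cycle k and reappears with weight k + 1: the
      -- weight grows.
      split₂ : 1 ≤ length A → Outcome (uA ++ B) rest
      split₂ h = outcome {rest′ = uA ∷ rest} (record
          { lead = lead′
          ; closed = ((u , transfer-to r off-A exit-e) , s≤s h) ∷ transfer-rest off-C (Decomp.closed d)
          ; unique = unique-↭ perm U₁
          ; cover = cover-β′ d (λ x n k → n (↭.∈-resp-↭ perm′ k)) (here refl)
              (∈L (here refl)) (κe∈ (uA ++ C)) (subst (_∈ L) (sym κf) (∈L b∈)) })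
        (inj₁ weight-≤)
        where
        L = map κ (support B (uA ∷ rest))
        ∈L : ∀ {z} → z ∈ uA → κ z ∈ L
        ∈L k = ∈-map⁺ κ (∈-++⁺ʳ (0 ∷ B) (∈-++⁺ˡ k))
        perm : map κ (0 ∷ uA ++ (B ++ C)) ↭ L
        perm = ↭.map⁺ κ (prep 0 (↭.shifts uA B))
        perm′ : map κ (support (uA ++ B) rest) ↭ L
        perm′ = ↭-trans (↭-reflexive (cong (λ z → map κ (0 ∷ z)) (++-assoc uA B C))) perm
        regroup : ∀ a b w → b + (suc a + w) ≡ suc (a + b + w)
        regroup = solve-∀
        weight-≤ : weight (uA ++ B) rest ≤ weight B (uA ∷ rest)
        weight-≤ = subst₂ _≤_ (cong (_+ weights rest) (sym (length-++ uA {B})))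
          (sym (regroup (length uA) (length B) (weights rest))) (n≤1+n _)

    split : ∀ {rest} A {B} → Decomp β (A ++ B) rest → Run β u A e → Run β e B 1 → Outcome (A ++ B) rest
    split []      d r s = ⊥-elim (e≢u (sym (run-nil r)))
    split (a ∷ A) d r s with run-head r
    split (a ∷ [])     d r s | refl = Split.split₁ d r s refl
    split (a ∷ a′ ∷ A) d r s | refl = Split.split₂ d r s (s≤s z≤n)

    -- Here the walk runs through the black edge from e to f. The flip turns the part before it
    -- around, and all lengths stay the same.
    module Reverse {P z Q rest} (d : Decomp β (P ++ z ∷ Q) rest) (e≡ : e ≡ partner z) where
      private
        C pre pre′ : List ℕ
        C = concat rest
        pre = P ++ [ z ]
        pre′ = e ∷ map partner (reverse P)

        U₁ : Unique (map κ (0 ∷ P ++ (z ∷ Q ++ C)))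
        U₁ = subst (λ w → Unique (map κ (0 ∷ w))) (++-assoc P (z ∷ Q) C) (Decomp.unique d)
        U₂ = uniq-++ʳ [ 0 ] U₁
        U₃ = uniq-++ʳ P U₂

        f≡ : β (partner z) ≡ f
        f≡ = trans (cong β (sym e≡)) βe

        κe : κ e ≡ κ z
        κe = trans (cong κ e≡) (half-partner z)

        runs : Run β u pre f × Run β f Q 1
        runs with run-split P (subst (λ s → Run β s (P ++ z ∷ Q) 1) β0 (Decomp.lead d))
        ... | m , r , step r′ = run-++ r (step (subst (Run β (β (partner z)) []) f≡ done))
                              , subst (λ s → Run β s Q 1) f≡ r′

        u∈ : u ∈ pre
        u∈ = go P (proj₁ runs)
          where
          go : ∀ P → Run β u (P ++ [ z ]) f → u ∈ P ++ [ z ]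
          go []      r = here (run-head r)
          go (a ∷ P) r = here (run-head r)

        pre-≡ : map partner (reverse pre) ≡ pre′
        pre-≡ = trans (cong (map partner) (reverse-++ P [ z ])) (cong (_∷ _) (sym e≡))

        reversed : Run β e pre′ 0
        reversed = subst₂ (λ s l → Run β s l 0) βf pre-≡
          (subst (Run β (β f) _) βu (run-reverse inv (proj₁ runs)))

        P≢ : ∀ {p} → p ∈ P → κ p ≢ κ 0 × κ p ≢ κ z × κ p ≢ κ f
        P≢ h = (λ q → n0 (sym q)) , sep P U₂ h (here refl) , nf
          where
          n0 = sep [ 0 ] U₁ (here refl) (∈-++⁺ˡ h)
          nf : _
          nf q with run-first (proj₂ runs)
          ... | inj₁ (here refl) = n0 (sym q)
          ... | inj₁ (there k)   = sep P U₂ h (there (∈-++⁺ˡ k)) q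
          ... | inj₂ refl        = n0 (sym q)

        upre : Unique (map κ (pre ++ (Q ++ C)))
        upre = subst (Unique ∘ map κ) (sym (++-assoc P [ z ] (Q ++ C))) U₂

        off-pre : All Off (map partner (reverse P))
        off-pre = All.tabulate λ h → off h
          where
          off : ∀ {w} → w ∈ map partner (reverse P) → Off w
          off h with ∈-map⁻ partner h
          ... | p , k , refl with P≢ (∈-reverse⁻ k)
            where
            ∈-reverse⁻ : ∀ {p} → p ∈ reverse P → p ∈ P
            ∈-reverse⁻ = ↭.∈-resp-↭ (↭.↭-reverse P)
          ... | n0 , nz , nf = (n0 ∘ back) , nu , (nz ∘ (λ q → trans (back q) κe)) , (nf ∘ back)
            where
            back : ∀ {t} → partner p ≡ t → κ p ≡ κ t
            back q = trans (sym (half-partner p)) (cong κ q)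
            nu : partner p ≢ u
            nu q = not-both (uniq-++ˡ pre upre) (∈-++⁺ˡ (↭.∈-resp-↭ (↭.↭-reverse P) k))
                     (subst (_∈ pre) (sym q) u∈)

        QC≢ : ∀ {w} → w ∈ Q ++ C → κ w ≢ κ 0 × κ w ≢ κ u × κ w ≢ κ e
        QC≢ k = (λ q → sep [ 0 ] U₁ (here refl) (∈-++⁺ʳ P (there k)) (sym q))
          , (λ q → sep pre upre u∈ k (sym q))
          , (λ q → sep [ z ] U₃ (here refl) k (sym (trans q κe)))

        off-C : All Off C
        off-C = All.tabulate off
          where
          off : ∀ {w} → w ∈ C → Off w
          off k with QC≢ (∈-++⁺ʳ Q k) | run-first (proj₂ runs)
          ... | n0 , nu , ne | inj₁ (here refl) = off-κ n0 nu ne n0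
          ... | n0 , nu , ne | inj₁ (there h)   = off-κ n0 nu ne (λ q → sep Q (uniq-++ʳ [ z ] U₃) h k (sym q))
          ... | n0 , nu , ne | inj₂ refl        = off-κ n0 nu ne n0

        tail : ∀ {Q₀} → Q ≡ Q₀ → Run β f Q₀ 1 → Run β′ f Q₀ 1
        tail {[]} _ s₀ = subst (λ t → Run β′ t [] 1) (sym (run-nil s₀)) done
        tail {q₀ ∷ Q₀} refl s₀ with run-head s₀
        ... | refl = transfer-to s₀ off-Q (exit-off off-1)
          where
          off-Q : All Off Q₀
          off-Q = All.tabulate λ h → let n0 , nu , ne = QC≢ (∈-++⁺ˡ (there h)) in
            off-κ n0 nu ne (λ q → sep [ f ] (uniq-++ʳ [ z ] U₃) (here refl) (∈-++⁺ˡ h) (sym q))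
          off-1 : Off 1
          off-1 = (λ ()) , (λ q → sep [ 0 ] U₁ (here refl) (subst (_ ∈_) (++-assoc P [ z ] (Q ++ C)) (∈-++⁺ˡ u∈)) (cong κ q))
            , (λ q → sep [ 0 ] U₁ (here refl) (∈-++⁺ʳ P (here refl)) (trans (cong κ q) κe))
            , (λ q → proj₁ (QC≢ (here refl)) (cong κ (sym q)))

      reverse′ : Outcome (P ++ z ∷ Q) rest
      reverse′ = outcome {l′ = pre′ ++ Q} (record
          { lead = lead-β′ (run-++ (transfer-to reversed off-pre exit-0) (tail refl (proj₂ runs)))
          ; closed = transfer-rest off-C (Decomp.closed d)
          ; unique = unique-↭ perm (Decomp.unique d)
          ; cover = cover-β′ d (λ x n k → n (↭.∈-resp-↭ perm k)) (here refl)
              (↭.∈-resp-↭ perm (∈-map⁺ κ (∈-++⁺ʳ [ 0 ] (∈-++⁺ˡ (subst (u ∈_) pQ (∈-++⁺ˡ u∈))))))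
              (there (here refl)) κf })
        (inj₁ (≤-reflexive (cong (_+ weights rest) length-≡)))
        where
        pQ : pre ++ Q ≡ P ++ z ∷ Q
        pQ = ++-assoc P [ z ] Q
        κ-map-partner : ∀ xs → map κ (map partner xs) ≡ map κ xs
        κ-map-partner xs = trans (sym (map-∘ xs)) (map-cong half-partner xs)
        κ-pre : map κ pre ↭ map κ pre′
        κ-pre = ↭-trans (↭-sym (↭.map⁺ κ (↭.↭-reverse pre)))
          (↭-reflexive (trans (sym (κ-map-partner (reverse pre))) (cong (map κ) pre-≡)))
        perm : map κ (support (P ++ z ∷ Q) rest) ↭ map κ (support (pre′ ++ Q) rest)
        perm = prep 0 (subst₂ _↭_
          (trans (sym (map-++ κ pre (Q ++ C))) (cong (map κ) (trans (sym (++-assoc pre Q C)) (cong (_++ C) pQ))))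
          (trans (sym (map-++ κ pre′ (Q ++ C))) (cong (map κ) (sym (++-assoc pre′ Q C))))
          (↭.++⁺ʳ (map κ (Q ++ C)) κ-pre))
        length-≡ : length (P ++ z ∷ Q) ≡ length (pre′ ++ Q)
        length-≡ = trans (cong length (sym pQ)) (trans (length-++ pre) (trans
          (cong (_+ length Q) (trans (sym (length-reverse pre)) (trans (sym (length-map partner (reverse pre))) (cong length pre-≡))))
          (sym (length-++ pre′))))
        κf : κ f ∈ map κ (support (pre′ ++ Q) rest)
        κf with run-first (proj₂ runs)
        ... | inj₁ (here q)  = subst (λ t → κ t ∈ _) (sym q) (here refl)
        ... | inj₁ (there k) = ∈-map⁺ κ (∈-++⁺ʳ [ 0 ] (∈-++⁺ˡ (∈-++⁺ʳ pre′ k)))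
        ... | inj₂ q         = subst (λ t → κ t ∈ _) (sym q) (here refl)

    -- D weighs one more than its length as a cycle of its own and exactly its length inside the
    -- leftmost cycle.
    join-rotated : ∀ {l} R₁ {D R₂} → Decomp β l (R₁ ++ D ∷ R₂) →
      ∀ {Q} → Run β e (e ∷ Q) e → map κ (e ∷ Q) ↭ map κ D → length (e ∷ Q) ≡ length D →
      Outcome l (R₁ ++ D ∷ R₂)
    join-rotated {l} R₁ {D} {R₂} d {Q} r p len = outcome
      (J.join d r (unique-↭ perm (Decomp.unique d)) closed′ (λ x n k → n (↭.∈-resp-↭ perm k)))
      (inj₂ (inj₂ (weight-≡ , e ∷ Q , refl , J.κe∈ d r U′ closed′ sub′ , J.κf∈ d r U′ closed′ sub′)))
      where
      module J = Join {l} {R₁ ++ D ∷ R₂} {R₁ ++ R₂} {Q}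
      closed′ : All (Closed β) (R₁ ++ R₂)
      closed′ with All.++⁻ R₁ (Decomp.closed d)
      ... | a , _ ∷ b = All.++⁺ a b
      perm : map κ (support l (R₁ ++ D ∷ R₂)) ↭ map κ (support ((e ∷ Q) ++ l) (R₁ ++ R₂))
      perm = prep 0 (↭-trans (↭.map⁺ κ move) (↭-trans (↭-reflexive (map-++ κ D _))
        (↭-trans (↭.++⁺ʳ _ (↭-sym p)) (↭-reflexive (trans (sym (map-++ κ (e ∷ Q) _)) (cong (map κ) (sym (++-assoc (e ∷ Q) l _))))))))
        where
        move : l ++ concat (R₁ ++ D ∷ R₂) ↭ D ++ (l ++ concat (R₁ ++ R₂))
        move = ↭-trans (↭-reflexive (cong (l ++_) (sym (concat-++ R₁ (D ∷ R₂)))))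
          (↭-trans (↭.++⁺ˡ l (↭.shifts (concat R₁) D))
          (↭-trans (↭.shifts l D) (↭-reflexive (cong (λ z → D ++ (l ++ z)) (concat-++ R₁ R₂)))))
      U′ = unique-↭ perm (Decomp.unique d)
      sub′ = λ x n k → n (↭.∈-resp-↭ perm k)
      weights-mid : ∀ R → weights (R ++ D ∷ R₂) ≡ suc (length D) + weights (R ++ R₂)
      weights-mid []      = refl
      weights-mid (E ∷ R) = trans (cong (_+_ (suc (length E))) (weights-mid R)) (swap+ (length E) (length D) _)
        where
        swap+ : ∀ a b c → suc a + (suc b + c) ≡ suc b + (suc a + c)
        swap+ = solve-∀
      weight-≡ : weight l (R₁ ++ D ∷ R₂) ≡ suc (weight ((e ∷ Q) ++ l) (R₁ ++ R₂))
      weight-≡ = trans (cong (_+_ (length l)) (weights-mid R₁)) (trans (regroup (length l) (length D) (weights (R₁ ++ R₂)))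
        (cong (λ z → suc (z + weights (R₁ ++ R₂))) (trans (cong (_+ length l) (sym len)) (sym (length-++ (e ∷ Q))))))
        where
        regroup : ∀ a b c → a + (suc b + c) ≡ suc (b + a + c)
        regroup = solve-∀

    -- The cases are where the grey edge of e lies, and then in which direction the listed walk
    -- traverses it.
    one-step : ∀ {l rest} → Decomp β l rest → Outcome l rest
    one-step {l} {rest} d with κ e ∈? map κ (support l rest)
    -- Off the support e lies on a 1-cycle, which weighs nothing; absorbing it lengthens the
    -- leftmost cycle by one.
    ... | no n = outcome (J.join d r U (Decomp.closed d) sub) (inj₁ (n≤1+n _))
      where
      module J = Join {l} {rest} {rest} {[]}
      sub : ∀ x → κ x ∉ map κ (support (e ∷ l) rest) → κ x ∉ map κ (support l rest)
      sub x n′ (here q)  = n′ (here q)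
      sub x n′ (there k) = n′ (there (there k))
      βe≡ : β e ≡ partner e
      βe≡ = Decomp.cover d e n
      r : Run β e [ e ] e
      r = step (subst (λ s → Run β s [] e) (trans (sym (inv e)) (cong β βe≡)) done)
      U : Unique (map κ (support (e ∷ l) rest))
      U with Decomp.unique d
      ... | a ∷ b = ((λ q → n (here (sym q))) ∷ a) ∷ All.tabulate (λ h q → n (there (subst (_∈ _) (sym q) h))) ∷ b
    ... | yes h with ∈-map⁻ κ {xs = support l rest} h
    ... | z , here refl , q with half-≡ e 0 q
    ... | inj₁ e≡ = ⊥-elim (e≢0 e≡)
    -- Now e is 1, the end of the leftmost cycle: the whole list l is cut off and B is empty.
    ... | inj₂ e≡ = subst (λ l → Outcome l rest) (++-identityʳ l)
      (split l (subst (λ l → Decomp β l rest) (sym (++-identityʳ l)) d)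
        (subst₂ (λ s t → Run β s l t) β0 (sym e≡) (Decomp.lead d))
        (subst (λ s → Run β s [] 1) (sym e≡) done))
    one-step {l} {rest} d | yes h | z , there k , q with ∈-++⁻ l k
    ... | inj₁ k′ with ∈-∃++ k′
    ... | P , Q , refl with half-≡ e z q
    ... | inj₂ e≡ = Reverse.reverse′ d e≡
    ... | inj₁ refl with run-split P (subst (λ s → Run β s (P ++ e ∷ Q) 1) β0 (Decomp.lead d))
    ... | m , r , s with run-head s
    ... | refl = split P d r s
    one-step {l} {rest} d | yes h | z , there k , q | inj₂ k′ with ∈-concat⁻′ rest k′
    ... | D , z∈D , D∈ with ∈-∃++ D∈
    ... | R₁ , R₂ , refl with All.lookup (Decomp.closed d) (∈-++⁺ʳ R₁ (here refl)) | half-≡ e z q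
    ... | (x , r) , _ | inj₁ refl with rotate r z∈D
    ... | Q , r′ , p = join-rotated R₁ d r′ (↭.map⁺ κ p) (↭.↭-length p)
    one-step {l} d | yes h | z , there k , q | inj₂ k′ | D , z∈D , D∈ | R₁ , R₂ , refl | (x , r) , _ | inj₂ e≡
      with rotate (run-reverse inv r)
             (subst (_∈ map partner (reverse D)) (sym e≡) (∈-map⁺ partner (↭.∈-resp-↭ (↭-sym (↭.↭-reverse D)) z∈D)))
    ... | Q , r′ , p = join-rotated R₁ d r′
      (↭-trans (↭.map⁺ κ p) (↭-trans (↭-reflexive (trans (sym (map-∘ (reverse D))) (map-cong half-partner (reverse D))))
        (↭.map⁺ κ (↭.↭-reverse D))))
      (trans (↭.↭-length p) (trans (length-map partner (reverse D)) (length-reverse D)))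

open CycleLists

-- The lower bounds: by weight, and one better for a coherent configuration.

module LowerBound where
  open import Data.Nat
  open import Data.Nat.Properties

  Valid : List ℤ → ℕ → Set
  Valid σ j = 1 ≤ j × j ≤ length σ

  length-take-≤ : ∀ {A : Set} {j} {σ : List A} → j ≤ length σ → length (take j σ) ≡ j
  length-take-≤ {j = j} {σ} h = trans (length-take j σ) (m≤n⇒m⊓n≡m h)

  length-prefixRev : ∀ j σ → length (prefixRev j σ) ≡ length σ
  length-prefixRev j σ =
    trans (length-flip-mid [] (take j σ)) (cong length (take++drop≡id j σ))

  Perm-prefixRev : ∀ j {σ} → Perm σ → Perm (prefixRev j σ)
  Perm-prefixRev j {σ} P = Perm-flip [] (take j σ) (subst Perm (sym (take++drop≡id j σ)) P)

  revOf-prefixRev : ∀ {j σ} (P : Perm σ) → j ≤ length σ → RevOf (cfg P) (cfg (Perm-prefixRev j P)) 0 j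
  revOf-prefixRev {j} {σ} P h p = trans
    (revOf-flip [] (take j σ) (subst Perm (sym (take++drop≡id j σ)) P) (Perm-prefixRev j P) p)
    (cong₂ labOf (take++drop≡id j σ) (cong (λ k → rev 0 k p) (length-take-≤ h)))

  at-ascend : ∀ k n p → p < n → at (ascend k n) p ≡ k + p
  at-ascend k (suc n) zero    _       = sym (+-identityʳ k)
  at-ascend k (suc n) (suc p) (s≤s l) = trans (at-ascend (suc k) n p l) (sym (+-suc k p))

  length-ι : ∀ n → length (ι n) ≡ n
  length-ι n = trans (length-map _ (upTo n)) (length-upTo n)

  ext-ι : ∀ n → ext (ι n) ≡ ascend 0 (dbl (suc n))
  ext-ι n = trans (cong₂ (λ a b → 0 ∷ a ∷ʳ b) body (trans (cong (λ z → 2 * z + 1) (length-ι n)) (last-label n)))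
                  (cong (0 ∷_) (ascend-∷ʳ 1 (dbl n)))
    where
    expand-suc : ∀ xs → concatMap expand (map (λ i → + suc i) xs) ≡ concatMap pair (map suc xs)
    expand-suc []       = refl
    expand-suc (x ∷ xs) = cong (pair (suc x) ++_) (expand-suc xs)
    body : concatMap expand (ι n) ≡ ascend 1 (dbl n)
    body = trans (expand-suc (upTo n))
             (trans (cong (concatMap pair ∘ map suc) (upTo-ascend n)) (concatMap-pair-ascend 0 n))

  labOf-ι : ∀ n p → labOf (ι n) p ≡ p
  labOf-ι n p with p <? dbl (suc (length (ι n)))
  ... | no k  = labOf-≮ {ι n} k
  ... | yes l = trans (labOf-< {ι n} l) (trans (cong (λ z → at z p) (ext-ι n))
                  (at-ascend 0 _ p (subst (λ z → p < dbl (suc z)) (length-ι n) l)))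

  β-ι : ∀ {n σ} (P : Perm σ) → σ ≡ ι n → ∀ x → Cfg.β (cfg P) x ≡ partner x
  β-ι {n} P refl x = trans (labOf-ι n _) (cong partner (trans (sym (labOf-ι n _)) (Cfg.lab-pos (cfg P) x)))

  module FirstFlip {σ} (P : Perm σ) {j} (v : Valid σ j) where
    P′ = Perm-prefixRev j P
    open Cfg (cfg P)
    module C′ = Cfg (cfg P′)
    u = lab 1
    e = lab (dbl j)
    f = lab (suc (dbl j))

    flipped : Swap β C′.β 0 u e f
    flipped = subst (λ z → Swap β C′.β z u e f) lab-0
      (swap-rev {cfg P} {cfg P′} (revOf-prefixRev P (proj₂ v)) (proj₁ v))

    e≢0 : e ≢ 0
    e≢0 q = <⇒≢ (proj₁ v) (sym (dbl-injective {j} {0} (lab-injective (trans q (sym lab-0)))))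

    e≢u : e ≢ u
    e≢u q = dbl≢sdbl {j} {0} (lab-injective q)

    open Flip flipped β-involutive e≢0 e≢u public

  lower-bound : ∀ js {σ} (P : Perm σ) {l rest} → Decomp (Cfg.β (cfg P)) l rest →
    All (Valid σ) js → applyAll js σ ≡ ι (length σ) → weight l rest ≤ length js
  lower-bound [] P d _ e = ≤-reflexive (weight-partner (β-ι P e) d)
  lower-bound (j ∷ js) {σ} P {l} {rest} d (v ∷ vs) sorted =
    ≤-trans (drop≤ effect) (s≤s (lower-bound js P′ decomp vs′ sorted′))
    where
    open FirstFlip P v
    open Outcome (one-step d)
    vs′ : All (Valid (prefixRev j σ)) js
    vs′ = subst (λ n → All (λ i → 1 ≤ i × i ≤ n) js) (sym (length-prefixRev j σ)) vs
    sorted′ : applyAll js (prefixRev j σ) ≡ ι (length (prefixRev j σ))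
    sorted′ = trans sorted (cong ι (sym (length-prefixRev j σ)))
    drop≤ : _ → weight l rest ≤ suc (weight l′ rest′)
    drop≤ (inj₁ h)              = ≤-trans h (n≤1+n _)
    drop≤ (inj₂ (inj₁ (h , _))) = ≤-reflexive h
    drop≤ (inj₂ (inj₂ (h , _))) = ≤-reflexive h

  -- An orientation of the grey edges in S that every alternating walk respects: inn tells the two
  -- ends of such an edge apart, and a region φ, constant off S, is entered through at most one end.
  record Coherence : Set₁ where
    field
      S      : ℕ → Set
      S?     : ∀ k → Dec (S k)
      inn    : ℕ → Bool
      φ      : ℕ → ℕ
      φ-ε    : ∀ x → φ (ε x) ≡ φ x
      φ-grey : ∀ x → ¬ S (κ x) → φ (partner x) ≡ φ x
      inn-grey : ∀ x → S (κ x) → inn (partner x) ≡ not (inn x)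
      enter  : ∀ x y → S (κ x) → S (κ y) → inn x ≡ true → inn y ≡ true → φ x ≡ φ y → x ≡ y
      S-0    : S 0
      inn-1  : inn 1 ≡ true

  module _ (K : Coherence) where
    open Coherence K

    -- Imposed on black edges, but a relation between labels that grey edges satisfy too. This is
    -- needed when a 1-cycle is split off, whose black edge runs along its grey edge.
    Compat : ℕ → ℕ → Set
    Compat x y = (¬ S (κ x) × ¬ S (κ y) × φ y ≡ φ x) ⊎ (S (κ x) × S (κ y) × inn y ≡ not (inn x))

    compat-grey : ∀ x → Compat x (partner x)
    compat-grey x with S? (κ x)
    ... | yes h = inj₂ (h , subst S (sym (half-partner x)) h , inn-grey x h)
    ... | no n  = inj₁ (n , (n ∘ subst S (half-partner x)) , φ-grey x n)

    -- Nothing is asked of black edges at the leftmost cycle. Merges and front splits alter only the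
    -- front of l, so the last label y persists until it would itself be split off, which `no-split`
    -- excludes.
    Coherent : (ℕ → ℕ) → List ℕ → Set
    Coherent β l = (∀ x → κ x ∉ map κ (0 ∷ l) → Compat x (β x))
                 × ∃₂ λ pre y → l ≡ pre ∷ʳ y × S (κ y) × inn y ≡ true

    -- Walking right from the first element, every S-edge is met at an end that is not inn
    -- and left at an end that is; so label 1 is never the left end of a black edge.
    no-split : ∀ (C : Cfg) j → 1 ≤ j → let open Cfg C; u = lab 1 in
      Coherent β [ u ] → lab (dbl j) ≡ 1 → lab (suc (dbl j)) ≡ partner u → ⊥
    no-split C (suc i) _ (comp , [] , _ , refl , Su , inn-u) at-1 at-γu = finish (walk i ≤-refl)
      where
      open Cfg C
      u = lab 1
      -- Invariant at black edge k: the region just reached was entered at an inn end y not further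
      -- to the right. By `enter` it has no second inn end, so the next S-edge is met at an end that
      -- is not inn.
      W : ℕ → Set
      W i = ∃ λ y → S (κ y) × inn y ≡ true × φ y ≡ φ (lab (suc (dbl i))) × pos y ≤ suc (dbl i)

      φ-next : ∀ i → φ (lab (dbl (suc i))) ≡ φ (lab (suc (dbl i)))
      φ-next i = trans (cong φ (trans (cong lab (cong suc (sym (partner-dbl i)))) (lab-ε (suc (dbl i))))) (φ-ε _)

      late : ∀ k {y} → y ≡ lab (dbl (suc k)) → ¬ pos y ≤ suc (dbl k)
      late k refl h = <-irrefl refl (subst (_≤ suc (dbl k)) (pos-lab _) h)

      walk : ∀ k → k ≤ i → W k
      walk zero    _ = u , Su , inn-u , refl , ≤-reflexive (pos-lab 1)
      walk (suc k) h with walk k (<⇒≤ h)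
      ... | y , Sy , inn-y , φ-y , pos-y with comp x fresh
        where
        x = lab (dbl (suc k))
        differ : ∀ {q} → dbl (suc k) ≢ q → x ≢ lab q
        differ n e = n (lab-injective e)
        fresh : κ x ∉ map κ (0 ∷ u ∷ [])
        fresh (here e) with half-≡ x 0 e
        ... | inj₁ e₀ = differ {0} (λ ()) (trans e₀ (sym lab-0))
        ... | inj₂ e₁ = differ {dbl (suc i)} (λ q → <-irrefl (dbl-injective q) (s≤s h)) (trans e₁ (sym at-1))
        fresh (there (here e)) with half-≡ x u e
        ... | inj₁ e₀ = differ {1} (dbl≢sdbl {suc k} {0}) e₀
        ... | inj₂ e₁ = differ {suc (dbl (suc i))} (dbl≢sdbl {suc k} {suc i}) (trans e₁ (sym at-γu))
      ... | inj₁ (_ , _ , φ-x) = y , Sy , inn-y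
          , trans φ-y (trans (sym (φ-next k)) (trans (sym φ-x) (cong φ (β-dbl (suc k)))))
          , ≤-trans pos-y (≤-trans (n≤1+n _) (n≤1+n _))
      ... | inj₂ (Sx , Sβx , inn-βx) with inn (lab (dbl (suc k))) in inn-x
      ... | true  = ⊥-elim (late k (enter y _ Sy Sx inn-y inn-x (trans φ-y (sym (φ-next k)))) pos-y)
      ... | false = β (lab (dbl (suc k))) , Sβx , inn-βx , cong φ (β-dbl (suc k))
          , ≤-reflexive (trans (cong pos (β-dbl (suc k))) (pos-lab _))

      finish : W i → ⊥
      finish (y , Sy , inn-y , φ-y , pos-y) = late i
        (trans (enter y 1 Sy S-0 inn-y inn-1 (trans φ-y (trans (sym (φ-next i)) (cong φ at-1)))) (sym at-1)) pos-y
    no-split C (suc i) _ (comp , _ ∷ [] , _ , () , _) _ _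
    no-split C (suc i) _ (comp , _ ∷ _ ∷ _ , _ , () , _) _ _

    -- The first flip that does not lower the weight is the extra one, and from there `lower-bound`
    -- suffices. As long as all flips lower it, `Coherent` persists and keeps the leftmost list
    -- nonempty.
    strict-lower-bound : ∀ js {σ} (P : Perm σ) {l rest} → Decomp (Cfg.β (cfg P)) l rest →
      Coherent (Cfg.β (cfg P)) l →
      All (Valid σ) js → applyAll js σ ≡ ι (length σ) → weight l rest < length js
    strict-lower-bound [] P {l} {rest} d (_ , pre , y , refl , _) _ e =
      ⊥-elim (nonempty pre (m+n≡0⇒m≡0 (length (pre ∷ʳ y)) (weight-partner (β-ι P e) d)))
      where
      nonempty : ∀ pre → length (pre ∷ʳ y) ≢ 0
      nonempty []      ()
      nonempty (_ ∷ _) ()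
    strict-lower-bound (j ∷ js) {σ} P {l} {rest} d (comp , pre , y , l≡ , Sy , inn-y) (v ∷ vs) sorted =
      s≤s (go (one-step d))
      where
      open FirstFlip P v
      open Cfg (cfg P)
      open Swap flipped using (at-a; at-b; at-d)
      vs′ : All (Valid (prefixRev j σ)) js
      vs′ = subst (λ n → All (λ i → 1 ≤ i × i ≤ n) js) (sym (length-prefixRev j σ)) vs
      sorted′ : applyAll js (prefixRev j σ) ≡ ι (length (prefixRev j σ))
      sorted′ = trans sorted (cong ι (sym (length-prefixRev j σ)))

      keep : ∀ {L} x → κ x ∉ map κ L → κ 0 ∈ map κ L → κ u ∈ map κ L → κ e ∈ map κ L → κ f ∈ map κ L →
        C′.β x ≡ β x
      keep x n k0 ku ke kf = β′-off (off-κ (miss k0) (miss ku) (miss ke) (miss kf))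
        where
        miss : ∀ {k} → k ∈ _ → κ x ≢ k
        miss h q = n (subst (_∈ _) (sym q) h)

      κu∈ : κ u ∈ map κ (0 ∷ l)
      κu∈ with κu-lead (Decomp.lead d)
      ... | w , h , q = subst (_∈ map κ (0 ∷ l)) (sym q) (∈-map⁺ κ h)

      go : Outcome l rest → weight l rest ≤ length js
      go (outcome dec (inj₁ h)) = ≤-trans h (lower-bound js P′ dec vs′ sorted′)
      go (outcome dec (inj₂ (inj₂ (h , D , refl , ke , kf)))) = subst (_≤ length js) (sym h)
        (strict-lower-bound js P′ dec (comp′ , D ++ pre , y , trans (cong (D ++_) l≡) (sym (++-assoc D pre [ y ])) , Sy , inn-y) vs′ sorted′)
        where
        widen : ∀ {k} → k ∈ map κ (0 ∷ l) → k ∈ map κ (0 ∷ D ++ l)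
        widen (here q)  = here q
        widen (there k) with ∈-map⁻ κ k
        ... | w , k′ , q = subst (_∈ _) (sym q) (∈-map⁺ κ (∈-++⁺ʳ (0 ∷ D) k′))
        narrow : ∀ {k} → k ∈ map κ D → k ∈ map κ (0 ∷ D ++ l)
        narrow k with ∈-map⁻ κ k
        ... | w , k′ , q = subst (_∈ _) (sym q) (∈-map⁺ κ (∈-++⁺ʳ [ 0 ] (∈-++⁺ˡ k′)))
        comp′ : ∀ x → κ x ∉ map κ (0 ∷ D ++ l) → Compat x (C′.β x)
        comp′ x n = subst (Compat x) (sym (keep {0 ∷ D ++ l} x n (here refl) (widen κu∈) (narrow ke) (narrow kf)))
          (comp x (n ∘ widen))
      go (outcome {l′} dec (inj₂ (inj₁ (h , ul′ , f≡ , ke)))) = subst (_≤ length js) (sym h)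
        (strict-lower-bound js P′ dec (comp′ , tail pre (trans (sym ul′) l≡)) vs′ sorted′)
        where
        tail : ∀ pre → u ∷ l′ ≡ pre ∷ʳ y → ∃₂ λ pre y → l′ ≡ pre ∷ʳ y × S (κ y) × inn y ≡ true
        tail (_ ∷ pre) refl = pre , y , refl , Sy , inn-y
        tail [] refl = ⊥-elim (no-split (cfg P) j (proj₁ v) (subst (λ z → ∀ x → κ x ∉ map κ (0 ∷ z) → Compat x (β x)) ul′ comp , [] , y , refl , Sy , inn-y)
          (trans (sym at-a) (run-nil (Decomp.lead dec))) f≡)
        comp′ : ∀ x → κ x ∉ map κ (0 ∷ l′) → Compat x (C′.β x)
        comp′ x n with κ x ≟ κ u
        ... | yes q with half-≡ x u q
        ... | inj₁ refl = subst (Compat u) (sym (trans at-b f≡)) (compat-grey u)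
        ... | inj₂ refl = subst (Compat (partner u))
          (trans (partner-involutive u) (sym (trans (cong C′.β (sym f≡)) at-d))) (compat-grey (partner u))
        comp′ x n | no q = subst (Compat x)
          (sym (keep {0 ∷ u ∷ l′} x fresh (here refl) (there (here refl)) (subst (λ z → κ e ∈ map κ (0 ∷ z)) ul′ ke)
            (there (here (trans (cong κ f≡) (half-partner u))))))
          (comp x (subst (λ z → κ x ∉ map κ (0 ∷ z)) (sym ul′) fresh))
          where
          fresh : κ x ∉ map κ (0 ∷ u ∷ l′)
          fresh (here r)          = n (here r)
          fresh (there (here r))  = q r
          fresh (there (there r)) = n (there r)

open LowerBound

-- Reversals and block interchanges from prefix flips, and the black edges as a list.

module Sorting where
  open import Data.Nat
  open import Data.Nat.Properties

  Sortable : List ℤ → ℕ → Set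
  Sortable σ k = ∃ λ js → All (Valid σ) js × applyAll js σ ≡ ι (length σ) × length js ≤ k

  sortable-≤ : ∀ {σ k l} → k ≤ l → Sortable σ k → Sortable σ l
  sortable-≤ h (js , v , s , l) = js , v , s , ≤-trans l h

  take-++-length : ∀ {A : Set} (X Y : List A) → take (length X) (X ++ Y) ≡ X
  take-++-length []      Y = refl
  take-++-length (x ∷ X) Y = cong (x ∷_) (take-++-length X Y)

  drop-++-length : ∀ {A : Set} (X Y : List A) → drop (length X) (X ++ Y) ≡ Y
  drop-++-length []      Y = refl
  drop-++-length (x ∷ X) Y = drop-++-length X Y

  -- The free Z lets each flip be followed by a regrouping of the blocks.
  sort-prefix : ∀ X Y {Z k} → 1 ≤ length X → flip X ++ Y ≡ Z → Sortable Z k → Sortable (X ++ Y) (suc k)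
  sort-prefix X Y h refl (js , v , s , l) =
    length X ∷ js
    , (h , subst (length X ≤_) (sym (length-++ X)) (m≤m+n _ _))
      ∷ subst (λ n → All (λ i → 1 ≤ i × i ≤ n) js) len v
    , trans (cong (applyAll js) flipped) (trans s (cong ι len))
    , s≤s l
    where
    len : length (flip X ++ Y) ≡ length (X ++ Y)
    len = length-flip-mid [] X
    flipped : prefixRev (length X) (X ++ Y) ≡ flip X ++ Y
    flipped = cong₂ (λ a b → flip a ++ b) (take-++-length X Y) (drop-++-length X Y)

  flip-++ : ∀ X Y → flip (X ++ Y) ≡ flip Y ++ flip X
  flip-++ X Y = trans (cong (map neg) (reverse-++ X Y)) (map-++ neg (reverse Y) (reverse X))

  flip-flip : ∀ X → flip (flip X) ≡ X
  flip-flip X = begin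
      map neg (reverse (map neg (reverse X))) ≡⟨ reverse-map neg (map neg (reverse X)) ⟩
      reverse (map neg (map neg (reverse X))) ≡⟨ cong reverse (map-∘ (reverse X)) ⟨
      reverse (map (neg ∘ neg) (reverse X))   ≡⟨ cong reverse (trans (map-cong neg-involutive (reverse X)) (map-id (reverse X))) ⟩
      reverse (reverse X)                     ≡⟨ reverse-involutive X ⟩
      X ∎
    where open ≡-Reasoning

  1≤length-++ : ∀ {A : Set} (X : List A) {Y} → 1 ≤ length X → 1 ≤ length (X ++ Y)
  1≤length-++ (x ∷ X) h = s≤s z≤n

  1≤length-flip : ∀ X → 1 ≤ length X → 1 ≤ length (flip X)
  1≤length-flip X = subst (1 ≤_) (sym (length-flip X))

  -- A non-prefix reversal takes three flips:  A B R,  B⁻ A⁻ R,  B A⁻ R,  A B⁻ R.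
  sort-reversal : ∀ A B R {k} → 1 ≤ length A → 1 ≤ length B →
    Sortable (A ++ flip B ++ R) k → Sortable (A ++ B ++ R) (3 + k)
  sort-reversal A B R a b s =
    subst (λ z → Sortable z _) (++-assoc A B R)
    (sort-prefix (A ++ B) R (1≤length-++ A a)
      (trans (cong (_++ R) (flip-++ A B)) (++-assoc (flip B) (flip A) R))
    (sort-prefix (flip B) (flip A ++ R) (1≤length-flip B b)
      (trans (cong (_++ (flip A ++ R)) (flip-flip B)) (sym (++-assoc B (flip A) R)))
    (sort-prefix (B ++ flip A) R (1≤length-++ B b)
      (trans (cong (_++ R) (trans (flip-++ B (flip A)) (cong (_++ flip B) (flip-flip A)))) (++-assoc A (flip B) R))
      s)))

  -- A block interchange takes six flips:  A B C D R,  A⁻ B C D R,  C⁻ B⁻ A D R,  D⁻ A⁻ B C R,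
  -- B⁻ A D C R,  C⁻ D⁻ A⁻ B R,  A D C B R.
  sort-interchange : ∀ A B C D R {k} → 1 ≤ length A → 1 ≤ length B → 1 ≤ length C → 1 ≤ length D →
    Sortable (A ++ D ++ C ++ B ++ R) k → Sortable (A ++ B ++ C ++ D ++ R) (6 + k)
  sort-interchange A B C D R a b c d s =
    sort-prefix A (B ++ C ++ D ++ R) a
      (assoc₃ (flip A) B C (D ++ R))
    (sort-prefix (flip A ++ B ++ C) (D ++ R) (1≤length-++ (flip A) (1≤length-flip A a))
      (trans (cong (_++ (D ++ R)) (flip₃ A B C)) (assoc₄ (flip C) (flip B) A D R))
    (sort-prefix (flip C ++ flip B ++ A ++ D) R (1≤length-++ (flip C) (1≤length-flip C c))
      (trans (cong (_++ R) (trans (flip-++ (flip C) (flip B ++ A ++ D)) (cong₂ _++_ (flip-++ (flip B) (A ++ D)) (flip-flip C))))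
       (trans (cong (λ z → (z ++ C) ++ R) (cong₂ _++_ (flip-++ A D) (flip-flip B))) (regroup (flip D) (flip A) B C R)))
    (sort-prefix (flip D ++ flip A ++ B) (C ++ R) (1≤length-++ (flip D) (1≤length-flip D d))
      (trans (cong (_++ (C ++ R)) (flip₃′ D A B)) (assoc₄ (flip B) A D C R))
    (sort-prefix (flip B ++ A ++ D ++ C) R (1≤length-++ (flip B) (1≤length-flip B b))
      (trans (cong (_++ R) (trans (flip-++ (flip B) (A ++ D ++ C)) (cong₂ _++_ (flip-++ A (D ++ C)) (flip-flip B))))
       (trans (cong (λ z → ((z ++ flip A) ++ B) ++ R) (flip-++ D C)) (regroup (flip C) (flip D) (flip A) B R)))
    (sort-prefix (flip C ++ flip D ++ flip A) (B ++ R) (1≤length-++ (flip C) (1≤length-flip C c))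
      (trans (cong (_++ (B ++ R)) (flip₃″ C D A)) (sym (assoc₃ A D C (B ++ R))))
      s)))))
    where
    assoc₃ : ∀ X Y Z W → X ++ Y ++ Z ++ W ≡ (X ++ Y ++ Z) ++ W
    assoc₃ X Y Z W = trans (cong (X ++_) (sym (++-assoc Y Z W))) (sym (++-assoc X (Y ++ Z) W))
    assoc₄ : ∀ X Y Z V W → (X ++ Y ++ Z) ++ (V ++ W) ≡ (X ++ Y ++ Z ++ V) ++ W
    assoc₄ X Y Z V W = trans (sym (assoc₃ X Y Z (V ++ W))) (trans (cong (X ++_) (assoc₃ Y Z V W)) (sym (++-assoc X (Y ++ Z ++ V) W)))
    regroup : ∀ X Y Z V W → (((X ++ Y) ++ Z) ++ V) ++ W ≡ (X ++ Y ++ Z) ++ (V ++ W)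
    regroup X Y Z V W = trans (++-assoc ((X ++ Y) ++ Z) V W) (cong (_++ (V ++ W)) (++-assoc X Y Z))
    flip-rev₃ : ∀ X Y Z → flip (X ++ Y ++ Z) ≡ flip Z ++ flip Y ++ flip X
    flip-rev₃ X Y Z = trans (flip-++ X (Y ++ Z)) (trans (cong (_++ flip X) (flip-++ Y Z)) (++-assoc (flip Z) (flip Y) (flip X)))
    flip₃ : ∀ X Y Z → flip (flip X ++ Y ++ Z) ≡ flip Z ++ flip Y ++ X
    flip₃ X Y Z = trans (flip-rev₃ (flip X) Y Z) (cong (λ t → flip Z ++ flip Y ++ t) (flip-flip X))
    flip₃′ : ∀ X Y Z → flip (flip X ++ flip Y ++ Z) ≡ flip Z ++ Y ++ X
    flip₃′ X Y Z = trans (flip₃ X (flip Y) Z) (cong (λ t → flip Z ++ t ++ X) (flip-flip Y))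
    flip₃″ : ∀ X Y Z → flip (flip X ++ flip Y ++ flip Z) ≡ Z ++ Y ++ X
    flip₃″ X Y Z = trans (flip₃′ X Y (flip Z)) (cong (λ t → t ++ Y ++ X) (flip-flip Z))

  start end : ℤ → ℕ
  start z = at (expand z) 0
  end z   = at (expand z) 1

  -- The black edges from left to right, x and y being the labels just before and just after σ.
  -- Exchanging blocks rearranges this list except for the edges at the cuts.
  edges : ℕ → List ℤ → ℕ → List (ℕ × ℕ)
  edges x []      y = (x , y) ∷ []
  edges x (z ∷ σ) y = (x , start z) ∷ edges (end z) σ y

  inner : ℕ → List ℤ → List (ℕ × ℕ)
  inner x []      = []
  inner x (z ∷ σ) = (x , start z) ∷ inner (end z) σ

  final : ℕ → List ℤ → ℕ
  final x []      = x
  final x (z ∷ σ) = final (end z) σ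

  first : List ℤ → ℕ → ℕ
  first []      y = y
  first (z ∷ σ) y = start z

  rest-edges : List ℤ → ℕ → List (ℕ × ℕ)
  rest-edges []      y = []
  rest-edges (z ∷ σ) y = edges (end z) σ y

  edges-split : ∀ x σ y → edges x σ y ≡ (x , first σ y) ∷ rest-edges σ y
  edges-split x []      y = refl
  edges-split x (z ∷ σ) y = refl

  edges-++ : ∀ x σ τ y → edges x (σ ++ τ) y ≡ inner x σ ++ edges (final x σ) τ y
  edges-++ x []      τ y = refl
  edges-++ x (z ∷ σ) τ y = cong (_ ∷_) (edges-++ (end z) σ τ y)

  length-inner : ∀ x σ → length (inner x σ) ≡ length σ
  length-inner x []      = refl
  length-inner x (z ∷ σ) = cong suc (length-inner (end z) σ)

  length-edges : ∀ x σ y → length (edges x σ y) ≡ suc (length σ)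
  length-edges x []      y = refl
  length-edges x (z ∷ σ) y = cong suc (length-edges (end z) σ y)

  flat : List (ℕ × ℕ) → List ℕ
  flat []             = []
  flat ((a , b) ∷ es) = a ∷ b ∷ flat es

  flat-edges : ∀ x σ y → flat (edges x σ y) ≡ x ∷ concatMap expand σ ++ [ y ]
  flat-edges x []             y = refl
  flat-edges x (+ m ∷ σ)      y = cong (λ z → x ∷ _ ∷ z) (flat-edges _ σ y)
  flat-edges x (-[1+ m ] ∷ σ) y = cong (λ z → x ∷ _ ∷ z) (flat-edges _ σ y)

  at-flat : ∀ es {a b es′} → at (flat (es ++ (a , b) ∷ es′)) (dbl (length es)) ≡ a
                            × at (flat (es ++ (a , b) ∷ es′)) (suc (dbl (length es))) ≡ b
  at-flat []       = refl , refl
  at-flat (_ ∷ es) = at-flat es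

  flat-∈ : ∀ es i → i < length es → (at (flat es) (dbl i) , at (flat es) (suc (dbl i))) ∈ es
  flat-∈ (_ ∷ es) zero    _       = here refl
  flat-∈ (_ ∷ es) (suc i) (s≤s h) = there (flat-∈ es i h)

  allEdges : List ℤ → List (ℕ × ℕ)
  allEdges σ = edges 0 σ (2 * length σ + 1)

  label-flat : ∀ σ {p} → label σ p ≡ at (flat (allEdges σ)) p
  label-flat σ {p} = cong (λ z → at z p) (sym (flat-edges 0 σ (2 * length σ + 1)))

  module _ {σ} (P : Perm σ) where
    open Cfg (cfg P)

    private
      lab-flat : ∀ {p} → p < dbl (suc (length σ)) → lab p ≡ at (flat (allEdges σ)) p
      lab-flat l = trans (labOf-< {σ} l) (label-flat σ)

    edge-lab : ∀ es {a b es′} → allEdges σ ≡ es ++ (a , b) ∷ es′ →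
      lab (dbl (length es)) ≡ a × lab (suc (dbl (length es))) ≡ b
    edge-lab es {a} {b} {es′} e = trans (lab-flat (<-trans (n<1+n _) h)) (trans (cong (λ z → at (flat z) _) e) (proj₁ (at-flat es)))
                    , trans (lab-flat h) (trans (cong (λ z → at (flat z) _) e) (proj₂ (at-flat es)))
      where
      len : length es < suc (length σ)
      len = subst (length es <_) (trans (sym (length-++ es)) (trans (cong length (sym e)) (length-edges 0 σ _)))
              (m<m+n (length es) (s≤s z≤n))
      h : suc (dbl (length es)) < dbl (suc (length σ))
      h = dbl-mono-< len

    edge-β : ∀ {a b} → (a , b) ∈ allEdges σ → β a ≡ b × β b ≡ a
    edge-β h with ∈-∃++ h
    ... | es , es′ , e with edge-lab es e
    ... | refl , refl = β-dbl (length es) , β-sdbl (length es)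

    lab-edge : ∀ {i} → i ≤ length σ → (lab (dbl i) , lab (suc (dbl i))) ∈ allEdges σ
    lab-edge {i} h = subst₂ (λ a b → (a , b) ∈ allEdges σ)
      (sym (lab-flat (<-trans (n<1+n _) (dbl-mono-< (s≤s h))))) (sym (lab-flat (dbl-mono-< (s≤s h))))
      (flat-∈ (allEdges σ) i (subst (i <_) (sym (length-edges 0 σ _)) (s≤s h)))

    lab-fixed : ∀ {p} → dbl (suc (length σ)) ≤ p → lab p ≡ p
    lab-fixed h = labOf-≮ {σ} (≤⇒≯ h)

    pos-fixed : ∀ {p} → dbl (suc (length σ)) ≤ p → pos p ≡ p
    pos-fixed h = posOf-≮ {σ} (≤⇒≯ h)

    lab-id⇒ι : (∀ p → lab p ≡ p) → σ ≡ ι (length σ)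
    lab-id⇒ι h = trans (go 0 σ λ {p} l → trans (sym (labOf-< {σ} (s≤s (m<n⇒m<1+n l)))) (h (suc p)))
                   (cong (map (λ i → + suc i)) (sym (upTo-ascend (length σ))))
      where
      go : ∀ k τ {ys} → (∀ {p} → p < dbl (length τ) → at (concatMap expand τ ++ ys) p ≡ suc (dbl k) + p) →
        τ ≡ map (λ i → + suc i) (ascend k (length τ))
      go k []              h = refl
      go k (+ zero ∷ τ)    h with h {0} (s≤s z≤n)
      ... | ()
      go k (+ suc m ∷ τ) {ys} h = cong₂ _∷_ (cong (λ i → + suc i) (dbl-injective (suc-injective
          (trans (sym (cong (_∸ 1) (2*≡dbl (suc m)))) (trans (h {0} (s≤s z≤n)) (+-identityʳ _))))))
        (go (suc k) τ {ys} λ {p} l → trans (h (s≤s (s≤s l))) (trans (+-suc (suc (dbl k)) (suc p)) (cong suc (+-suc (suc (dbl k)) p))))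
      go k (-[1+ m ] ∷ τ) {ys} h = ⊥-elim (dbl≢sdbl {suc m} {k}
          (trans (sym (2*≡dbl (suc m))) (trans (h {0} (s≤s z≤n)) (+-identityʳ _))))

  -- Comparing the edges as pairs of labels, wherever they stand, avoids computing how a block
  -- interchange moves positions.
  edges-reduce : ∀ {σ σ′} (P : Perm σ) (P′ : Perm σ′) → length σ ≡ length σ′ →
    (∀ {a b} → (a , b) ∈ allEdges σ′ → (a , b) ∈ allEdges σ ⊎ b ≡ partner a) →
    ∀ x → Cfg.β (cfg P′) x ≡ Cfg.β (cfg P) x ⊎ Cfg.β (cfg P′) x ≡ partner x
  edges-reduce {σ} {σ′} P P′ len h x = by-position (dbl-half (C′.pos x)) (i ≤? length σ′)
    where
    module C  = Cfg (cfg P)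
    module C′ = Cfg (cfg P′)
    i = ⌊ C′.pos x /2⌋

    Fine : ℕ → Set
    Fine z = C′.β z ≡ C.β z ⊎ C′.β z ≡ partner z

    fine-edge : i ≤ length σ′ → Fine (C′.lab (dbl i)) × Fine (C′.lab (suc (dbl i)))
    fine-edge l with h (lab-edge P′ l)
    ... | inj₁ k = inj₁ (trans (C′.β-dbl i) (sym (proj₁ (edge-β P k)))) , inj₁ (trans (C′.β-sdbl i) (sym (proj₂ (edge-β P k))))
    ... | inj₂ k = inj₂ (trans (C′.β-dbl i) k) , inj₂ (trans (C′.β-sdbl i) (partner-swap (sym k)))

    at-x : ∀ {p} → C′.pos x ≡ p → Fine (C′.lab p) → Fine x
    at-x refl = subst Fine (C′.lab-pos x)

    beyond : ∀ {p} → C′.pos x ≡ p → dbl (suc (length σ′)) ≤ p → Fine x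
    beyond refl m = inj₂ (trans (lab-fixed P′ (partner-≥ (suc (length σ′)) m))
      (cong partner (trans (sym (lab-fixed P′ m)) (C′.lab-pos x))))

    by-position : C′.pos x ≡ dbl i ⊎ C′.pos x ≡ suc (dbl i) → Dec (i ≤ length σ′) → Fine x
    by-position (inj₁ e) (yes l) = at-x e (proj₁ (fine-edge l))
    by-position (inj₂ e) (yes l) = at-x e (proj₂ (fine-edge l))
    by-position (inj₁ e) (no n)  = beyond e (dbl-mono-≤ (≰⇒> n))
    by-position (inj₂ e) (no n)  = beyond e (≤-trans (dbl-mono-≤ (≰⇒> n)) (n≤1+n _))

  -- Cuts i₁ and i₃ carry one nonoriented 2-cycle, cuts i₂ and i₄ the other, with grey edges `g₁` to
  -- `g₄`. Each of the four new black edges falls on one of these grey edges, so both cycles are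
  -- resolved.
  module Interchange (A : List ℤ) (b : ℤ) (B : List ℤ) (c : ℤ) (C : List ℤ) (d : ℤ) (D R : List ℤ)
    (P : Perm (A ++ (b ∷ B) ++ (c ∷ C) ++ (d ∷ D) ++ R)) where
    σ  = A ++ (b ∷ B) ++ (c ∷ C) ++ (d ∷ D) ++ R
    σ′ = A ++ (d ∷ D) ++ (c ∷ C) ++ (b ∷ B) ++ R

    i₁ i₂ i₃ i₄ : ℕ
    i₁ = length A
    i₂ = i₁ + suc (length B)
    i₃ = i₂ + suc (length C)
    i₄ = i₃ + suc (length D)

    σ↭ : σ ↭ σ′
    σ↭ = ↭.++⁺ˡ A (↭-trans (↭.shifts (b ∷ B) (c ∷ C)) (↭-trans
      (↭.++⁺ˡ (c ∷ C) (↭.shifts (b ∷ B) (d ∷ D))) (↭.shifts (c ∷ C) (d ∷ D))))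

    length-σ : length σ ≡ length σ′
    length-σ = ↭.↭-length σ↭

    P′ : Perm σ′
    P′ = subst (λ n → map ∣_∣ σ′ ↭ map suc (upTo n)) length-σ (↭-trans (↭.map⁺ ∣_∣ (↭-sym σ↭)) P)

    private
      y x₁ w₂ w₃ w₄ x₂ x₃ x₄ w₅ : ℕ
      y = 2 * length σ + 1
      x₁ = final 0 A
      w₂ = start b
      x₂ = final (end b) B
      w₃ = start c
      x₃ = final (end c) C
      w₄ = start d
      x₄ = final (end d) D
      w₅ = first R y
      eA = inner 0 A
      eB = inner (end b) B
      eC = inner (end c) C
      eD = inner (end d) D
      eR = rest-edges R y

      σ-edges : allEdges σ ≡ eA ++ (x₁ , w₂) ∷ eB ++ (x₂ , w₃) ∷ eC ++ (x₃ , w₄) ∷ eD ++ (x₄ , w₅) ∷ eR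
      σ-edges = trans (edges-++ 0 A _ y) (cong (λ z → eA ++ (x₁ , w₂) ∷ z)
        (trans (edges-++ (end b) B _ y) (cong (λ z → eB ++ (x₂ , w₃) ∷ z)
        (trans (edges-++ (end c) C _ y) (cong (λ z → eC ++ (x₃ , w₄) ∷ z)
        (trans (edges-++ (end d) D _ y) (cong (eD ++_) (edges-split x₄ R y))))))))

      σ′-edges : allEdges σ′ ≡ eA ++ (x₁ , w₄) ∷ eD ++ (x₄ , w₃) ∷ eC ++ (x₃ , w₂) ∷ eB ++ (x₂ , w₅) ∷ eR
      σ′-edges = trans (cong (λ n → edges 0 σ′ (2 * n + 1)) (sym length-σ))
        (trans (edges-++ 0 A _ y) (cong (λ z → eA ++ (x₁ , w₄) ∷ z)
        (trans (edges-++ (end d) D _ y) (cong (λ z → eD ++ (x₄ , w₃) ∷ z)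
        (trans (edges-++ (end c) C _ y) (cong (λ z → eC ++ (x₃ , w₂) ∷ z)
        (trans (edges-++ (end b) B _ y) (cong (eB ++_) (edges-split x₂ R y)))))))))

      p₁ p₂ p₃ p₄ : List (ℕ × ℕ)
      p₁ = eA
      p₂ = p₁ ++ (x₁ , w₂) ∷ eB
      p₃ = p₂ ++ (x₂ , w₃) ∷ eC
      p₄ = p₃ ++ (x₃ , w₄) ∷ eD

      reassoc : ∀ (p : List (ℕ × ℕ)) e q {r} → p ++ e ∷ (q ++ r) ≡ (p ++ e ∷ q) ++ r
      reassoc p e q {r} = sym (++-assoc p (e ∷ q) r)

      len-step : ∀ p e z X → length (p ++ e ∷ inner z X) ≡ length p + suc (length X)
      len-step p e z X = trans (length-++ p) (cong (λ n → length p + suc n) (length-inner z X))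

      len₁ : length p₁ ≡ i₁
      len₁ = length-inner 0 A
      len₂ : length p₂ ≡ i₂
      len₂ = trans (len-step p₁ _ (end b) B) (cong (_+ suc (length B)) len₁)
      len₃ : length p₃ ≡ i₃
      len₃ = trans (len-step p₂ _ (end c) C) (cong (_+ suc (length C)) len₂)
      len₄ : length p₄ ≡ i₄
      len₄ = trans (len-step p₃ _ (end d) D) (cong (_+ suc (length D)) len₃)

      σ-edges₂ = trans σ-edges (reassoc p₁ (x₁ , w₂) eB)
      σ-edges₃ = trans σ-edges₂ (reassoc p₂ (x₂ , w₃) eC)
      σ-edges₄ = trans σ-edges₃ (reassoc p₃ (x₃ , w₄) eD)

    open Cfg (cfg P)
    module C′ = Cfg (cfg P′)

    private
      at-edge : ∀ {p : List (ℕ × ℕ)} {i x w q} → length p ≡ i → allEdges σ ≡ p ++ (x , w) ∷ q →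
        lab (dbl i) ≡ x × lab (suc (dbl i)) ≡ w
      at-edge {p} refl e = edge-lab P p e

      lab₁ = at-edge len₁ σ-edges
      lab₂ = at-edge len₂ σ-edges₂
      lab₃ = at-edge len₃ σ-edges₃
      lab₄ = at-edge len₄ σ-edges₄

    module _ (g₁ : partner (lab (dbl i₁)) ≡ lab (suc (dbl i₃)))
             (g₂ : partner (lab (suc (dbl i₁))) ≡ lab (dbl i₃))
             (g₃ : partner (lab (dbl i₂)) ≡ lab (suc (dbl i₄)))
             (g₄ : partner (lab (suc (dbl i₂))) ≡ lab (dbl i₄)) where
      private
        h₁ : w₄ ≡ partner x₁
        h₁ = sym (trans (cong partner (sym (proj₁ lab₁))) (trans g₁ (proj₂ lab₃)))
        h₂ : w₂ ≡ partner x₃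
        h₂ = trans (sym (partner-involutive w₂)) (cong partner
          (trans (cong partner (sym (proj₂ lab₁))) (trans g₂ (proj₁ lab₃))))
        h₃ : w₅ ≡ partner x₂
        h₃ = sym (trans (cong partner (sym (proj₁ lab₂))) (trans g₃ (proj₂ lab₄)))
        h₄ : w₃ ≡ partner x₄
        h₄ = trans (sym (partner-involutive w₃)) (cong partner
          (trans (cong partner (sym (proj₂ lab₂))) (trans g₄ (proj₁ lab₄))))

        old : ∀ {e} → e ∈ allEdges σ′ → e ∈ allEdges σ ⊎ proj₂ e ≡ partner (proj₁ e)
        old h with ∈-++⁻ eA (subst (_ ∈_) σ′-edges h)
        ... | inj₁ k = inj₁ (subst (_ ∈_) (sym σ-edges) (∈-++⁺ˡ k))
        ... | inj₂ (here refl) = inj₂ h₁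
        ... | inj₂ (there k) with ∈-++⁻ eD k
        ... | inj₁ k = inj₁ (subst (_ ∈_) (sym σ-edges₄) (∈-++⁺ˡ (∈-++⁺ʳ p₃ (there k))))
        ... | inj₂ (here refl) = inj₂ h₄
        ... | inj₂ (there k) with ∈-++⁻ eC k
        ... | inj₁ k = inj₁ (subst (_ ∈_) (sym σ-edges₃) (∈-++⁺ˡ (∈-++⁺ʳ p₂ (there k))))
        ... | inj₂ (here refl) = inj₂ h₂
        ... | inj₂ (there k) with ∈-++⁻ eB k
        ... | inj₁ k = inj₁ (subst (_ ∈_) (sym σ-edges₂) (∈-++⁺ˡ (∈-++⁺ʳ p₁ (there k))))
        ... | inj₂ (here refl) = inj₂ h₃
        ... | inj₂ (there k) = inj₁ (subst (_ ∈_) (sym σ-edges₄) (∈-++⁺ʳ p₄ (there k)))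

      interchange-reduce : ∀ x → C′.β x ≡ β x ⊎ C′.β x ≡ partner x
      interchange-reduce = edges-reduce P P′ length-σ old

      interchange-trivial₁ : C′.β (lab (dbl i₁)) ≡ partner (lab (dbl i₁))
      interchange-trivial₁ = subst (λ z → C′.β z ≡ partner z) (sym (proj₁ lab₁))
        (trans (proj₁ (edge-β P′ (subst ((x₁ , w₄) ∈_) (sym σ′-edges) (∈-++⁺ʳ eA (here refl))))) h₁)

      interchange-trivial₂ : C′.β (lab (dbl i₂)) ≡ partner (lab (dbl i₂))
      interchange-trivial₂ = subst (λ z → C′.β z ≡ partner z) (sym (proj₁ lab₂))
        (trans (proj₁ (edge-β P′ (subst ((x₂ , w₅) ∈_) (sym σ′-edges)
          (∈-++⁺ʳ eA (there (∈-++⁺ʳ eD (there (∈-++⁺ʳ eC (there (∈-++⁺ʳ eB (here refl)))))))))) ) h₃)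

open Sorting

-- 2-cycles as orbits of two commuting involutions, and a bound on their number.

module Reduction where
  open import Data.Nat
  open import Data.Nat.Properties

  -- The step `partner ∘ β` of the alternating walk has square the identity: no cycle has more than
  -- two black edges.
  Simp : (ℕ → ℕ) → Set
  Simp β = ∀ x → partner (β (partner (β x))) ≡ x

  -- Under `Simp` these four labels make up the whole cycle of d.
  data Cyc (β : ℕ → ℕ) (d : ℕ) : ℕ → Set where
    same  : Cyc β d d
    via-black : Cyc β d (β d)
    via-grey  : Cyc β d (partner d)
    via-both   : Cyc β d (partner (β d))

  Nontrivial : (ℕ → ℕ) → ℕ → Set
  Nontrivial β x = β x ≢ partner x

  -- An upper bound for the number of 2-cycles. The representatives may repeat or lie on 1-cycles,
  -- so nothing has to be counted exactly.
  Meas : (ℕ → ℕ) → ℕ → Set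
  Meas β m = ∃ λ ds → length ds ≤ m × (∀ y → Nontrivial β y → ∃ λ d → d ∈ ds × Cyc β d y)

  -- A pointwise condition, but between involutions it acts on whole cycles: under `Simp` a 2-cycle
  -- either stays or falls into 1-cycles.
  Reduces : (ℕ → ℕ) → (ℕ → ℕ) → Set
  Reduces β β′ = ∀ x → β′ x ≡ β x ⊎ β′ x ≡ partner x

  module _ {β : ℕ → ℕ} (inv : ∀ x → β (β x) ≡ x) where
    simp-comm : Simp β → ∀ x → partner (β x) ≡ β (partner x)
    simp-comm s x = trans (sym (inv _)) (cong β
      (trans (sym (partner-involutive _)) (cong partner (s x))))

    trivial-grey : ∀ {x} → β x ≡ partner x → β (partner x) ≡ x
    trivial-grey e = trans (cong β (sym e)) (inv _)

    trivial-partner : ∀ {x} → β x ≡ partner x → β (partner x) ≡ partner (partner x)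
    trivial-partner e = trans (trivial-grey e) (sym (partner-involutive _))

  module _ {β β′ : ℕ → ℕ} (inv : ∀ x → β (β x) ≡ x) (inv′ : ∀ x → β′ (β′ x) ≡ x) (R : Reduces β β′) where
    private
      Tr : ℕ → Set
      Tr x = β′ x ≡ partner x

      Tr-grey : ∀ {x} → Tr x → Tr (partner x)
      Tr-grey = trivial-partner {β′} inv′

      -- If the edge at β x were kept while the one at x is not, β′ would not be injective.
      Tr-black : ∀ {x} → Tr x → Tr (β x)
      Tr-black {x} t with R (β x)
      ... | inj₂ e = e
      ... | inj₁ e = trans e (trans (inv x) (trans (sym (partner-involutive x))
        (cong partner (trans (sym t) (trans (cong β′ (sym (trans e (inv x)))) (inv′ _))))))

      Tr-old : ∀ {x} → β x ≡ partner x → Tr x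
      Tr-old {x} e with R x
      ... | inj₁ q = trans q e
      ... | inj₂ q = q

      kept : ∀ {x} → ¬ Tr x → β′ x ≡ β x
      kept {x} n with R x
      ... | inj₁ q = q
      ... | inj₂ q = ⊥-elim (n q)

      Tr-cyc : ∀ {d y} → Cyc β d y → Tr d → Tr y
      Tr-cyc same  t = t
      Tr-cyc via-black t = Tr-black t
      Tr-cyc via-grey  t = Tr-grey t
      Tr-cyc via-both   t = Tr-grey (Tr-black t)

      Tr-cyc⁻ : ∀ {d y} → Cyc β d y → Tr y → Tr d
      Tr-cyc⁻ same  t = t
      Tr-cyc⁻ via-black t = subst Tr (inv _) (Tr-black t)
      Tr-cyc⁻ via-grey  t = subst Tr (partner-involutive _) (Tr-grey t)
      Tr-cyc⁻ via-both   t = subst Tr (inv _) (Tr-black (subst Tr (partner-involutive _) (Tr-grey t)))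

      cyc′ : ∀ {d y} → ¬ Tr d → Cyc β d y → Cyc β′ d y
      cyc′ n same  = same
      cyc′ n via-black = subst (Cyc β′ _) (kept n) via-black
      cyc′ n via-grey  = via-grey
      cyc′ n via-both   = subst (Cyc β′ _) (cong partner (kept n)) via-both

      triv? : ∀ x → Dec (Tr x)
      triv? x = β′ x ≟ partner x

      covers : ∀ {ds} → (∀ y → Nontrivial β y → ∃ λ d → d ∈ ds × Cyc β d y) →
        ∀ y → Nontrivial β′ y → ∃ λ d → d ∈ filter (¬? ∘ triv?) ds × Cyc β′ d y
      covers c y n with c y (n ∘ Tr-old)
      ... | d , h , k = d , ∈-filter⁺ (¬? ∘ triv?) h (n ∘ Tr-cyc k) , cyc′ (n ∘ Tr-cyc k) k

      removed : ∀ {ds d} → d ∈ ds → Tr d → length (filter (¬? ∘ triv?) ds) < length ds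
      removed {ds} h t = filter-notAll (¬? ∘ triv?) ds (lose h (λ n → n t))

      removed₂ : ∀ {ds d e} → d ∈ ds → e ∈ ds → d ≢ e → Tr d → Tr e →
        suc (length (filter (¬? ∘ triv?) ds)) < length ds
      removed₂ {x ∷ ds} (here refl) (here refl) n _ _ = ⊥-elim (n refl)
      removed₂ {x ∷ ds} (here refl) (there k) n t s
        rewrite filter-reject (¬? ∘ triv?) {x} {ds} (λ n → n t) = s≤s (removed k s)
      removed₂ {x ∷ ds} (there h) (here refl) n t s
        rewrite filter-reject (¬? ∘ triv?) {x} {ds} (λ n → n s) = s≤s (removed h t)
      removed₂ {x ∷ ds} (there h) (there k) n t s = split (triv? x)
        where
        split : Dec (Tr x) → suc (length (filter (¬? ∘ triv?) (x ∷ ds))) < length (x ∷ ds)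
        split (yes q) rewrite filter-reject (¬? ∘ triv?) {x} {ds} (λ n → n q) =
          <-trans (removed₂ h k n t s) (n<1+n _)
        split (no q) rewrite filter-accept (¬? ∘ triv?) {x} {ds} q = s≤s (removed₂ h k n t s)

    reduce-simp : Simp β → Simp β′
    reduce-simp s x with triv? x
    ... | yes t = trans (cong (partner ∘ β′ ∘ partner) t)
      (trans (cong (partner ∘ β′) (partner-involutive x)) (trans (cong partner t) (partner-involutive x)))
    ... | no n = trans (cong (partner ∘ β′ ∘ partner) (kept n)) (trans (cong partner (kept m)) (s x))
      where
      m : ¬ Tr (partner (β x))
      m t = n (Tr-cyc⁻ via-both t)

    reduce-meas : ∀ {m x} → Tr x → Nontrivial β x → Meas β (suc m) → Meas β′ m
    reduce-meas {m} {x} t n (ds , l , c) with c x n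
    ... | d , h , k = filter (¬? ∘ triv?) ds , ≤-pred (≤-trans (removed h (Tr-cyc⁻ k t)) l) , covers c

    -- Under `Simp` the sets `Cyc` are classes of an equivalence, so two different 2-cycles have
    -- different representatives. This is why m is at least 2, which the equation records.
    reduce-meas₂ : Simp β → ∀ {m x y} → Tr x → Tr y → Nontrivial β x → Nontrivial β y → ¬ Cyc β x y →
      Meas β m → ∃ λ k → m ≡ suc (suc k) × Meas β′ k
    reduce-meas₂ s {m} {x} {y} t t′ n n′ ¬c (ds , l , c) with c x n | c y n′
    ... | d , h , k | e , h′ , k′ with ≤-trans (removed₂ h h′ d≢e (Tr-cyc⁻ k t) (Tr-cyc⁻ k′ t′)) l
      where
      join : ∀ {d x y} → Cyc β d x → Cyc β d y → Cyc β x y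
      join same q = q
      join via-black same = subst (Cyc β _) (inv _) via-black
      join via-black via-black = same
      join {d} via-black via-grey = subst (Cyc β (β d)) (cong partner (inv d)) via-both
      join via-black via-both = via-grey
      join {d} via-grey same = subst (Cyc β (partner d)) (partner-involutive d) via-grey
      join {d} via-grey via-black = subst (Cyc β (partner d)) (trans (cong partner (sym (simp-comm {β} inv s d))) (partner-involutive _)) via-both
      join via-grey via-grey = same
      join {d} via-grey via-both = subst (Cyc β (partner d)) (sym (simp-comm {β} inv s d)) via-black
      join {d} via-both same = subst (Cyc β (partner (β d))) (s′ d) via-both
        where
        s′ : ∀ d → partner (β (partner (β d))) ≡ d
        s′ = s
      join {d} via-both via-black = subst (Cyc β (partner (β d))) (partner-involutive _) via-grey
      join {d} via-both via-grey = subst (Cyc β (partner (β d)))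
        (trans (sym (partner-involutive _)) (cong partner (s d))) via-black
      join via-both via-both = same
      d≢e : d ≢ e
      d≢e refl = ¬c (join k k′)
    ... | s≤s (s≤s l′) = _ , refl , filter (¬? ∘ triv?) ds , l′ , covers c

  all-trivial : ∀ {β} → (∀ x → β (β x) ≡ x) → ∀ ds → (∀ y → Nontrivial β y → ∃ λ d → d ∈ ds × Cyc β d y) →
    (∃ λ d → Nontrivial β d) ⊎ (∀ x → β x ≡ partner x)
  all-trivial {β} inv ds c with Any.any? (λ d → ¬? (β d ≟ partner d)) ds
  ... | yes h = inj₁ (Any.satisfied h)
  ... | no n  = inj₂ triv
    where
    triv : ∀ x → β x ≡ partner x
    triv x with β x ≟ partner x
    ... | yes e = e
    ... | no q with c x q
    ... | d , h , k with β d ≟ partner d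
    ... | no q′ = ⊥-elim (n (lose h q′))
    ... | yes e = ⊥-elim (q (go k))
      where
      go : ∀ {y} → Cyc β d y → β y ≡ partner y
      go same  = e
      go via-black = subst (λ z → β z ≡ partner z) (sym e) (trivial-partner {β} inv e)
      go via-grey  = trivial-partner {β} inv e
      go via-both   = subst (λ z → β z ≡ partner z) (trans (sym (partner-involutive d)) (cong partner (sym e))) e

open Reduction

-- Oriented and nonoriented 2-cycles by their black edges, and the moves that resolve them.

module TwoCycles where
  open import Data.Nat
  open import Data.Nat.Properties

  half-lower : ∀ p → dbl ⌊ p /2⌋ ≤ p
  half-lower p with dbl-half p
  ... | inj₁ e = ≤-reflexive (sym e)
  ... | inj₂ e = ≤-trans (n≤1+n _) (≤-reflexive (sym e))

  half-upper : ∀ p → p ≤ suc (dbl ⌊ p /2⌋)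
  half-upper p with dbl-half p
  ... | inj₁ e = ≤-trans (≤-reflexive e) (n≤1+n _)
  ... | inj₂ e = ≤-reflexive e

  half-<⁻ : ∀ {i} p → i < ⌊ p /2⌋ → suc (dbl i) < p
  half-<⁻ p h = <-≤-trans (dbl-mono-< h) (half-lower p)

  half->⁻ : ∀ {j} p → ⌊ p /2⌋ < j → p < dbl j
  half->⁻ p h = ≤-<-trans (half-upper p) (dbl-mono-< h)

  -- A support has odd length exactly when its ends have equal parity, that is, are ends on the same
  -- side of their black edges. In a 2-cycle the two grey edges agree in this.
  Oriented₂ Unoriented₂ : Cfg → ℕ → ℕ → Set
  Oriented₂ C i j = partner (lab (dbl i)) ≡ lab (dbl j) × partner (lab (suc (dbl i))) ≡ lab (suc (dbl j))
    where open Cfg C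
  Unoriented₂ C i j = partner (lab (dbl i)) ≡ lab (suc (dbl j)) × partner (lab (suc (dbl i))) ≡ lab (dbl j)
    where open Cfg C

  Form : Cfg → ℕ → ℕ → Set
  Form C i j = Oriented₂ C i j ⊎ Unoriented₂ C i j

  module Geometry (C : Cfg) (s : Simp (Cfg.β C)) where
    open Cfg C

    comm : ∀ x → partner (β x) ≡ β (partner x)
    comm = simp-comm β-involutive s

    lab-of : ∀ {x p} → pos x ≡ p → lab p ≡ x
    lab-of {x} e = trans (cong lab (sym e)) (lab-pos x)

    private
      across : ∀ {p q} → partner (lab p) ≡ lab q → partner (lab (partner p)) ≡ lab (partner q)
      across {p} {q} e = trans (cong partner (sym (β-lab p)))
        (trans (comm (lab p)) (trans (cong β e) (β-lab q)))

      across-L : ∀ {i q} → partner (lab (dbl i)) ≡ lab q → partner (lab (suc (dbl i))) ≡ lab (partner q)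
      across-L {i} e = trans (cong (partner ∘ lab) (sym (partner-dbl i))) (across e)

      across-R : ∀ {i q} → partner (lab (suc (dbl i))) ≡ lab q → partner (lab (dbl i)) ≡ lab (partner q)
      across-R {i} e = trans (cong (partner ∘ lab) (sym (partner-sdbl i))) (across e)

    form-sym : ∀ {k l} → Form C k l → Form C l k
    form-sym (inj₁ (a , b)) = inj₁ (sym (partner-swap a) , sym (partner-swap b))
    form-sym (inj₂ (a , b)) = inj₂ (sym (partner-swap b) , sym (partner-swap a))

    -- One grey edge determines the other: β and `partner` commute, so the second joins the opposite
    -- ends of the black edges joined by the first.
    form-at : ∀ x → Form C ⌊ pos x /2⌋ ⌊ pos (partner x) /2⌋
    form-at x with dbl-half (pos x) | dbl-half (pos (partner x))
    ... | inj₁ p | inj₁ q = inj₁ (e , trans (across-L e) (cong lab (partner-dbl _)))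
      where e = trans (cong partner (lab-of p)) (sym (lab-of q))
    ... | inj₁ p | inj₂ q = inj₂ (e , trans (across-L e) (cong lab (partner-sdbl _)))
      where e = trans (cong partner (lab-of p)) (sym (lab-of q))
    ... | inj₂ p | inj₁ q = inj₂ (trans (across-R e) (cong lab (partner-dbl _)) , e)
      where e = trans (cong partner (lab-of p)) (sym (lab-of q))
    ... | inj₂ p | inj₂ q = inj₁ (trans (across-R e) (cong lab (partner-sdbl _)) , e)
      where e = trans (cong partner (lab-of p)) (sym (lab-of q))

    halves≢ : ∀ {x} → Nontrivial β x → ⌊ pos x /2⌋ ≢ ⌊ pos (partner x) /2⌋
    halves≢ {x} n e with half-≡ (pos (partner x)) (pos x) (sym e)
    ... | inj₁ q = partner≢ x (pos-injective q)
    ... | inj₂ q = n (sym (pos-injective (trans q (sym (pos-β x)))))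

    form-nontrivial : ∀ {i j} → i ≢ j → Form C i j → Nontrivial β (lab (dbl i))
    form-nontrivial {i} {j} n (inj₁ (a , _)) e =
      dbl≢sdbl {j} {i} (lab-injective (trans (sym a) (trans (sym e) (β-dbl i))))
    form-nontrivial {i} {j} n (inj₂ (a , _)) e =
      n (dbl-injective (suc-injective (lab-injective (trans (sym (β-dbl i)) (trans e a)))))

    -- Otherwise the labels on the elements i+1, …, j are closed under partner and ε, and contain
    -- with every label all smaller ones.
    exit : ∀ i j → i < j → ∃ λ p → In i j p × ¬ In i j (pos (partner (lab p)))
    exit i j h with anyUpTo? (λ p → in? i j p ×-dec ¬? (in? i j (pos (partner (lab p))))) (suc (dbl j))
    ... | yes (p , _ , q) = p , q
    ... | no n = ⊥-elim (low (lab (suc (dbl i))) (subst (In i j) (sym (pos-lab _)) (left-In h)))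
      where
      inside : ∀ {x} → In i j (pos x) → In i j (pos (partner x))
      inside {x} k = decidable-stable (in? i j _) λ m →
        n (pos x , s≤s (proj₂ k) , k , m ∘ subst (In i j ∘ pos ∘ partner) (lab-pos x))
      ε-In : ∀ p → In i j p → In i j (ε p)
      ε-In (suc p) (s≤s a , b) = s≤s (partner-≥ i a) , partner-< j b
      pos-ε : ∀ x → pos (ε x) ≡ ε (pos x)
      pos-ε x = trans (cong (pos ∘ ε) (sym (lab-pos x))) (trans (cong pos (sym (lab-ε (pos x)))) (pos-lab _))
      low : ∀ x → ¬ In i j (pos x)
      low zero k = <⇒≱ (proj₁ k) (subst (_≤ dbl i) (sym pos-0) z≤n)
      low (suc x) k with dbl-half x
      ... | inj₁ e = low x (subst (In i j ∘ pos)
        (trans (cong (partner ∘ suc) e) (trans (partner-sdbl _) (sym e))) (inside k))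
      ... | inj₂ e = low x (subst (In i j)
        (trans (sym (pos-ε (suc x))) (cong pos (trans (cong (suc ∘ partner) e)
          (trans (cong suc (partner-sdbl _)) (sym e))))) (ε-In _ k))

    -- The grey edges of a nonoriented 2-cycle join the two inner ends and the two outer ends of its
    -- black edges. So the grey edge that leaves the interval by `exit` belongs to another cycle.
    crossing : ∀ {i j} → i < j → Unoriented₂ C i j → ∃ λ x → In i j (pos x) × ¬ In i j (pos (partner x))
      × Nontrivial β x × i < ⌊ pos x /2⌋ × ⌊ pos x /2⌋ < j
      × (⌊ pos (partner x) /2⌋ < i ⊎ j < ⌊ pos (partner x) /2⌋)
    crossing {i} {j} h (a , b) with exit i j h
    ... | p , k , m = lab p , subst (In i j) (sym (pos-lab p)) k , m , nontriv
        , subst (λ z → i < ⌊ z /2⌋) (sym (pos-lab p)) lo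
        , subst (λ z → ⌊ z /2⌋ < j) (sym (pos-lab p)) hi , out
      where
      q = pos (partner (lab p))
      lab-q : lab q ≡ partner (lab p)
      lab-q = lab-pos _
      p≢L : p ≢ suc (dbl i)
      p≢L refl = m (subst (In i j) (sym (trans (cong pos b) (pos-lab _))) (right-In h))
      p≢R : p ≢ dbl j
      p≢R refl = m (subst (In i j) (sym (trans (cong pos (trans (cong partner (sym b)) (partner-involutive _))) (pos-lab _))) (left-In h))
      nontriv : Nontrivial β (lab p)
      nontriv e = m (subst (In i j) (trans (sym (pos-lab _)) (cong pos (trans (sym (β-lab p)) e))) (partner-In k p≢L p≢R))
      lo : i < ⌊ p /2⌋
      lo with <-cmp i ⌊ p /2⌋
      ... | tri< l _ _ = l
      ... | tri> _ _ l = ⊥-elim (<⇒≱ (proj₁ k) (<⇒≤ (half->⁻ p l)))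
      ... | tri≈ _ refl _ with dbl-half p
      ... | inj₁ e = ⊥-elim (<-irrefl (sym e) (proj₁ k))
      ... | inj₂ e = ⊥-elim (p≢L e)
      hi : ⌊ p /2⌋ < j
      hi with <-cmp ⌊ p /2⌋ j
      ... | tri< l _ _ = l
      ... | tri> _ _ l = ⊥-elim (<⇒≱ (<-trans (n<1+n _) (half-<⁻ p l)) (proj₂ k))
      ... | tri≈ _ refl _ with dbl-half p
      ... | inj₁ e = ⊥-elim (p≢R e)
      ... | inj₂ e = ⊥-elim (<-irrefl refl (subst (_≤ dbl j) e (proj₂ k)))
      q≢ : ∀ {t r} → q ≡ t → partner (lab t) ≡ lab r → ¬ In i j r → ⊥
      q≢ {t} {r} refl e n = n (subst (In i j) (lab-injective
        (trans (sym (partner-involutive (lab p))) (trans (cong partner (sym lab-q)) e))) k)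
      out : ⌊ q /2⌋ < i ⊎ j < ⌊ q /2⌋
      out with <-cmp ⌊ q /2⌋ i
      ... | tri< l _ _ = inj₁ l
      ... | tri≈ _ refl _ with dbl-half q
      ... | inj₁ e = ⊥-elim (q≢ e a (right-¬In i j))
      ... | inj₂ e = ⊥-elim (m (subst (In i j) (sym e) (left-In h)))
      out | tri> _ _ l with <-cmp ⌊ q /2⌋ j
      ... | tri> _ _ l′ = inj₂ l′
      ... | tri< l′ _ _ = ⊥-elim (m (<-trans (n<1+n _) (half-<⁻ q l) , <⇒≤ (half->⁻ q l′)))
      ... | tri≈ _ refl _ with dbl-half q
      ... | inj₁ e = ⊥-elim (m (subst (In i j) (sym e) (right-In h)))
      ... | inj₂ e = ⊥-elim (q≢ e (trans (cong partner (sym a)) (partner-involutive _)) (left-¬In i j))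

  module _ {C C′ : Cfg} {i j : ℕ} (R : RevOf C C′ i j) (h : i < j) (o : Oriented₂ C i j) where
    private
      module C  = Cfg C
      module C′ = Cfg C′
    open Swap (swap-rev {C} {C′} R h)

    click-reduces : Reduces C.β C′.β
    click-reduces x with x ≟ C.lab (dbl i) | x ≟ C.lab (suc (dbl i)) | x ≟ C.lab (dbl j) | x ≟ C.lab (suc (dbl j))
    ... | yes refl | _ | _ | _ = inj₂ (trans at-a (sym (proj₁ o)))
    ... | no _ | yes refl | _ | _ = inj₂ (trans at-b (sym (proj₂ o)))
    ... | no _ | no _ | yes refl | _ = inj₂ (trans at-c (partner-swap (proj₁ o)))
    ... | no _ | no _ | no _ | yes refl = inj₂ (trans at-d (partner-swap (proj₂ o)))
    ... | no a | no b | no c | no d = inj₁ (other x a b c d)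

    click-trivial : C′.β (C.lab (dbl i)) ≡ partner (C.lab (dbl i))
    click-trivial = trans at-a (sym (proj₁ o))

  form-bound : ∀ {σ} (P : Perm σ) {i j} → i < j → Form (cfg P) i j → j ≤ length σ
  form-bound {σ} P {i} {j} h f with j ≤? length σ
  ... | yes l = l
  ... | no n = ⊥-elim (go f)
    where
    open Cfg (cfg P)
    beyond : dbl (suc (length σ)) ≤ dbl j
    beyond = dbl-mono-≤ (≰⇒> n)
    L : lab (dbl j) ≡ dbl j
    L = lab-fixed P beyond
    R : lab (suc (dbl j)) ≡ suc (dbl j)
    R = lab-fixed P (≤-trans beyond (n≤1+n _))
    go : Form (cfg P) i j → ⊥
    go (inj₁ (a , _)) = dbl≢sdbl {i} {j} (lab-injective
      (trans (partner-swap a) (trans (cong partner L) (trans (partner-dbl j) (sym R)))))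
    go (inj₂ (a , _)) = <⇒≢ h (dbl-injective (lab-injective
      (trans (partner-swap a) (trans (cong partner R) (trans (partner-sdbl j) (sym L))))))

  record Reversed {σ} (P : Perm σ) (i j : ℕ) : Set where
    field
      {σ′}   : List ℤ
      P′     : Perm σ′
      revOf  : RevOf (cfg P) (cfg P′) i j
      sort₁  : i ≡ 0 → ∀ {k} → Sortable σ′ k → Sortable σ (1 + k)
      sort₃  : 1 ≤ i → ∀ {k} → Sortable σ′ k → Sortable σ (3 + k)

  cut : ∀ (τ : List ℤ) i → i ≤ length τ → ∃₂ λ A τ′ → τ ≡ A ++ τ′ × length A ≡ i
  cut τ i h = take i τ , drop i τ , sym (take++drop≡id i τ) , length-take-≤ h

  cut⁺ : ∀ (τ : List ℤ) {i j} → i < j → j ≤ i + length τ →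
    ∃ λ b → ∃₂ λ B τ′ → τ ≡ (b ∷ B) ++ τ′ × i + suc (length B) ≡ j × i + length τ ≡ j + length τ′
  cut⁺ τ {i} {j} h l with cut τ (j ∸ i) (m≤n+o⇒m∸n≤o j i l)
  ... | [] , τ′ , e , len = ⊥-elim (<⇒≢ (m<n⇒0<n∸m h) len)
  ... | b ∷ B , τ′ , refl , len = b , B , τ′ , refl , len′ ,
    trans (cong (_+_ i) (length-++ (b ∷ B))) (trans (sym (+-assoc i _ _)) (cong (_+ length τ′) len′))
    where
    len′ : i + suc (length B) ≡ j
    len′ = trans (cong (_+_ i) len) (m+[n∸m]≡n (<⇒≤ h))

  reverse-at : ∀ {σ} (P : Perm σ) {i j} → i < j → j ≤ length σ → Reversed P i j
  reverse-at {σ} P {i} {j} h l with cut σ i (≤-trans (<⇒≤ h) l)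
  ... | A , τ , refl , refl with cut⁺ τ h (subst (j ≤_) (length-++ A) l)
  ... | b , B , R , refl , refl , _ = record
    { P′ = Perm-flip A (b ∷ B) P
    ; revOf = revOf-flip A (b ∷ B) P (Perm-flip A (b ∷ B) P)
    ; sort₁ = first-sort A P
    ; sort₃ = λ a → sort-reversal A (b ∷ B) R a (s≤s z≤n)
    }
    where
    first-sort : ∀ A → Perm (A ++ (b ∷ B) ++ R) → length A ≡ 0 →
      ∀ {k} → Sortable (A ++ flip (b ∷ B) ++ R) k → Sortable (A ++ (b ∷ B) ++ R) (1 + k)
    first-sort [] _ _ = sort-prefix (b ∷ B) R (s≤s z≤n) refl

  record Interchanged {σ} (P : Perm σ) (i k : ℕ) : Set where
    open Cfg (cfg P)
    field
      {σ′}     : List ℤ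
      P′       : Perm σ′
      reduces  : Reduces β (Cfg.β (cfg P′))
      trivial₁ : Cfg.β (cfg P′) (lab (dbl i)) ≡ partner (lab (dbl i))
      trivial₂ : Cfg.β (cfg P′) (lab (dbl k)) ≡ partner (lab (dbl k))
      sort₆    : ∀ {m} → Sortable σ′ m → Sortable σ (6 + m)

  interchange-at : ∀ {σ} (P : Perm σ) {i k j l} → 1 ≤ i → i < k → k < j → j < l → l ≤ length σ →
    Unoriented₂ (cfg P) i j → Unoriented₂ (cfg P) k l → Interchanged P i k
  interchange-at {σ} P {i} {k} {j} {l} 1≤i h₁ h₂ h₃ h₄ u v with cut σ i (≤-trans (<⇒≤ (<-trans h₁ (<-trans h₂ h₃))) h₄)
  ... | A , τ₁ , refl , refl with cut⁺ τ₁ h₁ (≤-trans (<⇒≤ (<-trans h₂ h₃)) (≤-trans h₄ (≤-reflexive (length-++ A))))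
  ... | b , B , τ₂ , refl , refl , e₂ with cut⁺ τ₂ h₂ (≤-trans (<⇒≤ h₃) (≤-trans h₄ (≤-reflexive (trans (length-++ A) e₂))))
  ... | c , E , τ₃ , refl , refl , e₃ with cut⁺ τ₃ h₃ (≤-trans h₄ (≤-reflexive (trans (length-++ A) (trans e₂ e₃))))
  ... | d , D , R , refl , refl , e₄ = record
    { P′ = P′
    ; reduces  = interchange-reduce (proj₁ u) (proj₂ u) (proj₁ v) (proj₂ v)
    ; trivial₁ = interchange-trivial₁ (proj₁ u) (proj₂ u) (proj₁ v) (proj₂ v)
    ; trivial₂ = interchange-trivial₂ (proj₁ u) (proj₂ u) (proj₁ v) (proj₂ v)
    ; sort₆ = sort-interchange A (b ∷ B) (c ∷ E) (d ∷ D) R 1≤i (s≤s z≤n) (s≤s z≤n) (s≤s z≤n)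
    }
    where open Interchange A b B c E d D R P

open TwoCycles

-- Sorting when π₁ = 1.

module FixedFirst where
  open import Data.Nat
  open import Data.Nat.Properties

  sort-trivial : ∀ {σ} (P : Perm σ) → (∀ x → Cfg.β (cfg P) x ≡ partner x) → Sortable σ 0
  sort-trivial P triv = [] , [] , lab-id⇒ι P id-lab , z≤n
    where
    open Cfg (cfg P)
    right : ∀ i → lab (dbl i) ≡ dbl i → lab (suc (dbl i)) ≡ suc (dbl i)
    right i e = trans (sym (β-dbl i)) (trans (triv _) (trans (cong partner e) (partner-dbl i)))
    left : ∀ i → lab (dbl i) ≡ dbl i
    left zero    = lab-0
    left (suc i) = trans (cong (lab ∘ suc) (sym (partner-dbl i))) (trans (lab-ε (suc (dbl i)))
      (trans (cong ε (right i (left i))) (cong suc (partner-dbl i))))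
    id-lab : ∀ p → lab p ≡ p
    id-lab p with dbl-half p
    ... | inj₁ e = trans (cong lab e) (trans (left _) (sym e))
    ... | inj₂ e = trans (cong lab e) (trans (right _ (left _)) (sym e))

  record Clicked {σ} (P : Perm σ) (i j : ℕ) : Set where
    field
      reversed : Reversed P i j
    open Reversed reversed public
    field
      simp′   : Simp (Cfg.β (cfg P′))
      reduces : Reduces (Cfg.β (cfg P)) (Cfg.β (cfg P′))
      trivial : Cfg.β (cfg P′) (Cfg.lab (cfg P) (dbl i)) ≡ partner (Cfg.lab (cfg P) (dbl i))
      meas    : ∀ {m} → Meas (Cfg.β (cfg P)) (suc m) → Meas (Cfg.β (cfg P′)) m

  click : ∀ {σ} (P : Perm σ) → Simp (Cfg.β (cfg P)) → ∀ {i j} → i < j → Oriented₂ (cfg P) i j → Clicked P i j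
  click P s {i} {j} h o = record
    { reversed = r ; simp′ = reduce-simp C.β-involutive C′.β-involutive red s
    ; reduces = red ; trivial = click-trivial {cfg P} {cfg P′} revOf h o
    ; meas = reduce-meas C.β-involutive C′.β-involutive red (click-trivial {cfg P} {cfg P′} revOf h o)
               (Geometry.form-nontrivial (cfg P) s (<⇒≢ h) (inj₁ o)) }
    where
    module C = Cfg (cfg P)
    r = reverse-at P h (form-bound P h (inj₁ o))
    open Reversed r
    module C′ = Cfg (cfg P′)
    red = click-reduces {cfg P} {cfg P′} revOf h o

  empty-meas : ∀ {β x} → Meas β 0 → ¬ Nontrivial β x
  empty-meas ([] , _ , c) n with c _ n
  ... | _ , () , _

  3*suc : ∀ m {σ} → Sortable σ (3 + 3 * m) → Sortable σ (3 * suc m)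
  3*suc m {σ} = subst (Sortable σ) (sym (*-suc 3 m))

  -- Three flips for each 2-cycle. A nonoriented one is crossed by another cycle, which is resolved
  -- instead if it is oriented and together with it in six flips if not. The latter lowers m by two,
  -- behind an equation, hence the fuel.
  sort-fixed-first : ∀ fuel m → m ≤ fuel → ∀ {σ} (P : Perm σ) → let open Cfg (cfg P) in
    Simp β → β 0 ≡ 1 → Meas β m → Sortable σ (3 * m)
  sort-fixed-first fuel zero _ P s b M@(ds , _ , c) with all-trivial (Cfg.β-involutive (cfg P)) ds c
  ... | inj₂ triv    = sort-trivial P triv
  ... | inj₁ (d , n) = ⊥-elim (empty-meas M n)
  sort-fixed-first (suc fuel) (suc m′) (s≤s m≤) {σ} P s b M@(ds , _ , c)
    with all-trivial (Cfg.β-involutive (cfg P)) ds c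
  ... | inj₂ triv    = sortable-≤ z≤n (sort-trivial P triv)
  ... | inj₁ (d , n) = by-form (ordered (form-at d) (halves≢ n))
    where
    open Cfg (cfg P)
    open Geometry (cfg P) s

    ordered : ∀ {k l} → Form (cfg P) k l → k ≢ l → ∃₂ λ i j → i < j × Form (cfg P) i j
    ordered {k} {l} f n with <-cmp k l
    ... | tri< h _ _ = k , l , h , f
    ... | tri≈ _ e _ = ⊥-elim (n e)
    ... | tri> _ _ h = l , k , h , form-sym f

    -- The moves of three and six flips need a nonempty block before the first cut; with β 0 = 1 no
    -- 2-cycle uses black edge 0.
    1≤ : ∀ {i j} → i < j → Form (cfg P) i j → 1 ≤ i
    1≤ {zero}  h f = ⊥-elim (form-nontrivial (<⇒≢ h) f (trans (cong β lab-0) (trans b (cong partner (sym lab-0)))))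
    1≤ {suc i} h f = s≤s z≤n

    still : ∀ {β′} → Reduces β β′ → β′ 0 ≡ 1
    still r with r 0
    ... | inj₁ e = trans e b
    ... | inj₂ e = e

    by-click : ∀ {i j} → i < j → Oriented₂ (cfg P) i j → Sortable σ (3 * suc m′)
    by-click h o = 3*suc m′ (sort₃ (1≤ h (inj₁ o))
      (sort-fixed-first fuel m′ m≤ P′ simp′ (still reduces) (meas M)))
      where open Clicked (click P s h o)

    by-interchange : ∀ {i k j l} → i < k → k < j → j < l →
      Unoriented₂ (cfg P) i j → Unoriented₂ (cfg P) k l → Sortable σ (3 * suc m′)
    by-interchange {i} {k} {j} {l} h₁ h₂ h₃ u v
      with reduce-meas₂ β-involutive (Cfg.β-involutive (cfg (Interchanged.P′ I))) (Interchanged.reduces I) s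
             (Interchanged.trivial₁ I) (Interchanged.trivial₂ I)
             (form-nontrivial (<⇒≢ (<-trans h₁ h₂)) (inj₂ u)) (form-nontrivial (<⇒≢ (<-trans h₂ h₃)) (inj₂ v)) apart M
      where
      I = interchange-at P (1≤ (<-trans h₁ h₂) (inj₂ u)) h₁ h₂ h₃ (form-bound P (<-trans h₂ h₃) (inj₂ v)) u v
      apart : ¬ Cyc β (lab (dbl i)) (lab (dbl k))
      apart q = go q refl
        where
        go : ∀ {y} → Cyc β (lab (dbl i)) y → y ≢ lab (dbl k)
        go same   e = <⇒≢ h₁ (dbl-injective (lab-injective e))
        go via-black e = dbl≢sdbl {k} {i} (sym (lab-injective (trans (sym (β-dbl i)) e)))
        go via-grey  e = dbl≢sdbl {k} {j} (sym (lab-injective (trans (sym (proj₁ u)) e)))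
        go via-both   e = <⇒≢ h₂ (sym (dbl-injective (lab-injective
          (trans (sym (proj₂ u)) (trans (cong partner (sym (β-dbl i))) e)))))
    ... | m″ , refl , M′ = 3*suc (suc m″) (subst (λ z → Sortable σ (3 + z)) (sym (*-suc 3 m″))
      (sort₆ (sort-fixed-first fuel m″ (<⇒≤ m≤) P′ (reduce-simp β-involutive (Cfg.β-involutive (cfg P′)) reduces s)
        (still reduces) M′)))
      where
      open Interchanged (interchange-at P (1≤ (<-trans h₁ h₂) (inj₂ u)) h₁ h₂ h₃ (form-bound P (<-trans h₂ h₃) (inj₂ v)) u v)

    by-form : (∃₂ λ i j → i < j × Form (cfg P) i j) → Sortable σ (3 * suc m′)
    by-form (i , j , h , inj₁ o) = by-click h o
    by-form (i , j , h , inj₂ u) with crossing h u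
    ... | x , _ , _ , nx , h₁ , h₂ , inj₁ h₀ with form-sym (form-at x)
    ... | inj₁ o = by-click (<-trans h₀ h₁) o
    ... | inj₂ v = by-interchange h₀ h₁ h₂ v u
    by-form (i , j , h , inj₂ u) | x , _ , _ , nx , h₁ , h₂ , inj₂ h₃ with form-at x
    ... | inj₁ o = by-click (<-trans h₂ h₃) o
    ... | inj₂ v = by-interchange h₁ h₂ h₃ u v

open FixedFirst

-- Sorting when an oriented cycle can be reached from the leftmost one.

module OrientedLeftmost where
  open import Data.Nat
  open import Data.Nat.Properties

  -- Oriented: a support of odd length means that both ends have the same parity.
  Or : Cfg → ℕ → Set
  Or C x = odd (pos x) ≡ odd (pos (partner x))
    where open Cfg C

  Between : ℕ → ℕ → ℕ → Set
  Between a b p = (a < p × p < b) ⊎ (b < p × p < a)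

  -- The component graph spelled out on labels, so that a path can be followed link by link through
  -- a reversal.
  data Lk (C : Cfg) : ℕ → ℕ → Set where
    along-black : ∀ {x} → Lk C x (Cfg.β C x)
    along-grey  : ∀ {x} → Lk C x (partner x)
    across      : ∀ {x y} → let open Cfg C in
      Between (pos x) (pos (partner x)) (pos y) → ¬ Between (pos x) (pos (partner x)) (pos (partner y)) → Lk C x y

  Separated : ℕ → ℕ → ℕ → ℕ → Set
  Separated i j p q = (In i j p × ¬ In i j q) ⊎ (¬ In i j p × In i j q)

  Crosses : Cfg → ℕ → ℕ → ℕ → Set
  Crosses C i j x = Separated i j (pos x) (pos (partner x))
    where open Cfg C

  separated? : ∀ i j p q → Separated i j p q ⊎ (In i j p × In i j q) ⊎ (¬ In i j p × ¬ In i j q)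
  separated? i j p q with in? i j p | in? i j q
  ... | yes a | yes b = inj₂ (inj₁ (a , b))
  ... | yes a | no b  = inj₁ (inj₁ (a , b))
  ... | no a  | yes b = inj₁ (inj₂ (a , b))
  ... | no a  | no b  = inj₂ (inj₂ (a , b))

  in-strict : ∀ {i j p} → In i j p → ⌊ p /2⌋ ≢ i → ⌊ p /2⌋ ≢ j → suc (dbl i) < p × p < dbl j
  in-strict {i} {j} {p} (a , b) n m = lo , hi
    where
    lo : suc (dbl i) < p
    lo with <-cmp i ⌊ p /2⌋
    ... | tri< l _ _ = half-<⁻ p l
    ... | tri≈ _ e _ = ⊥-elim (n (sym e))
    ... | tri> _ _ l = ⊥-elim (<-asym a (half->⁻ p l))
    hi : p < dbl j
    hi with <-cmp ⌊ p /2⌋ j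
    ... | tri< l _ _ = half->⁻ p l
    ... | tri≈ _ e _ = ⊥-elim (m e)
    ... | tri> _ _ l = ⊥-elim (<⇒≱ (<-trans (n<1+n _) (half-<⁻ p l)) b)

  module _ {i j : ℕ} where
    private
      r = rev i j
      below : ∀ {a p} → ¬ In i j a → In i j p → a < p → a ≤ dbl i
      below {a} n h l with a ≤? dbl i
      ... | yes k = k
      ... | no k  = ⊥-elim (n (≰⇒> k , <⇒≤ (<-≤-trans l (proj₂ h))))
      above : ∀ {b p} → ¬ In i j b → In i j p → p < b → dbl j < b
      above {b} n h l with dbl j <? b
      ... | yes k = k
      ... | no k  = ⊥-elim (n (<-trans (proj₁ h) l , ≮⇒≥ k))

      rev-outer : ∀ {a b p} → ¬ In i j a → ¬ In i j b → a < p → p < b → a < r p × r p < b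
      rev-outer {a} {b} {p} n m k l with in? i j p
      ... | no o  rewrite rev-out o = k , l
      ... | yes h = ≤-<-trans (below n h k) (proj₁ (rev-In h)) , ≤-<-trans (proj₂ (rev-In h)) (above m h l)

      rev-inner : ∀ {a b p} → In i j a → In i j b → a < p → p < b → r b < r p × r p < r a
      rev-inner h k l m = rev-anti q k m , rev-anti h q l
        where q = <-trans (proj₁ h) l , <⇒≤ (<-≤-trans m (proj₂ k))

    -- If a and b lie in the block, everything between them is mirrored. If both lie outside, the
    -- block is either wholly between them or wholly not.
    between-rev : ∀ {a b p} → (In i j a × In i j b) ⊎ (¬ In i j a × ¬ In i j b) →
      Between a b p → Between (r a) (r b) (r p)
    between-rev (inj₁ (h , k)) (inj₁ (l , m)) = inj₂ (rev-inner h k l m)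
    between-rev (inj₁ (h , k)) (inj₂ (l , m)) = inj₁ (rev-inner k h l m)
    between-rev (inj₂ (h , k)) (inj₁ (l , m)) rewrite rev-out h | rev-out k = inj₁ (rev-outer h k l m)
    between-rev (inj₂ (h , k)) (inj₂ (l , m)) rewrite rev-out h | rev-out k = inj₂ (rev-outer k h l m)

    between-rev⁻ : ∀ {a b p} → (In i j a × In i j b) ⊎ (¬ In i j a × ¬ In i j b) →
      Between (r a) (r b) (r p) → Between a b p
    between-rev⁻ {a} {b} {p} s q =
      subst id (cong₂ (λ f g → f g) (cong₂ Between (rev-involutive i j a) (rev-involutive i j b)) (rev-involutive i j p))
        (between-rev (same-side s) q)
      where
      same-side : (In i j a × In i j b) ⊎ (¬ In i j a × ¬ In i j b) →
        (In i j (r a) × In i j (r b)) ⊎ (¬ In i j (r a) × ¬ In i j (r b))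
      same-side (inj₁ (h , k)) = inj₁ (rev-In h , rev-In k)
      same-side (inj₂ (h , k)) = inj₂ (rev-¬In h , rev-¬In k)

  module _ {C C′ : Cfg} {i j : ℕ} (R : RevOf C C′ i j) where
    private
      module C  = Cfg C
      module C′ = Cfg C′
      pos′ = pos-rev {C} {C′} R

    -- Exactly one end of the grey edge moves, and a moved end changes its parity.
    crosses-oriented : ∀ {x} → Crosses C i j x → ¬ Or C x → Or C′ x
    crosses-oriented {x} (inj₁ (h , k)) n = trans (cong odd (pos′ x)) (trans (odd-rev h)
      (trans (sym (¬-not (n ∘ sym))) (cong odd (sym (trans (pos′ (partner x)) (rev-out k))))))
    crosses-oriented {x} (inj₂ (h , k)) n = trans (cong odd (trans (pos′ x) (rev-out h)))
      (trans (¬-not n) (sym (trans (cong odd (pos′ (partner x))) (odd-rev k))))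

    across-rev : ∀ {x y} → (In i j (C.pos x) × In i j (C.pos (partner x))) ⊎ (¬ In i j (C.pos x) × ¬ In i j (C.pos (partner x))) →
      Between (C.pos x) (C.pos (partner x)) (C.pos y) → ¬ Between (C.pos x) (C.pos (partner x)) (C.pos (partner y)) → Lk C′ x y
    across-rev {x} {y} s p n = across
      (subst₂ (λ a b → Between a b (C′.pos y)) (sym (pos′ x)) (sym (pos′ (partner x)))
        (subst (Between _ _) (sym (pos′ y)) (between-rev s p)))
      (n ∘ between-rev⁻ s ∘ subst (Between _ _) (pos′ (partner y))
         ∘ subst₂ (λ a b → Between a b (C′.pos (partner y))) (pos′ x) (pos′ (partner x)))

  module Orient (C : Cfg) (s : Simp (Cfg.β C)) where
    open Cfg C
    open Geometry C s public

    private
      odd-L : ∀ {x k} → pos x ≡ dbl k → odd (pos x) ≡ false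
      odd-L {x} {k} e = trans (cong odd e) (odd-dbl k)
      odd-R : ∀ {x k} → pos x ≡ suc (dbl k) → odd (pos x) ≡ true
      odd-R {x} {k} e = trans (cong odd e) (cong not (odd-dbl k))

      pos-of : ∀ {x p q} → pos x ≡ p → partner (lab p) ≡ lab q → pos (partner x) ≡ q
      pos-of e f = trans (cong (pos ∘ partner) (sym (lab-of e))) (trans (cong pos f) (pos-lab _))

    oriented⇒Or : ∀ {i j x} → ⌊ pos x /2⌋ ≡ i → Oriented₂ C i j → Or C x
    oriented⇒Or {x = x} refl (a , b) with dbl-half (pos x)
    ... | inj₁ e = trans (odd-L e) (sym (odd-L (pos-of e a)))
    ... | inj₂ e = trans (odd-R e) (sym (odd-R (pos-of e b)))

    unoriented⇒¬Or : ∀ {i j x} → ⌊ pos x /2⌋ ≡ i → Unoriented₂ C i j → ¬ Or C x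
    unoriented⇒¬Or {x = x} refl (a , b) o with dbl-half (pos x)
    ... | inj₁ e with trans (sym (odd-L e)) (trans o (odd-R (pos-of e a)))
    ... | ()
    unoriented⇒¬Or {x = x} refl (a , b) o | inj₂ e with trans (sym (odd-R e)) (trans o (odd-L (pos-of e b)))
    ... | ()

    Or⇒oriented : ∀ {x} → Or C x → Oriented₂ C ⌊ pos x /2⌋ ⌊ pos (partner x) /2⌋
    Or⇒oriented {x} o with form-at x
    ... | inj₁ f = f
    ... | inj₂ u = ⊥-elim (unoriented⇒¬Or {x = x} refl u o)

    Or-nontrivial : ∀ {x} → Or C x → Nontrivial β x
    Or-nontrivial {x} o e with trans o (trans (cong (odd ∘ pos) (sym e)) (trans (cong odd (pos-β x)) (odd-partner (pos x))))
    ... | q = not-¬ {odd (pos x)} refl q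

    Or-grey : ∀ {x} → Or C x → Or C (partner x)
    Or-grey {x} o = trans (sym o) (cong (odd ∘ pos) (sym (partner-involutive x)))

    Or-black : ∀ {x} → Or C x → Or C (β x)
    Or-black {x} o = trans (flips x) (trans (cong not o) (sym (trans (cong (odd ∘ pos) (comm x)) (flips (partner x)))))
      where
      flips : ∀ y → odd (pos (β y)) ≡ not (odd (pos y))
      flips y = trans (cong odd (pos-β y)) (odd-partner (pos y))

    Oriented-sym : ∀ {k l} → Oriented₂ C k l → Oriented₂ C l k
    Oriented-sym (a , b) = sym (partner-swap a) , sym (partner-swap b)

    elsewhere : ∀ {i j m} → Oriented₂ C i j → ¬ Or C m → ⌊ pos m /2⌋ ≢ i × ⌊ pos m /2⌋ ≢ j
    elsewhere {m = m} o n = (λ e → n (oriented⇒Or {x = m} e o)) , (λ e → n (oriented⇒Or {x = m} e (Oriented-sym o)))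

    private
      -- Symmetry of crossing for two intervals without a common end.
      inside : ∀ {lo hi a b} → a ≢ hi → b ≢ hi → a ≢ lo → b ≢ lo → lo < hi →
        (Between a b lo × ¬ Between a b hi) ⊎ (Between a b hi × ¬ Between a b lo) →
        ((lo < a × a < hi) × ¬ (lo < b × b < hi)) ⊎ (¬ (lo < a × a < hi) × (lo < b × b < hi))
      inside {lo} {hi} {a} {b} n₁ n₂ n₃ n₄ h (inj₁ (inj₁ (k , l) , m)) =
        inj₂ ((λ q → <-asym k (proj₁ q)) , l , ≤∧≢⇒< (≮⇒≥ (λ q → m (inj₁ (<-trans k h , q)))) n₂)
      inside {lo} {hi} {a} {b} n₁ n₂ n₃ n₄ h (inj₁ (inj₂ (k , l) , m)) =
        inj₁ ((l , ≤∧≢⇒< (≮⇒≥ (λ q → m (inj₂ (<-trans k h , q)))) n₁) , (λ q → <-asym k (proj₁ q)))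
      inside {lo} {hi} {a} {b} n₁ n₂ n₃ n₄ h (inj₂ (inj₁ (k , l) , m)) =
        inj₁ ((≤∧≢⇒< (≮⇒≥ (λ q → m (inj₁ (q , <-trans h l)))) (n₃ ∘ sym) , k) , (λ q → <-asym l (proj₂ q)))
      inside {lo} {hi} {a} {b} n₁ n₂ n₃ n₄ h (inj₂ (inj₂ (k , l) , m)) =
        inj₂ ((λ q → <-asym l (proj₂ q)) , ≤∧≢⇒< (≮⇒≥ (λ q → m (inj₂ (q , <-trans h l)))) (n₄ ∘ sym) , k)

      half≢ : ∀ {p q i} → ⌊ p /2⌋ ≢ i → ⌊ q /2⌋ ≡ i → p ≢ q
      half≢ n e refl = n e

      separated : ∀ {i j lo hi a b} → ⌊ a /2⌋ ≢ i × ⌊ a /2⌋ ≢ j → ⌊ b /2⌋ ≢ i × ⌊ b /2⌋ ≢ j →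
        (lo ≡ dbl i × hi ≡ dbl j) ⊎ (lo ≡ suc (dbl i) × hi ≡ suc (dbl j)) → i < j →
        (Between a b lo × ¬ Between a b hi) ⊎ (Between a b hi × ¬ Between a b lo) → Separated i j a b
      separated {i} {j} {a = a} {b} (a₁ , a₂) (b₁ , b₂) (inj₁ (refl , refl)) h q
        with inside (half≢ a₂ (half-dbl j)) (half≢ b₂ (half-dbl j)) (half≢ a₁ (half-dbl i)) (half≢ b₁ (half-dbl i))
               (<-trans (n<1+n _) (dbl-mono-< h)) q
      ... | inj₁ ((k , l) , n) = inj₁ ((k , <⇒≤ l) , λ r → n (<-trans (n<1+n _) (proj₁ (in-strict r b₁ b₂)) , proj₂ (in-strict r b₁ b₂)))
      ... | inj₂ (n , (k , l)) = inj₂ ((λ r → n (<-trans (n<1+n _) (proj₁ (in-strict r a₁ a₂)) , proj₂ (in-strict r a₁ a₂))) , k , <⇒≤ l)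
      separated {i} {j} {a = a} {b} (a₁ , a₂) (b₁ , b₂) (inj₂ (refl , refl)) h q
        with inside (half≢ a₂ (half-sdbl j)) (half≢ b₂ (half-sdbl j)) (half≢ a₁ (half-sdbl i)) (half≢ b₁ (half-sdbl i))
               (s≤s (<-trans (n<1+n _) (dbl-mono-< h))) q
      ... | inj₁ ((k , l) , n) = inj₁ ((<-trans (n<1+n _) k , ≤-pred l) , λ r → n (proj₁ (in-strict r b₁ b₂) , m<n⇒m<1+n (proj₂ (in-strict r b₁ b₂))))
      ... | inj₂ (n , (k , l)) = inj₂ ((λ r → n (proj₁ (in-strict r a₁ a₂) , m<n⇒m<1+n (proj₂ (in-strict r a₁ a₂)))) , <-trans (n<1+n _) k , ≤-pred l)

      ends : ∀ {d} → Or C d → (pos d ≡ dbl ⌊ pos d /2⌋ × pos (partner d) ≡ dbl ⌊ pos (partner d) /2⌋)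
                            ⊎ (pos d ≡ suc (dbl ⌊ pos d /2⌋) × pos (partner d) ≡ suc (dbl ⌊ pos (partner d) /2⌋))
      ends {d} o with dbl-half (pos d) | dbl-half (pos (partner d))
      ... | inj₁ p | inj₁ q = inj₁ (p , q)
      ... | inj₂ p | inj₂ q = inj₂ (p , q)
      ... | inj₁ p | inj₂ q with trans (sym (odd-L p)) (trans o (odd-R q))
      ... | ()
      ends {d} o | inj₂ p | inj₁ q with trans (sym (odd-R p)) (trans o (odd-L q))
      ... | ()

    -- Steps within a cycle preserve orientation, so this link leads to a different cycle, and the
    -- reversal that resolves that cycle separates the ends of the grey edge of m.
    link-to-oriented : ∀ {m d} → Lk C m d → ¬ Or C m → Or C d → ∃₂ λ i j → i < j × Oriented₂ C i j × Crosses C i j m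
    link-to-oriented {m} along-black n o = ⊥-elim (n (subst (Or C) (β-involutive m) (Or-black o)))
    link-to-oriented {m} along-grey  n o = ⊥-elim (n (subst (Or C) (partner-involutive m) (Or-grey o)))
    link-to-oriented {m} {d} (across p q) n o with <-cmp ⌊ pos d /2⌋ ⌊ pos (partner d) /2⌋
    ... | tri< h _ _ = _ , _ , h , Or⇒oriented o
      , separated (elsewhere (Or⇒oriented {d} o) n) (elsewhere (Or⇒oriented {d} o) n′) (ends {d} o) h (inj₁ (p , q))
      where
      n′ : ¬ Or C (partner m)
      n′ = n ∘ subst (Or C) (partner-involutive m) ∘ Or-grey
    ... | tri≈ _ e _ = ⊥-elim (halves≢ (Or-nontrivial {d} o) e)
    ... | tri> _ _ h = _ , _ , h , Oriented-sym (Or⇒oriented {d} o)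
      , separated (elsewhere (Oriented-sym (Or⇒oriented {d} o)) n) (elsewhere (Oriented-sym (Or⇒oriented {d} o)) n′)
          (swap-ends (ends {d} o)) h (inj₂ (p , q))
      where
      n′ : ¬ Or C (partner m)
      n′ = n ∘ subst (Or C) (partner-involutive m) ∘ Or-grey
      swap-ends : ∀ {A B A′ B′ : Set} → (A × B) ⊎ (A′ × B′) → (B × A) ⊎ (B′ × A′)
      swap-ends (inj₁ (a , b)) = inj₁ (b , a)
      swap-ends (inj₂ (a , b)) = inj₂ (b , a)

    LkN : ℕ → ℕ → Set
    LkN x y = ¬ Or C x × Lk C x y

    or? : ∀ x → Dec (Or C x)
    or? x = odd (pos x) ≟ᵇ odd (pos (partner x))

    first-oriented : ∀ {x k} → Star (Lk C) x k → Or C k → Or C x ⊎ ∃₂ λ m d → Star LkN x m × Lk C m d × ¬ Or C m × Or C d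
    first-oriented nil o = inj₁ o
    first-oriented {x} (_◅_ {j = y} l ls) o with or? x
    ... | yes o′ = inj₁ o′
    ... | no n with first-oriented ls o
    ... | inj₁ o″ = inj₂ (x , y , nil , l , n , o″)
    ... | inj₂ (m , d , ks , k , nm , od) = inj₂ (m , d , (n , l) ◅ ks , k , nm , od)

    module _ {C′ : Cfg} {i j : ℕ} (R : RevOf C C′ i j) (red : ∀ x → ¬ Or C x → Cfg.β C′ x ≡ β x) where
      -- The first grey edge on the path that the reversal crosses becomes oriented; one exists
      -- because m is crossed. Every earlier link starts at an edge with both ends on one side of
      -- the reversal and survives.
      shorten : ∀ {x m} → Star LkN x m → ¬ Or C m → Crosses C i j m → ∃ λ k → Star (Lk C′) x k × Or C′ k
      shorten nil n c = _ , nil , crosses-oriented {C} {C′} R c n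
      shorten {x} ((n , l) ◅ ls) nm c with separated? i j (pos x) (pos (partner x))
      ... | inj₁ c′ = x , nil , crosses-oriented {C} {C′} R c′ n
      ... | inj₂ s with shorten ls nm c
      ... | k , ks , o = k , keep l ◅ ks , o
        where
        keep : ∀ {y} → Lk C x y → Lk C′ x y
        keep along-black  = subst (Lk C′ x) (red x n) along-black
        keep along-grey   = along-grey
        keep (across p q) = across-rev {C} {C′} R s p q

  -- Induction on the number of 2-cycles, not on the path: each round resolves one in three flips,
  -- and the leftmost one, once oriented, needs a single flip.
  sort-oriented : ∀ m {σ} (P : Perm σ) → let open Cfg (cfg P) in Simp β → β 0 ≢ 1 → Meas β (suc m) →
    ∀ {k} → Star (Lk (cfg P)) 0 k → Or (cfg P) k → Sortable σ (1 + 3 * m)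
  sort-oriented m {σ} P s b M path o with Orient.first-oriented (cfg P) s path o
  ... | inj₁ o₀ = sort₁ refl (sort-fixed-first m m ≤-refl P′ simp′ fixed (meas M))
    where
    open Cfg (cfg P)
    open Orient (cfg P) s
    j = ⌊ pos 1 /2⌋
    half-0 : ⌊ pos 0 /2⌋ ≡ 0
    half-0 = cong ⌊_/2⌋ pos-0
    o′ : Oriented₂ (cfg P) 0 j
    o′ = subst (λ z → Oriented₂ (cfg P) z j) half-0 (Or⇒oriented {0} o₀)
    h : 0 < j
    h = n≢0⇒n>0 (λ e → halves≢ {0} b (trans half-0 (sym e)))
    open Clicked (click P s h o′)
    fixed : Cfg.β (cfg P′) 0 ≡ 1
    fixed = subst (λ z → Cfg.β (cfg P′) z ≡ partner z) lab-0 trivial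
  ... | inj₂ (m₀ , d , ls , l , nm , od) with Orient.link-to-oriented (cfg P) s l nm od
  ... | i , j , h , o′ , c = go m M (Orient.shorten (cfg P) s {cfg P′} revOf red ls nm c)
    where
    open Cfg (cfg P)
    open Orient (cfg P) s
    open Clicked (click P s h o′)
    open Swap (swap-rev {cfg P} {cfg P′} revOf h)

    red : ∀ x → ¬ Or (cfg P) x → Cfg.β (cfg P′) x ≡ β x
    red x n = other x (off (proj₁ e) (half-dbl i)) (off (proj₁ e) (half-sdbl i)) (off (proj₂ e) (half-dbl j)) (off (proj₂ e) (half-sdbl j))
      where
      e = elsewhere {m = x} o′ n
      off : ∀ {p k} → ⌊ pos x /2⌋ ≢ k → ⌊ p /2⌋ ≡ k → x ≢ lab p
      off n q refl = n (trans (cong ⌊_/2⌋ (pos-lab _)) q)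

    ¬Or-0 : ∀ {x m} → Star LkN x m → ¬ Or (cfg P) m → ¬ Or (cfg P) x
    ¬Or-0 nil          n = n
    ¬Or-0 ((n , _) ◅ _) _ = n

    n₀ : ¬ Or (cfg P) 0
    n₀ = ¬Or-0 ls nm

    1≤i : 1 ≤ i
    1≤i = n≢0⇒n>0 (λ e → n₀ (oriented⇒Or {x = 0} (trans (cong ⌊_/2⌋ pos-0) (sym e)) o′))

    b′ : Cfg.β (cfg P′) 0 ≢ 1
    b′ e = b (trans (sym (red 0 n₀)) e)

    go : ∀ m → Meas β (suc m) → (∃ λ k → Star (Lk (cfg P′)) 0 k × Or (cfg P′) k) → Sortable σ (1 + 3 * m)
    -- The leftmost 2-cycle is still there after the move, so the measure cannot have reached 0.
    go zero    M _             = ⊥-elim (empty-meas (meas M) b′)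
    go (suc m) M (k , ks , ok) = subst (Sortable σ ∘ suc) (sym (*-suc 3 m))
      (sort₃ 1≤i (sort-oriented m P′ simp′ b′ (meas M) ks ok))

open OrientedLeftmost

-- Turning a nonoriented leftmost cycle.

module AnyLeftmost where
  open import Data.Nat
  open import Data.Nat.Properties

  -- The grey edges {a,d} and {b,c} make one 2-cycle with the black edges {a,b}, {c,d} and again
  -- with {a,c}, {b,d}. Hence the flip keeps `Simp` and the number of 2-cycles.
  module Turn {β β′ : ℕ → ℕ} {a b c d : ℕ} (S : Swap β β′ a b c d) (inv : ∀ x → β (β x) ≡ x)
              (s : Simp β) (γa : partner a ≡ d) (γb : partner b ≡ c) where
    open Swap S

    private
      γc : partner c ≡ b
      γc = trans (cong partner (sym γb)) (partner-involutive b)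
      γd : partner d ≡ a
      γd = trans (cong partner (sym γa)) (partner-involutive a)

      data Corner : ℕ → Set where
        isa : Corner a
        isb : Corner b
        isc : Corner c
        isd : Corner d

      corner? : ∀ x → Dec (Corner x)
      corner? x with x ≟ a | x ≟ b | x ≟ c | x ≟ d
      ... | yes refl | _ | _ | _ = yes isa
      ... | no _ | yes refl | _ | _ = yes isb
      ... | no _ | no _ | yes refl | _ = yes isc
      ... | no _ | no _ | no _ | yes refl = yes isd
      ... | no p | no q | no r | no t = no λ { isa → p refl ; isb → q refl ; isc → r refl ; isd → t refl }

      corner-γ : ∀ {x} → Corner x → Corner (partner x)
      corner-γ isa = subst Corner (sym γa) isd
      corner-γ isb = subst Corner (sym γb) isc
      corner-γ isc = subst Corner (sym γc) isb
      corner-γ isd = subst Corner (sym γd) isa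

      corner-β : ∀ {x} → Corner x → Corner (β x)
      corner-β isa = subst Corner (sym βa) isb
      corner-β isb = subst Corner (trans (sym (inv a)) (cong β βa)) isa
      corner-β isc = subst Corner (sym βc) isd
      corner-β isd = subst Corner (trans (sym (inv c)) (cong β βc)) isc

      corner-γ⁻ : ∀ {x} → Corner (partner x) → Corner x
      corner-γ⁻ k = subst Corner (partner-involutive _) (corner-γ k)

      corner-β⁻ : ∀ {x} → Corner (β x) → Corner x
      corner-β⁻ k = subst Corner (inv _) (corner-β k)

      away : ∀ {x} → ¬ Corner x → β′ x ≡ β x
      away {x} n = other x (λ { refl → n isa }) (λ { refl → n isb }) (λ { refl → n isc }) (λ { refl → n isd })

      far′ : ∀ {x y z} → β′ x ≡ y → partner y ≡ z → Cyc β′ x z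
      far′ refl refl = via-both
      black′ : ∀ {x y} → β′ x ≡ y → Cyc β′ x y
      black′ refl = via-black
      grey′ : ∀ {x y} → partner x ≡ y → Cyc β′ x y
      grey′ refl = via-grey

      corners : ∀ {x y} → Corner x → Corner y → Cyc β′ x y
      corners isa isa = same
      corners isa isb = far′ at-a γc
      corners isa isc = black′ at-a
      corners isa isd = grey′ γa
      corners isb isa = far′ at-b γd
      corners isb isb = same
      corners isb isc = grey′ γb
      corners isb isd = black′ at-b
      corners isc isa = black′ at-c
      corners isc isb = grey′ γc
      corners isc isc = same
      corners isc isd = far′ at-c γa
      corners isd isa = grey′ γd
      corners isd isb = black′ at-d
      corners isd isc = far′ at-d γb
      corners isd isd = same

      corner-cyc⁻ : ∀ {x y} → Cyc β x y → Corner y → Corner x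
      corner-cyc⁻ same   k = k
      corner-cyc⁻ via-black k = corner-β⁻ k
      corner-cyc⁻ via-grey  k = corner-γ⁻ k
      corner-cyc⁻ via-both   k = corner-β⁻ (corner-γ⁻ k)

      corner-cyc : ∀ {x y} → Cyc β x y → Corner x → Corner y
      corner-cyc same   k = k
      corner-cyc via-black k = corner-β k
      corner-cyc via-grey  k = corner-γ k
      corner-cyc via-both   k = corner-γ (corner-β k)

      walk : ∀ {x y z w} → β′ x ≡ y → partner y ≡ z → β′ z ≡ w → partner w ≡ x → partner (β′ (partner (β′ x))) ≡ x
      walk refl refl refl e = e

    turn-simp : Simp β′
    turn-simp x with corner? x
    ... | yes isa = walk at-a γc at-b γd
    ... | yes isb = walk at-b γd at-a γc
    ... | yes isc = walk at-c γa at-d γb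
    ... | yes isd = walk at-d γb at-c γa
    ... | no n = trans (cong (partner ∘ β′ ∘ partner) (away n))
      (trans (cong partner (away (n ∘ corner-β⁻ ∘ corner-γ⁻))) (s x))

    turn-meas : ∀ {m} → Nontrivial β a → Meas β m → Meas β′ m
    turn-meas n (ds , l , c) = ds , l , cover
      where
      cover : ∀ y → Nontrivial β′ y → ∃ λ d → d ∈ ds × Cyc β′ d y
      cover y n′ with corner? y
      ... | yes k with c a n
      ... | e , h , q = e , h , corners (corner-cyc⁻ q isa) k
      cover y n′ | no k with c y (n′ ∘ trans (away k))
      ... | e , h , q = e , h , keep q
        where
        e∉ : ¬ Corner e
        e∉ = k ∘ corner-cyc q
        keep : ∀ {z} → Cyc β e z → Cyc β′ e z
        keep same   = same
        keep via-black = black′ (away e∉)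
        keep via-grey  = via-grey
        keep via-both   = far′ (away e∉) refl

  -- If the leftmost cycle is nonoriented, either a cycle crossing it is oriented or becomes so by
  -- one flip that turns the leftmost cycle.
  sort-simple : ∀ m {σ} (P : Perm σ) → let open Cfg (cfg P) in
    Simp β → β 0 ≢ 1 → Meas β (suc m) → Sortable σ (2 + 3 * m)
  sort-simple m {σ} P s b M with Orient.or? (cfg P) s 0
  ... | yes o = sortable-≤ (n≤1+n _) (sort-oriented m P s b M nil o)
  ... | no n with ⌊ Cfg.pos (cfg P) 0 /2⌋ | Geometry.form-at (cfg P) s 0 | Orient.oriented⇒Or (cfg P) s {x = 0} refl
                | cong ⌊_/2⌋ (Cfg.pos-0 (cfg P))
                | Geometry.halves≢ (cfg P) s {0} b
  ... | .0 | inj₁ o | or | refl | _ = ⊥-elim (n (or o))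
  ... | .0 | inj₂ u | _ | refl | n≢ = by-crossing (crossing h u)
    where
    open Cfg (cfg P)
    open Geometry (cfg P) s
    j = ⌊ pos 1 /2⌋
    h : 0 < j
    h = n≢0⇒n>0 (n≢ ∘ sym)

    pos-1 : pos 1 ≡ suc (dbl j)
    pos-1 = trans (cong (pos ∘ partner) (sym lab-0)) (trans (cong pos (proj₁ u)) (pos-lab _))

    to : ∀ {p} → In 0 j p → Between (pos 0) (pos 1) p
    to (k , l) = subst₂ (λ a b → Between a b _) (sym pos-0) (sym pos-1) (inj₁ (k , s≤s l))

    from : ∀ {p} → Between (pos 0) (pos 1) p → In 0 j p
    from q with subst₂ (λ a b → Between a b _) pos-0 pos-1 q
    ... | inj₁ (k , s≤s l) = k , l

    by-crossing : (∃ λ x → In 0 j (pos x) × ¬ In 0 j (pos (partner x)) × _) → Sortable σ (2 + 3 * m)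
    by-crossing (x , k , l , _) with Orient.or? (cfg P) s x
    ... | yes o = sortable-≤ (n≤1+n _) (sort-oriented m P s b M (across (to k) (l ∘ from) ◅ nil) o)
    -- The grey edge {0,1} has both ends outside the flipped block, so its link to x survives, while
    -- x is crossed and becomes oriented.
    ... | no n′ = sort₁ refl (sort-oriented m P′ turn-simp b′ (turn-meas nontriv M)
      (across-rev {cfg P} {cfg P′} revOf (inj₂ (out₀ , out₁)) (to k) (l ∘ from) ◅ nil)
      (crosses-oriented {cfg P} {cfg P′} revOf {x} (inj₁ (k , l)) n′))
      where
      open Reversed (reverse-at P h (form-bound P h (inj₂ u)))
      module C′ = Cfg (cfg P′)
      S = swap-rev {cfg P} {cfg P′} revOf h
      open Turn S β-involutive s (proj₁ u) (proj₂ u)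
      nontriv : Nontrivial β (lab 0)
      nontriv = form-nontrivial (<⇒≢ h) (inj₂ u)
      b′ : C′.β 0 ≢ 1
      b′ e = dbl≢sdbl {j} {j} (lab-injective (trans (sym (Swap.at-a S)) (trans (cong C′.β lab-0)
        (trans e (trans (cong partner (sym lab-0)) (proj₁ u))))))
      out₀ : ¬ In 0 j (pos 0)
      out₀ = left-¬In 0 j ∘ subst (In 0 j) pos-0
      out₁ : ¬ In 0 j (pos 1)
      out₁ = right-¬In 0 j ∘ subst (In 0 j) pos-1

open AnyLeftmost

-- Counting lemmas, and the walks of the definition of cycles.

module Counting where
  open import Data.Nat
  open import Data.Nat.Properties
  open import Data.Nat.Tactic.RingSolver using (solve-∀)

  unique-⊆-length : ∀ {A : Set} {xs ys : List A} → Unique xs → (∀ {x} → x ∈ xs → x ∈ ys) → length xs ≤ length ys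
  unique-⊆-length {xs = []} _ _ = z≤n
  unique-⊆-length {xs = x ∷ xs} (n ∷ u) sub with ∈-∃++ (sub (here refl))
  ... | ys , zs , refl = ≤-trans (s≤s (unique-⊆-length u sub′))
    (≤-reflexive (sym (trans (length-++ ys) (trans (+-suc (length ys) (length zs)) (cong suc (sym (length-++ ys)))))))
    where
    sub′ : ∀ {y} → y ∈ xs → y ∈ ys ++ zs
    sub′ h with ∈-++⁻ ys (sub (there h))
    ... | inj₁ k           = ∈-++⁺ˡ k
    ... | inj₂ (here refl) = ⊥-elim (All.lookup n h refl)
    ... | inj₂ (there k)   = ∈-++⁺ʳ ys k

  trues : (ℕ → Bool) → List ℕ → List ℕ
  trues f = filter (dec-T ∘ f)

  countB-length : ∀ f xs → countB f xs ≡ length (trues f xs)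
  countB-length f []       = refl
  countB-length f (x ∷ xs) with f x
  ... | true  = cong suc (countB-length f xs)
  ... | false = countB-length f xs

  module _ {f : ℕ → Bool} {xs : List ℕ} where
    ∈-trues⁺ : ∀ {x} → x ∈ xs → T (f x) → x ∈ trues f xs
    ∈-trues⁺ = ∈-filter⁺ (dec-T ∘ f)

    ∈-trues⁻ : ∀ {x} → x ∈ trues f xs → x ∈ xs × T (f x)
    ∈-trues⁻ = ∈-filter⁻ (dec-T ∘ f)

    countB-≥ : ∀ {ys} → Unique ys → (∀ {y} → y ∈ ys → y ∈ xs × T (f y)) → length ys ≤ countB f xs
    countB-≥ {ys} u h = subst (length ys ≤_) (sym (countB-length f xs))
      (unique-⊆-length u (λ k → ∈-trues⁺ (proj₁ (h k)) (proj₂ (h k))))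

    countB-≤ : ∀ {ys} → Unique xs → (∀ {y} → y ∈ xs → T (f y) → y ∈ ys) → countB f xs ≤ length ys
    countB-≤ {ys} u h = subst (_≤ length ys) (sym (countB-length f xs))
      (unique-⊆-length (Unique.filter⁺ (dec-T ∘ f) u) (λ k → h (proj₁ (∈-trues⁻ k)) (proj₂ (∈-trues⁻ k))))

  countB-cong : ∀ {f g} xs → (∀ {x} → x ∈ xs → f x ≡ g x) → countB f xs ≡ countB g xs
  countB-cong []       h = refl
  countB-cong {f} {g} (x ∷ xs) h rewrite h (here refl) with g x
  ... | true  = cong suc (countB-cong xs (h ∘ there))
  ... | false = countB-cong xs (h ∘ there)

  countB-mono : ∀ {f g} xs (μ : ℕ → ℕ) → Unique xs → (∀ {x} → μ (μ x) ≡ x) → (∀ {x} → x ∈ xs → μ x ∈ xs) →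
    (∀ {x} → T (f x) → T (g (μ x))) → countB f xs ≤ countB g xs
  countB-mono {f} {g} xs μ u inv cl h = subst₂ _≤_
    (trans (length-map μ (trues f xs)) (sym (countB-length f xs))) refl
    (countB-≥ {g} {xs} (Unique.map⁺ (λ e → trans (sym inv) (trans (cong μ e) inv)) (Unique.filter⁺ (dec-T ∘ f) u)) in-g)
    where
    in-g : ∀ {y} → y ∈ map μ (trues f xs) → y ∈ xs × T (g y)
    in-g k with ∈-map⁻ μ k
    ... | x , k′ , refl = cl (proj₁ (∈-trues⁻ {f} {xs} k′)) , h (proj₂ (∈-trues⁻ {f} {xs} k′))

  bool-≡ : ∀ {a b} → (T a → T b) → (T b → T a) → a ≡ b
  bool-≡ {true}  {true}  _ _ = refl
  bool-≡ {false} {false} _ _ = refl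
  bool-≡ {true}  {false} f _ = ⊥-elim (f _)
  bool-≡ {false} {true}  _ g = ⊥-elim (g _)

  Exactly-one : Bool × Bool × Bool → Set
  Exactly-one t = t ≡ (true , false , false) ⊎ t ≡ (false , false , true) ⊎ t ≡ (false , true , false)

  trichotomous : ∀ a b → Exactly-one ((a <ᵇ b) , (b <ᵇ a) , (a ≡ᵇ b))
  trichotomous zero    zero    = inj₂ (inj₁ refl)
  trichotomous zero    (suc b) = inj₁ refl
  trichotomous (suc a) zero    = inj₂ (inj₂ refl)
  trichotomous (suc a) (suc b) = trichotomous a b

  -- Each cycle of an involution is counted at its least element.
  involution-count : ∀ (μ : ℕ → ℕ) xs → Unique xs → (∀ {x} → μ (μ x) ≡ x) → (∀ {x} → x ∈ xs → μ x ∈ xs) →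
    length xs + countB (λ i → not (μ i <ᵇ i)) xs ≡ 3 * countB (λ i → i <ᵇ μ i) xs + 2 * countB (λ i → i ≡ᵇ μ i) xs
  involution-count μ xs u inv cl = begin
      length xs + L
        ≡⟨ cong₂ _+_ (split xs) (split≤ xs) ⟩
      (A + G + E) + (A + E)
        ≡⟨ cong (λ z → (A + z + E) + (A + E)) (≤-antisym G≤A A≤G) ⟩
      (A + A + E) + (A + E)
        ≡⟨ regroup A E ⟩
      3 * A + 2 * E ∎
    where
    open ≡-Reasoning
    L = countB (λ i → not (μ i <ᵇ i)) xs
    A = countB (λ i → i <ᵇ μ i) xs
    E = countB (λ i → i ≡ᵇ μ i) xs
    G = countB (λ i → μ i <ᵇ i) xs
    regroup : ∀ a e → (a + a + e) + (a + e) ≡ 3 * a + 2 * e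
    regroup = solve-∀
    A≤G : A ≤ G
    A≤G = countB-mono xs μ u inv cl (λ {x} h → subst (λ z → T (z <ᵇ μ x)) (sym inv) h)
    G≤A : G ≤ A
    G≤A = countB-mono xs μ u inv cl (λ {x} h → subst (λ z → T (μ x <ᵇ z)) (sym inv) h)
    split : ∀ ys → length ys ≡ countB (λ i → i <ᵇ μ i) ys + countB (λ i → μ i <ᵇ i) ys + countB (λ i → i ≡ᵇ μ i) ys
    split []       = refl
    split (y ∷ ys) with y <ᵇ μ y | μ y <ᵇ y | y ≡ᵇ μ y | trichotomous y (μ y)
    ... | _ | _ | _ | inj₁ refl        = cong suc (split ys)
    ... | _ | _ | _ | inj₂ (inj₁ refl) = trans (cong suc (split ys)) (sym (+-suc _ _))
    ... | _ | _ | _ | inj₂ (inj₂ refl) =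
      trans (cong suc (split ys)) (cong (_+ countB (λ i → i ≡ᵇ μ i) ys) (sym (+-suc (countB (λ i → i <ᵇ μ i) ys) _)))
    split≤ : ∀ ys → countB (λ i → not (μ i <ᵇ i)) ys ≡ countB (λ i → i <ᵇ μ i) ys + countB (λ i → i ≡ᵇ μ i) ys
    split≤ []       = refl
    split≤ (y ∷ ys) with y <ᵇ μ y | μ y <ᵇ y | y ≡ᵇ μ y | trichotomous y (μ y)
    ... | _ | _ | _ | inj₁ refl        = cong suc (split≤ ys)
    ... | _ | _ | _ | inj₂ (inj₁ refl) = trans (cong suc (split≤ ys)) (sym (+-suc _ _))
    ... | _ | _ | _ | inj₂ (inj₂ refl) = split≤ ys

  module Walks {π} (P : Perm π) where
    open Cfg (cfg P) public
    n = length π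
    N = dbl (suc n)

    -- The step `next` as a bijection of all positions; on labels it is `partner ∘ β`.
    τ : ℕ → ℕ
    τ p = pos (partner (lab (partner p)))

    lab-τ : ∀ p → lab (τ p) ≡ partner (β (lab p))
    lab-τ p = trans (lab-pos _) (cong partner (sym (β-lab p)))

    lab-< : ∀ {p} → p < N → lab p < N
    lab-< l = subst (_< N) (sym (labOf-< {π} l)) (label-< P l)

    position≡pos : ∀ {x} → x < N → position π x ≡ pos x
    position≡pos l = sym (posOf-< {π} l)

    pos-< : ∀ {x} → x < N → pos x < N
    pos-< l = subst (_< N) (position≡pos l) (proj₂ (position-< P l))

    τ-< : ∀ {p} → p < N → τ p < N
    τ-< l = pos-< (partner-< (suc n) (lab-< (partner-< (suc n) l)))

    next≡τ : ∀ {p} → p < N → next π p ≡ τ p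
    next≡τ {p} l = trans (cong (position π ∘ partner) (sym (labOf-< {π} l′)))
      (position≡pos (partner-< (suc n) (lab-< l′)))
      where l′ = partner-< (suc n) l

    iter-τ : ∀ k {p} → p < N → iter k (next π) p ≡ iter k τ p × iter k τ p < N
    iter-τ zero    l = refl , l
    iter-τ (suc k) l with iter-τ k l
    ... | e , m = trans (cong (next π) e) (next≡τ m) , τ-< m

    2n+2 : 2 * n + 2 ≡ N
    2n+2 = trans (+-comm (2 * n) 2) (cong (suc ∘ suc) (2*≡dbl n))

    private
      steps : ℕ → ℕ → List ℕ
      steps p k = iter k (next π) p ∷ partner (iter k (next π) p) ∷ []

    inCycle-intro : ∀ {p} k {q} → p < N → k < N → q ≡ iter k τ p ⊎ q ≡ partner (iter k τ p) → T (inCycle π p q)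
    inCycle-intro {p} k {q} l h e = Any.any⁺ _ (lose (∈-concatMap⁺ (steps p) (lose (∈-upTo⁺ (subst (k <_) (sym 2n+2) h)) (mem e))) (≡⇒≡ᵇ q q refl))
      where
      mem : q ≡ iter k τ p ⊎ q ≡ partner (iter k τ p) → q ∈ steps p k
      mem (inj₁ refl) = here (sym (proj₁ (iter-τ k l)))
      mem (inj₂ refl) = there (here (cong partner (sym (proj₁ (iter-τ k l)))))

    inCycle-elim : ∀ {p q} → p < N → T (inCycle π p q) → ∃ λ k → q ≡ iter k τ p ⊎ q ≡ partner (iter k τ p)
    inCycle-elim {p} {q} l t with find (Any.any⁻ (λ v → v ≡ᵇ q) (cycleVerts π p) t)
    ... | v , h , e with ≡ᵇ⇒≡ v q e
    ... | refl with find (∈-concatMap⁻ (steps p) {xs = upTo (2 * n + 2)} h)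
    ... | k , _ , here r         = k , inj₁ (trans r (proj₁ (iter-τ k l)))
    ... | k , _ , there (here r) = k , inj₂ (trans r (cong partner (proj₁ (iter-τ k l))))

    τ-injective : ∀ {p q} → τ p ≡ τ q → p ≡ q
    τ-injective e = partner-injective (lab-injective (partner-injective (pos-injective e)))

    τ≢partner : ∀ p → τ p ≢ partner p
    τ≢partner p e = partner≢ (lab (partner p)) (trans (sym (lab-pos _)) (cong lab e))

    edge-in : ∀ {p} k → p < N → k < N → T (inCycle π p (dbl ⌊ iter k τ p /2⌋))
    edge-in {p} k l h = inCycle-intro k l h (even (iter k τ p))
      where
      even : ∀ q → dbl ⌊ q /2⌋ ≡ q ⊎ dbl ⌊ q /2⌋ ≡ partner q
      even q with dbl-half q
      ... | inj₁ e = inj₁ (sym e)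
      ... | inj₂ e = inj₂ (trans (sym (partner-sdbl _)) (cong partner (sym e)))

    half-< : ∀ {q} → q < N → ⌊ q /2⌋ < suc n
    half-< {q} l with ⌊ q /2⌋ <? suc n
    ... | yes h = h
    ... | no m  = ⊥-elim (<⇒≱ l (≤-trans (dbl-mono-≤ (≮⇒≥ m)) (half-lower q)))

    dbl-<N : ∀ {i} → i ≤ n → dbl i < N
    dbl-<N h = <-trans (n<1+n _) (dbl-mono-< (s≤s h))

    cycLen-dbl : ∀ i → cycLen π i ≡ countB (λ j → inCycle π (dbl i) (dbl j)) (upTo (suc n))
    cycLen-dbl i = countB-cong (upTo (suc n)) (λ {j} _ → cong₂ (inCycle π) (2*≡dbl i) (2*≡dbl j))

    private
      three : ∀ {f : ℕ → Bool} {a b c} → a ≢ b → a ≢ c → b ≢ c → T (f a) → T (f b) → T (f c) →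
        a < suc n → b < suc n → c < suc n → 3 ≤ countB f (upTo (suc n))
      three {f} {a} {b} {c} ab ac bc ta tb tc la lb lc =
        countB-≥ {f} {upTo (suc n)} {a ∷ b ∷ c ∷ []} ((ab ∷ ac ∷ []) ∷ (bc ∷ []) ∷ [] ∷ [])
          λ { (here refl) → ∈-upTo⁺ la , ta ; (there (here refl)) → ∈-upTo⁺ lb , tb
            ; (there (there (here refl))) → ∈-upTo⁺ lc , tc }

    -- Three successive black edges cannot all differ, and each coincidence forces the claim, as a
    -- walk never returns by the other end of a black edge. By 1 ≤ n the third edge is among those
    -- that `cycleVerts` collects.
    simple⇒τ² : 1 ≤ n → Simple π → ∀ {i} → i ≤ n → τ (τ (dbl i)) ≡ dbl i
    simple⇒τ² 1≤n S {i} i≤ with ⌊ p₀ /2⌋ ≟ ⌊ p₁ /2⌋ | ⌊ p₁ /2⌋ ≟ ⌊ p₂ /2⌋ | ⌊ p₀ /2⌋ ≟ ⌊ p₂ /2⌋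
      where
      p₀ = dbl i
      p₁ = τ p₀
      p₂ = τ p₁
    ... | yes e | _ | _ with half-≡ (τ (dbl i)) (dbl i) (sym e)
    ... | inj₁ q = trans (cong τ q) q
    ... | inj₂ q = ⊥-elim (τ≢partner _ q)
    simple⇒τ² 1≤n S {i} i≤ | _ | yes e | _ with half-≡ (τ (τ (dbl i))) (τ (dbl i)) (sym e)
    ... | inj₁ q = trans q (τ-injective q)
    ... | inj₂ q = ⊥-elim (τ≢partner _ q)
    simple⇒τ² 1≤n S {i} i≤ | _ | _ | yes e with half-≡ (τ (τ (dbl i))) (dbl i) (sym e)
    ... | inj₁ q = q
    ... | inj₂ q = ⊥-elim (partner≢ (τ (dbl i)) (lab-injective (trans (sym (partner-involutive _))
      (trans (cong partner (trans (sym (lab-pos _)) (cong lab q))) (sym (lab-pos _))))))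
    simple⇒τ² 1≤n S {i} i≤ | no a | no b | no c = ⊥-elim (<⇒≱ (three {λ j → inCycle π (dbl i) (dbl j)} a c b
        (edge-in 0 l (s≤s z≤n)) (edge-in 1 l (s≤s (s≤s z≤n))) (edge-in 2 l (s≤s (s≤s (≤-trans (s≤s z≤n) (dbl-mono-≤ 1≤n)))))
        (half-< l) (half-< (τ-< l)) (half-< (τ-< (τ-< l))))
      (subst (_≤ 2) (cycLen-dbl i) (S i i≤)))
      where l = dbl-<N i≤

    trivial-beyond : ∀ {x} → ¬ ⌊ pos x /2⌋ ≤ n → β x ≡ partner x
    trivial-beyond {x} m = trans (lab-fixed P (partner-≥ (suc n) far))
      (cong partner (trans (sym (lab-fixed P far)) (lab-pos x)))
      where
      far : N ≤ pos x
      far = ≤-trans (dbl-mono-≤ (≰⇒> m)) (half-lower (pos x))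

    simple⇒Simp : 1 ≤ n → Simple π → Simp β
    simple⇒Simp 1≤n S x with ⌊ pos x /2⌋ ≤? n
    ... | no m = trans (cong (partner ∘ β ∘ partner) triv) (trans (cong (partner ∘ β) (partner-involutive x))
        (trans (cong partner triv) (partner-involutive x)))
      where
      triv : β x ≡ partner x
      triv = trivial-beyond m
    ... | yes m = go (dbl-half (pos x))
      where
      i = ⌊ pos x /2⌋
      square : ∀ p → τ (τ p) ≡ p → partner (β (partner (β (lab p)))) ≡ lab p
      square p e = trans (cong (partner ∘ β) (sym (lab-τ p))) (trans (sym (lab-τ (τ p))) (cong lab e))
      a = lab (dbl i)
      sq-a : partner (β (partner (β a))) ≡ a
      sq-a = square (dbl i) (simple⇒τ² 1≤n S m)
      -- The same cycle, traversed backwards.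
      sq-βa : partner (β (partner (β (β a)))) ≡ β a
      sq-βa = trans (cong (partner ∘ β ∘ partner) (β-involutive a)) (trans (cong (partner ∘ β ∘ partner) (sym sq-a))
        (trans (cong (partner ∘ β) (partner-involutive _)) (trans (cong partner (β-involutive _)) (partner-involutive _))))
      go : pos x ≡ dbl i ⊎ pos x ≡ suc (dbl i) → partner (β (partner (β x))) ≡ x
      go (inj₁ e) = subst (λ z → partner (β (partner (β z))) ≡ z) (trans (cong lab (sym e)) (lab-pos x)) sq-a
      go (inj₂ e) = subst (λ z → partner (β (partner (β z))) ≡ z)
        (trans (β-dbl i) (trans (cong lab (sym e)) (lab-pos x))) sq-βa

open Counting

-- The cycles of the given permutation: their number and their decomposition.

module InitialCycles where
  open import Data.Nat
  open import Data.Nat.Properties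

  module Initial {π} (P : Perm π) (s : Simp (Cfg.β (cfg P))) where
    open Walks P public
    open Geometry (cfg P) s public

    τ-involutive : ∀ p → τ (τ p) ≡ p
    τ-involutive p = lab-injective (trans (lab-τ (τ p)) (trans (cong (partner ∘ β) (lab-τ p)) (s (lab p))))

    iter-cases : ∀ k p → iter k τ p ≡ p ⊎ iter k τ p ≡ τ p
    iter-cases zero    p = inj₁ refl
    iter-cases (suc k) p with iter-cases k p
    ... | inj₁ e = inj₂ (cong τ e)
    ... | inj₂ e = inj₁ (trans (cong τ e) (τ-involutive p))

    inCycle⇒Cyc : ∀ {p q} → p < N → T (inCycle π p q) → Cyc β (lab p) (lab q)
    inCycle⇒Cyc {p} l t with inCycle-elim l t
    ... | k , e with iter-cases k p | e
    ... | inj₁ r | inj₁ e′ = subst (Cyc β (lab p)) (cong lab (sym (trans e′ r))) same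
    ... | inj₁ r | inj₂ e′ = subst (Cyc β (lab p)) (trans (β-lab p) (cong lab (sym (trans e′ (cong partner r))))) via-black
    ... | inj₂ r | inj₁ e′ = subst (Cyc β (lab p)) (trans (sym (lab-τ p)) (cong lab (sym (trans e′ r)))) via-both
    ... | inj₂ r | inj₂ e′ = subst (Cyc β (lab p)) grey-≡ via-grey
      where
      grey-≡ : partner (lab p) ≡ lab _
      grey-≡ = trans (cong partner (sym (β-involutive (lab p)))) (trans (comm (β (lab p)))
        (trans (cong β (sym (lab-τ p))) (trans (β-lab (τ p)) (cong lab (sym (trans e′ (cong partner r)))))))

    Cyc⇒inCycle : ∀ {p y} → p < N → Cyc β (lab p) y → T (inCycle π p (pos y))
    Cyc⇒inCycle {p} l same = inCycle-intro 0 l (s≤s z≤n) (inj₁ (pos-lab p))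
    Cyc⇒inCycle {p} l via-black = inCycle-intro 0 l (s≤s z≤n) (inj₂ (trans (pos-β (lab p)) (cong partner (pos-lab p))))
    Cyc⇒inCycle {p} l via-both = inCycle-intro 1 l (s≤s (s≤s z≤n)) (inj₁ (trans (cong pos (sym (lab-τ p))) (pos-lab _)))
    Cyc⇒inCycle {p} l via-grey = inCycle-intro 1 l (s≤s (s≤s z≤n))
      (inj₂ (trans (cong (pos ∘ partner) (sym (β-involutive (lab p)))) (trans (cong pos (comm (β (lab p))))
        (trans (cong (pos ∘ β) (sym (lab-τ p))) (trans (pos-β _) (cong partner (pos-lab _)))))))

    -- the other black edge of the 2-cycle through a black edge
    μ : ℕ → ℕ
    μ i = ⌊ τ (dbl i) /2⌋

    μ-at : ∀ x → μ ⌊ pos x /2⌋ ≡ ⌊ pos (partner x) /2⌋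
    μ-at x with dbl-half (pos x)
    ... | inj₁ e = trans (cong (⌊_/2⌋ ∘ τ) (sym e)) (trans (cong (⌊_/2⌋ ∘ pos)
        (trans (cong partner (trans (sym (β-lab (pos x))) (cong β (lab-pos x)))) (comm x)))
      (trans (cong ⌊_/2⌋ (pos-β (partner x))) (half-partner _)))
    ... | inj₂ e = cong (⌊_/2⌋ ∘ pos ∘ partner) (trans (cong lab (trans (partner-dbl _) (sym e))) (lab-pos x))

    half-lab : ∀ {p i} → ⌊ p /2⌋ ≡ i → ⌊ pos (lab p) /2⌋ ≡ i
    half-lab e = trans (cong ⌊_/2⌋ (pos-lab _)) e

    μ-of : ∀ {p i} → ⌊ p /2⌋ ≡ i → ⌊ pos (partner (lab p)) /2⌋ ≡ μ i
    μ-of {p} e = trans (sym (μ-at (lab p))) (cong μ (half-lab e))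

    μ-involutive : ∀ {i} → μ (μ i) ≡ i
    μ-involutive {i} = trans (cong μ (sym (μ-of (half-dbl i))))
      (trans (μ-at _) (trans (cong (⌊_/2⌋ ∘ pos) (partner-involutive _)) (half-lab (half-dbl i))))

    edgeList : List ℕ
    edgeList = upTo (suc n)

    μ-closed : ∀ {i} → i ∈ edgeList → μ i ∈ edgeList
    μ-closed h = ∈-upTo⁺ (half-< (τ-< (dbl-<N (≤-pred (∈-upTo⁻ h)))))

    private
      half-iter : ∀ {j q} → dbl j ≡ q ⊎ dbl j ≡ partner q → j ≡ ⌊ q /2⌋
      half-iter {j} (inj₁ e) = trans (sym (half-dbl j)) (cong ⌊_/2⌋ e)
      half-iter {j} (inj₂ e) = trans (sym (half-dbl j)) (trans (cong ⌊_/2⌋ e) (half-partner _))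

    inCycle⇒μ : ∀ {i j} → i ≤ n → T (inCycle π (dbl i) (dbl j)) → j ≡ i ⊎ j ≡ μ i
    inCycle⇒μ {i} {j} h t with inCycle-elim (dbl-<N h) t
    ... | k , e with iter-cases k (dbl i)
    ... | inj₁ r = inj₁ (trans (half-iter e) (trans (cong ⌊_/2⌋ r) (half-dbl i)))
    ... | inj₂ r = inj₂ (trans (half-iter e) (cong ⌊_/2⌋ r))

    inCycle-self : ∀ {i} → i ≤ n → T (inCycle π (dbl i) (dbl i))
    inCycle-self {i} h = subst (λ z → T (inCycle π (dbl i) (dbl z))) (half-dbl i) (edge-in 0 (dbl-<N h) (s≤s z≤n))

    inCycle-μ : ∀ {i} → i ≤ n → T (inCycle π (dbl i) (dbl (μ i)))
    inCycle-μ h = edge-in 1 (dbl-<N h) (s≤s (s≤s z≤n))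

    private
      T-not : ∀ {b} → T (not b) → T b → ⊥
      T-not {true}  () _
      T-not {false} _ ()
      not-T : ∀ {b} → ¬ T b → T (not b)
      not-T {true}  n = n _
      not-T {false} _ = _
      to2 : ∀ i j → T (inCycle π (dbl i) (dbl j)) → T (inCycle π (2 * i) (2 * j))
      to2 i j = subst T (sym (cong₂ (inCycle π) (2*≡dbl i) (2*≡dbl j)))
      from2 : ∀ i j → T (inCycle π (2 * i) (2 * j)) → T (inCycle π (dbl i) (dbl j))
      from2 i j = subst T (cong₂ (inCycle π) (2*≡dbl i) (2*≡dbl j))

    cyc-count : cyc π ≡ countB (λ i → not (μ i <ᵇ i)) edgeList
    cyc-count = countB-cong edgeList λ {i} h → bool-≡ (to i (≤-pred (∈-upTo⁻ h))) (from i (≤-pred (∈-upTo⁻ h)))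
      where
      least : ℕ → ℕ → Bool
      least i j = not (inCycle π (2 * i) (2 * j))
      to : ∀ i → i ≤ n → T (all (least i) (upTo i)) → T (not (μ i <ᵇ i))
      to i h t = not-T λ l → T-not {inCycle π (2 * i) (2 * μ i)}
        (All.lookup (All.all⁺ (least i) (upTo i) t) (∈-upTo⁺ (<ᵇ⇒< (μ i) i l))) (to2 i (μ i) (inCycle-μ h))
      from : ∀ i → i ≤ n → T (not (μ i <ᵇ i)) → T (all (least i) (upTo i))
      from i h t = All.all⁻ (least i) (All.tabulate λ {j} k → not-T (λ r → apart (∈-upTo⁻ k) (inCycle⇒μ h (from2 i j r))))
        where
        apart : ∀ {j} → j < i → ¬ (j ≡ i ⊎ j ≡ μ i)
        apart l (inj₁ refl) = <-irrefl refl l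
        apart l (inj₂ refl) = T-not t (<⇒<ᵇ l)

    cyc₁-count : cyc₁ π ≡ countB (λ i → i ≡ᵇ μ i) edgeList
    cyc₁-count = countB-cong edgeList λ {i} h → bool-≡ (to i (≤-pred (∈-upTo⁻ h))) (from i (≤-pred (∈-upTo⁻ h)))
      where
      f : ℕ → ℕ → Bool
      f i j = inCycle π (dbl i) (dbl j)
      to : ∀ i → i ≤ n → T (cycLen π i ≡ᵇ 1) → T (i ≡ᵇ μ i)
      to i h t with i ≟ μ i
      ... | yes e = ≡⇒≡ᵇ i (μ i) e
      ... | no m  = ⊥-elim (<⇒≱ (countB-≥ {f i} {edgeList} {i ∷ μ i ∷ []} ((m ∷ []) ∷ [] ∷ [])
          λ { (here refl) → ∈-upTo⁺ (s≤s h) , inCycle-self h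
            ; (there (here refl)) → μ-closed (∈-upTo⁺ (s≤s h)) , inCycle-μ h })
        (≤-reflexive (trans (sym (cycLen-dbl i)) (≡ᵇ⇒≡ (cycLen π i) 1 t))))
      from : ∀ i → i ≤ n → T (i ≡ᵇ μ i) → T (cycLen π i ≡ᵇ 1)
      from i h t = ≡⇒≡ᵇ (cycLen π i) 1 (trans (cycLen-dbl i) (≤-antisym
          (countB-≤ {f i} {edgeList} {[ i ]} (Unique.upTo⁺ (suc n)) (λ _ r → only (inCycle⇒μ h r)))
          (countB-≥ {f i} {edgeList} {[ i ]} ([] ∷ []) λ { (here refl) → ∈-upTo⁺ (s≤s h) , inCycle-self h })))
        where
        only : ∀ {j} → j ≡ i ⊎ j ≡ μ i → j ∈ [ i ]
        only (inj₁ e) = here e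
        only (inj₂ e) = here (trans e (sym (≡ᵇ⇒≡ i (μ i) t)))

    isLeast : ℕ → Bool
    isLeast i = i <ᵇ μ i

    twoCycles : ℕ
    twoCycles = countB isLeast edgeList

    -- With m 2-cycles there are n + 1 = 2m + c₁ black edges and c = m + c₁ cycles.
    cycle-formula : n + 1 + cyc π ≡ 3 * twoCycles + 2 * cyc₁ π
    cycle-formula = trans (cong₂ _+_ (trans (+-comm n 1) (sym (length-upTo (suc n)))) cyc-count)
      (trans (involution-count μ edgeList (Unique.upTo⁺ (suc n)) μ-involutive μ-closed)
        (cong (λ z → 3 * twoCycles + 2 * z) (sym cyc₁-count)))

    nontrivial-bound : ∀ {x} → Nontrivial β x → ⌊ pos x /2⌋ ≤ n
    nontrivial-bound {x} nt with ⌊ pos x /2⌋ ≤? n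
    ... | yes h = h
    ... | no m  = ⊥-elim (nt (trivial-beyond m))

    nontrivial-grey : ∀ {x} → Nontrivial β x → Nontrivial β (partner x)
    nontrivial-grey nt e = nt (subst (λ z → β z ≡ partner z) (partner-involutive _) (trivial-partner {β} β-involutive e))

    least-edge : ∀ {x} → Nontrivial β x → ∃ λ i → i ≤ n × i < μ i × (⌊ pos x /2⌋ ≡ i ⊎ ⌊ pos (partner x) /2⌋ ≡ i)
    least-edge {x} nt with <-cmp ⌊ pos x /2⌋ ⌊ pos (partner x) /2⌋
    ... | tri< h _ _ = _ , nontrivial-bound nt , subst (⌊ pos x /2⌋ <_) (sym (μ-at x)) h , inj₁ refl
    ... | tri≈ _ e _ = ⊥-elim (halves≢ nt e)
    ... | tri> _ _ h = _ , nontrivial-bound (nontrivial-grey nt)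
        , subst (⌊ pos (partner x) /2⌋ <_) (sym (trans (μ-at (partner x)) (cong (⌊_/2⌋ ∘ pos) (partner-involutive x)))) h , inj₂ refl

    initial-meas : Meas β twoCycles
    initial-meas = map (λ i → lab (suc (dbl i))) (trues isLeast edgeList)
      , ≤-reflexive (trans (length-map _ (trues isLeast edgeList)) (sym (countB-length isLeast edgeList)))
      , cover
      where
      cover : ∀ y → Nontrivial β y → _
      cover y nt with least-edge nt
      ... | i , h , l , e = lab (suc (dbl i)) , ∈-map⁺ _ (∈-trues⁺ {isLeast} {edgeList} (∈-upTo⁺ (s≤s h)) (<⇒<ᵇ l)) , on-cycle e
        where
        on : ∀ {z} → ⌊ pos z /2⌋ ≡ i → z ≡ lab (suc (dbl i)) ⊎ z ≡ β (lab (suc (dbl i)))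
        on {z} refl with dbl-half (pos z)
        ... | inj₁ q = inj₂ (trans (sym (lab-of q)) (sym (β-sdbl i)))
        ... | inj₂ q = inj₁ (sym (lab-of q))
        on-cycle : ⌊ pos y /2⌋ ≡ i ⊎ ⌊ pos (partner y) /2⌋ ≡ i → Cyc β (lab (suc (dbl i))) y
        on-cycle (inj₁ e) with on e
        ... | inj₁ q = subst (Cyc β _) (sym q) same
        ... | inj₂ q = subst (Cyc β _) (sym q) via-black
        on-cycle (inj₂ e) with on e
        ... | inj₁ q = subst (Cyc β _) (trans (cong partner (sym q)) (partner-involutive y)) via-grey
        ... | inj₂ q = subst (Cyc β _) (trans (cong partner (sym q)) (partner-involutive y)) via-both

    cycleAt : ℕ → List ℕ
    cycleAt i = lab (suc (dbl i)) ∷ partner (lab (dbl i)) ∷ []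

    cycleAt-closed : ∀ i → Closed β (cycleAt i)
    cycleAt-closed i = (b , step (subst (λ z → Run β z [ partner (lab (dbl i)) ] b) c≡ (step (subst (λ z → Run β z [] b) b≡ done)))) , s≤s (s≤s z≤n)
      where
      b = lab (suc (dbl i))
      c≡ : partner (lab (dbl i)) ≡ β (partner (lab (suc (dbl i))))
      c≡ = trans (cong partner (sym (β-sdbl i))) (comm _)
      b≡ : lab (suc (dbl i)) ≡ β (partner (partner (lab (dbl i))))
      b≡ = trans (sym (β-dbl i)) (cong β (sym (partner-involutive _)))

    κ-shared : ∀ {p q i j} → ⌊ p /2⌋ ≡ i → ⌊ q /2⌋ ≡ j → κ (lab p) ≡ κ (lab q) → p ≡ q ⊎ i ≡ μ j
    κ-shared {p} {q} e f k with half-≡ (lab p) (lab q) k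
    ... | inj₁ r = inj₁ (lab-injective r)
    ... | inj₂ r = inj₂ (trans (sym (half-lab e)) (trans (cong (⌊_/2⌋ ∘ pos) r) (μ-of f)))

    κ-cycles : ∀ {k} is → k ∈ map κ (concat (map cycleAt is)) → ∃ λ i → ∃ λ p → i ∈ is × ⌊ p /2⌋ ≡ i × k ≡ κ (lab p)
    κ-cycles (i ∷ is) (here e)         = i , _ , here refl , half-sdbl i , e
    κ-cycles (i ∷ is) (there (here e)) = i , _ , here refl , half-dbl i , trans e (half-partner _)
    κ-cycles (i ∷ is) (there (there h)) with κ-cycles is h
    ... | j , p , m , r = j , p , there m , r

    -- The black edges of a 2-cycle are exchanged by `μ`, so two different ones that are both least
    -- lie on different cycles and share no grey edge.
    apart : ∀ {p q i j} → ⌊ p /2⌋ ≡ i → ⌊ q /2⌋ ≡ j → i ≢ j → i < μ i → j < μ j → κ (lab p) ≢ κ (lab q)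
    apart {p} {j = j} e f n l m k with κ-shared e f k
    ... | inj₁ refl = n (trans (sym e) f)
    ... | inj₂ refl = <-asym m (subst (μ j <_) (μ-involutive {j}) l)

    own-apart : ∀ {i} → i < μ i → κ (lab (suc (dbl i))) ≢ κ (lab (dbl i))
    own-apart {i} l k with κ-shared (half-sdbl i) (half-dbl i) k
    ... | inj₁ e = dbl≢sdbl {i} {i} (sym e)
    ... | inj₂ e = <⇒≢ l e

    fresh : ∀ {p i is} → ⌊ p /2⌋ ≡ i → i < μ i → i ∉ is → All (λ j → j < μ j) is →
      κ (lab p) ∉ map κ (concat (map cycleAt is))
    fresh {is = is} e l n a h with κ-cycles is h
    ... | j , q , m , f , k = apart e f (λ { refl → n m }) l (All.lookup a m) k

    cycles-unique : ∀ {is} → Unique is → All (λ i → i < μ i) is → Unique (map κ (concat (map cycleAt is)))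
    cycles-unique {[]}     _       _       = []
    cycles-unique {i ∷ is} (n ∷ u) (l ∷ a) =
      (κ≢ ∷ All.tabulate (λ h e → fresh (half-sdbl i) l i∉ a (subst (_∈ _) (sym e) h)))
      ∷ All.tabulate (λ h e → fresh (half-dbl i) l i∉ a (subst (_∈ _) (trans (sym e) (half-partner _)) h))
      ∷ cycles-unique u a
      where
      i∉ : i ∉ is
      i∉ h = All.lookup n h refl
      κ≢ : κ (lab (suc (dbl i))) ≢ κ (partner (lab (dbl i)))
      κ≢ e = own-apart l (trans e (half-partner _))

    -- Black edge 0 is left out, since `Decomp` keeps the leftmost cycle apart.
    later : List ℕ
    later = trues isLeast (applyUpTo suc n)

    later-least : All (λ i → i < μ i) later
    later-least = All.tabulate λ {i} h → <ᵇ⇒< i (μ i) (proj₂ (∈-trues⁻ {isLeast} {applyUpTo suc n} h))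

    later-unique : Unique later
    later-unique with Unique.upTo⁺ (suc n)
    ... | _ ∷ u = Unique.filter⁺ (dec-T ∘ isLeast) u

    0∉later : 0 ∉ later
    0∉later h with ∈-applyUpTo⁻ suc (proj₁ (∈-trues⁻ {isLeast} {applyUpTo suc n} h))
    ... | _ , _ , ()

    others : List (List ℕ)
    others = map cycleAt later

    others-closed : All (Closed β) others
    others-closed = All.map⁺ (All.tabulate (λ {i} _ → cycleAt-closed i))

    weights-others : weights others ≡ 3 * length later
    weights-others = go later
      where
      go : ∀ is → weights (map cycleAt is) ≡ 3 * length is
      go []       = refl
      go (i ∷ is) = trans (cong (_+_ 3) (go is)) (sym (*-suc 3 (length is)))

    β0 : β 0 ≡ lab 1
    β0 = cong (lab ∘ partner) pos-0

    μ0 : μ 0 ≡ ⌊ pos 1 /2⌋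
    μ0 = trans (cong μ (cong ⌊_/2⌋ (sym pos-0))) (μ-at 0)

    covered : ∀ {L} → (∀ {i p} → i ∈ later → ⌊ p /2⌋ ≡ i → κ (lab p) ∈ L) →
      (0 < μ 0 → ∀ {p} → ⌊ p /2⌋ ≡ 0 → κ (lab p) ∈ L) → ∀ x → κ x ∉ L → β x ≡ partner x
    covered {L} h₁ h₀ x n with β x ≟ partner x
    ... | yes e = e
    ... | no nt with least-edge nt
    ... | i , i≤ , l , e = ⊥-elim (n (go i i≤ l e))
      where
      at-i : ∀ i → i ≤ Walks.n P → i < μ i → ∀ {p} → ⌊ p /2⌋ ≡ i → κ (lab p) ∈ L
      at-i zero    _ l f = h₀ l f
      at-i (suc i) h l f = h₁ (∈-trues⁺ {isLeast} {applyUpTo suc (Walks.n P)} (∈-applyUpTo⁺ suc h) (<⇒<ᵇ l)) f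
      go : ∀ i → i ≤ Walks.n P → i < μ i → ⌊ pos x /2⌋ ≡ i ⊎ ⌊ pos (partner x) /2⌋ ≡ i → κ x ∈ L
      go i h l (inj₁ f) = subst (λ z → κ z ∈ L) (lab-pos x) (at-i i h l f)
      go i h l (inj₂ f) = subst (_∈ L) (trans (cong κ (lab-pos (partner x))) (half-partner x)) (at-i i h l f)

    in-others : ∀ {i p} → i ∈ later → ⌊ p /2⌋ ≡ i → κ (lab p) ∈ map κ (concat others)
    in-others {i} {p} h refl with dbl-half p
    ... | inj₁ e = subst (_∈ map κ (concat others)) (trans (half-partner _) (cong (κ ∘ lab) (sym e)))
      (∈-map⁺ κ (∈-concat⁺′ (there (here refl)) (∈-map⁺ cycleAt h)))
    ... | inj₂ e = subst (_∈ map κ (concat others)) (cong (κ ∘ lab) (sym e)) (∈-map⁺ κ (∈-concat⁺′ (here refl) (∈-map⁺ cycleAt h)))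

    decomp-fixed : β 0 ≡ 1 → Decomp β [] others
    decomp-fixed b = record
      { lead = subst (λ z → Run β z [] 1) (sym b) done
      ; closed = others-closed
      ; unique = All.tabulate (λ h e → no-zero (subst (_∈ _) (sym e) h)) ∷ cycles-unique later-unique later-least
      ; cover = covered (λ h e → there (in-others h e)) (λ l → ⊥-elim (<⇒≢ l (sym μ0≡0)))
      }
      where
      μ0≡0 : μ 0 ≡ 0
      μ0≡0 = trans (cong (⌊_/2⌋ ∘ pos ∘ partner) (trans (sym β0) b)) (cong ⌊_/2⌋ pos-0)
      no-zero : 0 ∉ map κ (concat others)
      no-zero h with κ-cycles later h
      ... | j , p , m , f , k with κ-shared {p} {0} f refl (trans (sym k) (cong κ (sym lab-0)))
      ... | inj₁ refl = 0∉later (subst (_∈ later) (sym f) m)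
      ... | inj₂ e = 0∉later (subst (_∈ later) (trans e μ0≡0) m)

    module _ (b : β 0 ≢ 1) where
      0<μ0 : 0 < μ 0
      0<μ0 = n≢0⇒n>0 λ e → halves≢ {0} b (trans (cong ⌊_/2⌋ pos-0) (trans (sym e) μ0))

      decomp-moved : Decomp β [ lab 1 ] others
      decomp-moved = record
        { lead = subst (λ z → Run β z [ lab 1 ] 1) (sym β0) (step (subst (λ z → Run β z [] 1) 1≡ done))
        ; closed = others-closed
        ; unique = (first-apart ∷ All.tabulate (λ h e → fresh {0} refl 0<μ0 0∉later later-least
              (subst (_∈ _) (trans (sym e) (cong κ (sym lab-0))) h)))
            ∷ All.tabulate (λ h e → fresh {1} refl 0<μ0 0∉later later-least (subst (_∈ _) (sym e) h))
            ∷ cycles-unique later-unique later-least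
        ; cover = covered (λ h e → there (there (in-others h e))) (λ _ → near)
        }
        where
        1≡ : 1 ≡ β (partner (lab 1))
        1≡ = sym (trans (cong (β ∘ partner) (sym β0)) (trans (cong β (comm 0)) (β-involutive 1)))
        first-apart : 0 ≢ κ (lab 1)
        first-apart e = own-apart 0<μ0 (trans (sym e) (cong κ (sym lab-0)))
        near : ∀ {p} → ⌊ p /2⌋ ≡ 0 → κ (lab p) ∈ map κ (support [ lab 1 ] others)
        near {zero}          _ = here (cong κ lab-0)
        near {suc zero}      _ = there (here refl)

      twoCycles-moved : twoCycles ≡ suc (length later)
      twoCycles-moved with isLeast 0 in e
      ... | true  = cong suc (countB-length isLeast (applyUpTo suc n))
      ... | false = ⊥-elim (subst T e (<⇒<ᵇ 0<μ0))

    twoCycles-fixed : β 0 ≡ 1 → twoCycles ≡ length later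
    twoCycles-fixed b with isLeast 0 in e
    ... | true  = ⊥-elim (<⇒≢ (<ᵇ⇒< 0 (μ 0) (T-true e)) (sym (trans (cong (⌊_/2⌋ ∘ pos ∘ partner) (trans (sym β0) b)) (cong ⌊_/2⌋ pos-0))))
    ... | false = countB-length isLeast (applyUpTo suc n)

open InitialCycles

-- Interleaving and components, and coherence of a nonoriented leftmost component.

module Components where
  open import Data.Nat
  open import Data.Nat.Properties

  between⇒ : ∀ {p q x} → Between p q x → p ⊓ q < x × x < p ⊔ q
  between⇒ {p} {q} (inj₁ (a , b)) = ≤-<-trans (m⊓n≤m p q) a , <-≤-trans b (m≤n⊔m p q)
  between⇒ {p} {q} (inj₂ (a , b)) = ≤-<-trans (m⊓n≤n p q) a , <-≤-trans b (m≤m⊔n p q)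

  between⇐ : ∀ {p q x} → p ⊓ q < x → x < p ⊔ q → Between p q x
  between⇐ {p} {q} a b with ⊓-sel p q | ⊔-sel p q
  ... | inj₁ e | inj₂ f = inj₁ (subst (_< _) e a , subst (_ <_) f b)
  ... | inj₂ e | inj₁ f = inj₂ (subst (_< _) e a , subst (_ <_) f b)
  ... | inj₁ e | inj₁ f = ⊥-elim (<-asym (subst (_< _) e a) (subst (_ <_) f b))
  ... | inj₂ e | inj₂ f = ⊥-elim (<-asym (subst (_< _) e a) (subst (_ <_) f b))

  private
    odd-%⇒ : ∀ m → m % 2 ≡ 1 → odd m ≡ true
    odd-%⇒ (suc zero)    _ = refl
    odd-%⇒ (suc (suc m)) e = trans (not-involutive _) (odd-%⇒ m e)

    odd-%⇐ : ∀ m → odd m ≡ true → m % 2 ≡ 1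
    odd-%⇐ (suc zero)    _ = refl
    odd-%⇐ (suc (suc m)) e = odd-%⇐ m (trans (sym (not-involutive _)) e)

    odd-+-even : ∀ a t → odd t ≡ false → odd (a + t) ≡ odd a
    odd-+-even zero    t e = e
    odd-+-even (suc a) t e = cong not (odd-+-even a t e)

    odd-+-odd : ∀ a t → odd t ≡ true → odd (a + t) ≡ not (odd a)
    odd-+-odd zero    t e = e
    odd-+-odd (suc a) t e = cong not (odd-+-odd a t e)

  odd-gap⇒ : ∀ {a b} → a ≤ b → (b ∸ a + 1) % 2 ≡ 1 → odd b ≡ odd a
  odd-gap⇒ {a} {b} h e = trans (cong odd (sym (m+[n∸m]≡n h))) (odd-+-even a (b ∸ a) (even (b ∸ a) e))
    where
    even : ∀ t → (t + 1) % 2 ≡ 1 → odd t ≡ false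
    even t e with odd t | odd-%⇒ (t + 1) e | odd-+-odd t 1 refl
    ... | false | _ | _ = refl
    ... | true  | p | q with trans (sym p) q
    ... | ()

  odd-gap⇐ : ∀ {a b} → a ≤ b → odd b ≡ odd a → (b ∸ a + 1) % 2 ≡ 1
  odd-gap⇐ {a} {b} h e = odd-%⇐ (t + 1) (trans (odd-+-odd t 1 refl) (cong not even))
    where
    t = b ∸ a
    even : odd t ≡ false
    even with odd t in f
    ... | false = refl
    ... | true with odd a | trans (sym e) (trans (cong odd (sym (m+[n∸m]≡n h))) (odd-+-odd a t f))
    ... | true  | ()
    ... | false | ()

  odd-range : ∀ {p q} → (((p ⊔ q) ∸ (p ⊓ q)) + 1) % 2 ≡ 1 → odd p ≡ odd q
  odd-range {p} {q} e with ≤-total p q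
  ... | inj₁ h rewrite m≤n⇒m⊓n≡m h | m≤n⇒m⊔n≡n h = sym (odd-gap⇒ h e)
  ... | inj₂ h rewrite m≥n⇒m⊓n≡n h | m≥n⇒m⊔n≡m h = odd-gap⇒ h e

  odd-range⁻ : ∀ {p q} → odd p ≡ odd q → (((p ⊔ q) ∸ (p ⊓ q)) + 1) % 2 ≡ 1
  odd-range⁻ {p} {q} e with ≤-total p q
  ... | inj₁ h rewrite m≤n⇒m⊓n≡m h | m≤n⇒m⊔n≡n h = odd-gap⇐ h (sym e)
  ... | inj₂ h rewrite m≥n⇒m⊓n≡n h | m≥n⇒m⊔n≡m h = odd-gap⇐ h e

  module Links {π} (P : Perm π) (s : Simp (Cfg.β (cfg P))) where
    open Initial P s public

    posL posR : ℕ → ℕ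
    posL k = pos (dbl k)
    posR k = pos (suc (dbl k))

    Bet : ℕ → ℕ → Set
    Bet k p = Between (posL k) (posR k) p

    position-L : ∀ {k} → k ≤ n → position π (2 * k) ≡ posL k
    position-L {k} h = trans (cong (position π) (2*≡dbl k)) (position≡pos (dbl-<N h))

    position-R : ∀ {k} → k ≤ n → position π (2 * k + 1) ≡ posR k
    position-R {k} h = trans (cong (position π) (last-label k)) (position≡pos (dbl-mono-< (s≤s h)))

    gLo-≡ : ∀ {k} → k ≤ n → gLo π k ≡ posL k ⊓ posR k
    gLo-≡ h = cong₂ _⊓_ (position-L h) (position-R h)

    gHi-≡ : ∀ {k} → k ≤ n → gHi π k ≡ posL k ⊔ posR k
    gHi-≡ h = cong₂ _⊔_ (position-L h) (position-R h)

    ends-of : ∀ {x k} → κ x ≡ k → (x ≡ dbl k × partner x ≡ suc (dbl k)) ⊎ (x ≡ suc (dbl k) × partner x ≡ dbl k)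
    ends-of {x} refl with dbl-half x
    ... | inj₁ e = inj₁ (e , trans (cong partner e) (partner-dbl _))
    ... | inj₂ e = inj₂ (e , trans (cong partner e) (partner-sdbl _))

    not-end : ∀ {x k} → κ x ≢ k → pos x ≢ posL k × pos x ≢ posR k
    not-end n = (λ e → n (trans (cong κ (pos-injective e)) (half-dbl _))) , (λ e → n (trans (cong κ (pos-injective e)) (half-sdbl _)))

    end≢Bet : ∀ {x k} → κ x ≡ k → ¬ Bet k (pos x)
    end≢Bet e b with ends-of e | b
    ... | inj₁ (refl , _) | inj₁ (l , _) = <-irrefl refl l
    ... | inj₁ (refl , _) | inj₂ (_ , l) = <-irrefl refl l
    ... | inj₂ (refl , _) | inj₁ (_ , l) = <-irrefl refl l
    ... | inj₂ (refl , _) | inj₂ (l , _) = <-irrefl refl l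

    ≢⊓⊔ : ∀ {x k} → κ x ≢ k → pos x ≢ posL k ⊓ posR k × pos x ≢ posL k ⊔ posR k
    ≢⊓⊔ {x} {k} n = min , max
      where
      min : pos x ≢ posL k ⊓ posR k
      min e with ⊓-sel (posL k) (posR k)
      ... | inj₁ f = proj₁ (not-end n) (trans e f)
      ... | inj₂ f = proj₂ (not-end n) (trans e f)
      max : pos x ≢ posL k ⊔ posR k
      max e with ⊔-sel (posL k) (posR k)
      ... | inj₁ f = proj₁ (not-end n) (trans e f)
      ... | inj₂ f = proj₂ (not-end n) (trans e f)

    range-of : ∀ {y l} → κ y ≡ l → pos y ⊓ pos (partner y) ≡ posL l ⊓ posR l × pos y ⊔ pos (partner y) ≡ posL l ⊔ posR l
    range-of {l = l} e with ends-of e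
    ... | inj₁ (p , q) = cong₂ (λ a b → pos a ⊓ pos b) p q , cong₂ (λ a b → pos a ⊔ pos b) p q
    ... | inj₂ (p , q) = trans (cong₂ (λ a b → pos a ⊓ pos b) p q) (⊓-comm (posR l) (posL l)) , trans (cong₂ (λ a b → pos a ⊔ pos b) p q) (⊔-comm (posR l) (posL l))

    κ-partner : ∀ {y l} → κ y ≡ l → κ (partner y) ≡ l
    κ-partner e = trans (half-partner _) e

    -- Supports of different grey edges have no common end, so they interleave exactly when one end
    -- y of the second lies inside the first and the other does not.
    interleave⇒ : ∀ {k l} → k ≤ n → l ≤ n → Interleave π k l →
      ∃ λ y → κ y ≡ l × Bet k (pos y) × ¬ Bet k (pos (partner y))
    interleave⇒ {k} {l} k≤ l≤ (k≢l , (ov₁ , ov₂) , nc₁ , nc₂)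
      rewrite gLo-≡ k≤ | gLo-≡ l≤ | gHi-≡ k≤ | gHi-≡ l≤ = go sorted
      where
      a = posL k ⊓ posR k
      b = posL k ⊔ posR k
      c = posL l ⊓ posR l
      d = posL l ⊔ posR l
      sorted : ∃ λ y → κ y ≡ l × pos y ≡ c × pos (partner y) ≡ d
      sorted with ≤-total (posL l) (posR l)
      ... | inj₁ h = dbl l , half-dbl l , sym (m≤n⇒m⊓n≡m h) , trans (cong pos (partner-dbl l)) (sym (m≤n⇒m⊔n≡n h))
      ... | inj₂ h = suc (dbl l) , half-sdbl l , sym (m≥n⇒m⊓n≡n h) , trans (cong pos (partner-sdbl l)) (sym (m≥n⇒m⊔n≡m h))
      go : _ → _
      go (y , κy , ec , ed) = cases (<-cmp a (pos y))
        where
        n₁ = ≢⊓⊔ {y} {k} (λ e → k≢l (trans (sym e) κy))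
        n₂ = ≢⊓⊔ {partner y} {k} (λ e → k≢l (trans (sym e) (κ-partner κy)))
        cases : _ → _
        cases (tri< h _ _) = y , κy
          , between⇐ h (≤∧≢⇒< (subst (_≤ b) (sym ec) ov₂) (proj₂ n₁))
          , λ q → nc₁ (subst (a ≤_) ec (<⇒≤ h) , subst (_≤ b) ed (<⇒≤ (proj₂ (between⇒ {posL k} q))))
        cases (tri≈ _ e _) = ⊥-elim (proj₁ n₁ (sym e))
        cases (tri> _ _ h) = partner y , κ-partner κy
          , between⇐ (≤∧≢⇒< (subst (a ≤_) (sym ed) ov₁) (proj₁ n₂ ∘ sym))
              (≰⇒> (λ q → nc₂ (subst (_≤ a) ec (<⇒≤ h) , subst (b ≤_) ed q)))
          , λ q → <-asym h (subst (λ z → a < pos z) (partner-involutive y) (proj₁ (between⇒ {posL k} q)))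

    interleave⇐ : ∀ {k} y → k ≤ n → κ y ≤ n → Bet k (pos y) → ¬ Bet k (pos (partner y)) → Interleave π k (κ y)
    interleave⇐ {k} y k≤ l≤ q m = k≢l , overlaps , nc₁ , nc₂
      where
      l = κ y
      a = posL k ⊓ posR k
      b = posL k ⊔ posR k
      c′ = pos y
      d′ = pos (partner y)
      a<c = proj₁ (between⇒ {posL k} q)
      c<b = proj₂ (between⇒ {posL k} q)
      k≢l : k ≢ l
      k≢l e = end≢Bet {y} (sym e) q
      lo-l : gLo π l ≡ c′ ⊓ d′
      lo-l = trans (gLo-≡ l≤) (sym (proj₁ (range-of {y} refl)))
      hi-l : gHi π l ≡ c′ ⊔ d′
      hi-l = trans (gHi-≡ l≤) (sym (proj₂ (range-of {y} refl)))
      overlaps : Overlap π k l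
      overlaps = subst₂ _≤_ (sym (gLo-≡ k≤)) (sym hi-l) (≤-trans (<⇒≤ a<c) (m≤m⊔n c′ d′))
              , subst₂ _≤_ (sym lo-l) (sym (gHi-≡ k≤)) (≤-trans (m⊓n≤m c′ d′) (<⇒≤ c<b))
      d≢ = ≢⊓⊔ {partner y} {k} (λ e → k≢l (trans (sym e) (half-partner y)))
      nc₁ : ¬ Contains π k l
      nc₁ (u , v) = m (between⇐
        (≤∧≢⇒< (≤-trans (subst₂ _≤_ (gLo-≡ k≤) lo-l u) (m⊓n≤n c′ d′)) (proj₁ d≢ ∘ sym))
        (≤∧≢⇒< (≤-trans (m≤n⊔m c′ d′) (subst₂ _≤_ hi-l (gHi-≡ k≤) v)) (proj₂ d≢)))
      nc₂ : ¬ Contains π l k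
      nc₂ (u , v) with ⊓-sel c′ d′ | ⊔-sel c′ d′ | subst₂ _≤_ lo-l (gLo-≡ k≤) u | subst₂ _≤_ (gHi-≡ k≤) hi-l v
      ... | inj₁ e | _ | u′ | _ = <⇒≱ a<c (subst (_≤ a) e u′)
      ... | inj₂ _ | inj₁ f | _ | v′ = <⇒≱ c<b (subst (b ≤_) f v′)
      ... | inj₂ e | inj₂ f | u′ | v′ = <⇒≱ (<-trans a<c c<b) (≤-trans (subst (b ≤_) f v′) (subst (_≤ a) e u′))

    interleave-sym : ∀ {k l} → Interleave π k l → Interleave π l k
    interleave-sym (a , (b , c) , d , e) = a ∘ sym , (c , b) , e , d

    sameCycle⇒ : ∀ {k l} → k ≤ n → l ≤ n → SameCycleGrey π k l → Cyc β (dbl k) (dbl l)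
    sameCycle⇒ k≤ l≤ t rewrite position-L k≤ | position-L l≤ =
      subst₂ (Cyc β) (lab-pos _) (lab-pos _) (inCycle⇒Cyc (pos-< (dbl-<N k≤)) t)

    sameCycle⇐ : ∀ {k l} → k ≤ n → l ≤ n → Cyc β (dbl k) (dbl l) → SameCycleGrey π k l
    sameCycle⇐ k≤ l≤ c rewrite position-L k≤ | position-L l≤ =
      Cyc⇒inCycle (pos-< (dbl-<N k≤)) (subst (λ z → Cyc β z _) (sym (lab-pos _)) c)

    link⇒path : ∀ {k l} → Link π k l → Star (Lk (cfg P)) (dbl k) (dbl l)
    link⇒path {k} {l} (k≤ , l≤ , inj₁ t) = go (sameCycle⇒ k≤ l≤ t)
      where
      go : ∀ {y} → Cyc β (dbl k) y → Star (Lk (cfg P)) (dbl k) y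
      go same   = nil
      go via-black = along-black ◅ nil
      go via-grey  = along-grey ◅ nil
      go via-both   = along-black ◅ along-grey ◅ nil
    link⇒path {k} {l} (k≤ , l≤ , inj₂ i) with interleave⇒ k≤ l≤ i
    ... | y , κy , p , q = across (conv p) (q ∘ conv⁻) ◅ last (ends-of κy)
      where
      conv : ∀ {x} → Bet k x → Between (pos (dbl k)) (pos (partner (dbl k))) x
      conv {x} = subst (λ z → Between (pos (dbl k)) (pos z) x) (sym (partner-dbl k))
      conv⁻ : ∀ {x} → Between (pos (dbl k)) (pos (partner (dbl k))) x → Bet k x
      conv⁻ {x} = subst (λ z → Between (pos (dbl k)) (pos z) x) (partner-dbl k)
      last : (y ≡ dbl l × partner y ≡ suc (dbl l)) ⊎ (y ≡ suc (dbl l) × partner y ≡ dbl l) → Star (Lk (cfg P)) y (dbl l)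
      last (inj₁ (refl , _)) = nil
      last (inj₂ (_ , e))    = subst (Star (Lk (cfg P)) y) e (along-grey ◅ nil)

    component⇒path : ∀ {k l} → Star (Link π) k l → Star (Lk (cfg P)) (dbl k) (dbl l)
    component⇒path nil      = nil
    component⇒path (l ◅ ls) = link⇒path l ◅◅ component⇒path ls

    component-bound : ∀ {k l} → k ≤ n → Star (Link π) k l → l ≤ n
    component-bound h nil                = h
    component-bound h ((_ , l≤ , _) ◅ ls) = component-bound l≤ ls

    oriented⇒ : ∀ {k} → k ≤ n → OrientedGrey π k → Or (cfg P) (dbl k)
    oriented⇒ {k} h e rewrite gLo-≡ h | gHi-≡ h =
      trans (odd-range {posL k} {posR k} e) (cong (odd ∘ pos) (sym (partner-dbl k)))

    oriented⇐ : ∀ {k} → k ≤ n → odd (posL k) ≡ odd (posR k) → OrientedGrey π k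
    oriented⇐ {k} h e rewrite gLo-≡ h | gHi-≡ h = odd-range⁻ {posL k} {posR k} e

    module Nonoriented (S? : ∀ k → Dec (Star (Link π) 0 k)) (non : LeftmostNonoriented π) where
      S : ℕ → Set
      S = Star (Link π) 0

      S-bound : ∀ {k} → S k → k ≤ n
      S-bound = component-bound z≤n

      <N-of : ∀ {x} → Nontrivial β x → x < N
      <N-of {x} nt = subst (_< N) (lab-pos x) (lab-< (≤-<-trans (half-upper (pos x)) (dbl-mono-< (s≤s (nontrivial-bound nt)))))

      nontrivial-β : ∀ {x} → Nontrivial β x → Nontrivial β (β x)
      nontrivial-β {x} nt e = nt (sym (trans (cong partner (trans (sym (β-involutive x)) e)) (partner-involutive _)))

      S-black : ∀ {x} → Nontrivial β x → S (κ x) → S (κ (β x))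
      S-black {x} nt h = h ◅◅ ((κ≤ nt , κ≤ (nontrivial-β nt) , inj₁ (sameCycle⇐ (κ≤ nt) (κ≤ (nontrivial-β nt)) cyc-κ)) ◅ nil)
        where
        κ≤ : ∀ {y} → Nontrivial β y → κ y ≤ n
        κ≤ m = ≤-pred (half-< (<N-of m))
        cyc-κ : Cyc β (dbl (κ x)) (dbl (κ (β x)))
        cyc-κ with ends-of {x} refl | ends-of {β x} refl
        ... | inj₁ (e , _) | inj₁ (f , _) = subst₂ (Cyc β) e f via-black
        ... | inj₁ (e , _) | inj₂ (_ , f) = subst₂ (Cyc β) e f via-both
        ... | inj₂ (_ , e) | inj₁ (f , _) = subst₂ (Cyc β) e
          (trans (comm _) (trans (cong β (partner-involutive x)) f)) via-both
        ... | inj₂ (_ , e) | inj₂ (_ , f) = subst₂ (Cyc β) e (trans (sym (comm x)) f) via-black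

      -- The component starts at position 0, outside k₀, and cannot get in. An edge of it with one
      -- end inside would interleave with k₀, a black edge cannot jump over an end of k₀, and an
      -- edge inside cannot interleave with one outside.
      module Outside {k₀} (k₀≤ : k₀ ≤ n) (n₀ : ¬ S k₀) where
        Out : ℕ → Set
        Out m = ∀ y → κ y ≡ m → ¬ Bet k₀ (pos y)

        both-out : ∀ {m y} → S m → κ y ≡ m → ¬ Bet k₀ (pos y) → Out m
        both-out {m} {y} h e q y′ e′ b with half-≡ y′ y (trans e′ (sym e))
        ... | inj₁ refl = q b
        ... | inj₂ refl = n₀ (h ◅◅ ((S-bound h , k₀≤ , inj₂ (interleave-sym
          (subst (Interleave π k₀) e′ (interleave⇐ (partner y) k₀≤ (subst (_≤ n) (sym e′) (S-bound h)) b
            (q ∘ subst (Bet k₀ ∘ pos) (partner-involutive y)))))) ◅ nil))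

        -- p and `partner p` are neighbours, so an open interval is entered between them only if p
        -- is one of its ends.
        adjacent : ∀ {a b p} → ¬ (a < p × p < b) → p ≢ a → p ≢ b → a < partner p → partner p < b → ⊥
        adjacent {a} {b} {p} q na nb l m with a <? p
        ... | no h  = <⇒≱ l (≤-trans (partner-≤ p) (≤∧≢⇒< (≮⇒≥ h) na))
        ... | yes h with p <? b
        ... | yes k = q (h , k)
        ... | no k  = <⇒≱ (≤∧≢⇒< (≮⇒≥ k) (nb ∘ sym))
          (≤-trans (subst (_≤ suc (partner p)) (partner-involutive p) (partner-≤ (partner p))) m)

        black-out : ∀ {z} → S (κ z) → ¬ Bet k₀ (pos z) → ¬ Bet k₀ (pos (β z))
        black-out {z} h q b with not-end {z} {k₀} (λ e → n₀ (subst S e h)) | subst (Bet k₀) (pos-β z) b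
        ... | nl , nr | inj₁ (l , m) = adjacent (q ∘ inj₁) nl nr l m
        ... | nl , nr | inj₂ (l , m) = adjacent (q ∘ inj₂) nr nl l m

        nested : ∀ {a b c d u v} → Between a b c → Between a b d → ¬ Between a b u → ¬ Between a b v →
          Between u v c → Between u v d
        nested {a} {b} {c} {d} {u} {v} = λ { (inj₁ p) (inj₁ q) nu nv r → both p q (nu ∘ inj₁) (nv ∘ inj₁) r
          ; (inj₂ p) (inj₂ q) nu nv r → both p q (nu ∘ inj₂) (nv ∘ inj₂) r
          ; (inj₁ (p , p′)) (inj₂ (q , q′)) nu nv r → ⊥-elim (<-asym (<-trans p p′) (<-trans q q′))
          ; (inj₂ (p , p′)) (inj₁ (q , q′)) nu nv r → ⊥-elim (<-asym (<-trans p p′) (<-trans q q′)) }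
          where
          left : ∀ {lo hi w} → lo < d → c < hi → ¬ (lo < w × w < hi) → w < c → w < d
          left ld ch n l = ≤-<-trans (≮⇒≥ (λ k → n (k , <-trans l ch))) ld
          right : ∀ {lo hi w} → d < hi → lo < c → ¬ (lo < w × w < hi) → c < w → d < w
          right dh lc n l = <-≤-trans dh (≮⇒≥ (λ k → n (<-trans lc l , k)))
          both : ∀ {lo hi} → lo < c × c < hi → lo < d × d < hi → ¬ (lo < u × u < hi) → ¬ (lo < v × v < hi) →
            Between u v c → Between u v d
          both (p , p′) (q , q′) nu nv (inj₁ (l , r)) = inj₁ (left q p′ nu l , right q′ p nv r)
          both (p , p′) (q , q′) nu nv (inj₂ (l , r)) = inj₂ (left q p′ nv l , right q′ p nu r)

        link-out : ∀ {m m′} → S m → Out m → Link π m m′ → Out m′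
        link-out {m} {m′} h o l@(m≤ , m′≤ , inj₁ t) = go (sameCycle⇒ m≤ m′≤ t) refl
          where
          h′ = h ◅◅ (l ◅ nil)
          o-black : ¬ Bet k₀ (pos (β (dbl m)))
          o-black = black-out (subst S (sym (half-dbl m)) h) (o (dbl m) (half-dbl m))
          go : ∀ {y} → Cyc β (dbl m) y → y ≡ dbl m′ → Out m′
          go same   e = both-out h′ (trans (cong κ e) (half-dbl m′)) (o (dbl m) (half-dbl m))
          go via-black e = both-out h′ (trans (cong κ e) (half-dbl m′)) o-black
          go via-grey  e = both-out h′ (trans (cong κ e) (half-dbl m′)) (o _ (κ-partner (half-dbl m)))
          go via-both   e = both-out h′ (trans (sym (half-partner _)) (trans (cong κ e) (half-dbl m′))) o-black
        link-out {m} {m′} h o l@(m≤ , m′≤ , inj₂ i) with interleave⇒ m≤ m′≤ i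
        ... | y , κy , p , q = λ z κz b → q (nested (inside z κz b y κy) (inside z κz b (partner y) (κ-partner κy))
            (o (dbl m) (half-dbl m)) (o (suc (dbl m)) (half-sdbl m)) p)
          where
          bet? : ∀ x → Dec (Bet k₀ (pos x))
          bet? x with posL k₀ <? pos x ×-dec pos x <? posR k₀ | posR k₀ <? pos x ×-dec pos x <? posL k₀
          ... | yes a | _     = yes (inj₁ a)
          ... | no _  | yes b = yes (inj₂ b)
          ... | no a  | no b  = no λ { (inj₁ c) → a c ; (inj₂ c) → b c }
          inside : ∀ z → κ z ≡ m′ → Bet k₀ (pos z) → ∀ y → κ y ≡ m′ → Bet k₀ (pos y)
          inside z κz b y κy with bet? y
          ... | yes c = c
          ... | no c  = ⊥-elim (both-out (h ◅◅ (l ◅ nil)) κy c z κz b)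

        component-out : ∀ {m k} → S m → Out m → Star (Link π) m k → Out k
        component-out h o nil      = o
        component-out h o (l ◅ ls) = component-out (h ◅◅ (l ◅ nil)) (link-out h o l) ls

        out : ∀ {z} → S (κ z) → ¬ Bet k₀ (pos z)
        out {z} h = component-out nil (both-out {0} {0} nil refl base) h z refl
          where
          base : ¬ Bet k₀ (pos 0)
          base b with subst (Bet k₀) pos-0 b
          ... | inj₁ (() , _)
          ... | inj₂ (() , _)

      Mark : ℕ → Set
      Mark p = odd p ≡ true × S (κ (lab p))

      mark? : ∀ p → Dec (Mark p)
      mark? p = (odd p ≟ᵇ true) ×-dec S? (κ (lab p))

      -- A region is named by the last mark at or before the position, 0 if there is none. Marks are
      -- right ends of black edges, the places where a walk to the right passes a black edge of the
      -- component.
      gap : ℕ → ℕ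
      gap zero = zero
      gap (suc p) with mark? (suc p)
      ... | yes _ = suc p
      ... | no _  = gap p

      gap-mark : ∀ {p} → Mark p → gap p ≡ p
      gap-mark {zero}  (() , _)
      gap-mark {suc p} m with mark? (suc p)
      ... | yes _ = refl
      ... | no k  = ⊥-elim (k m)

      gap-step : ∀ {p} → ¬ Mark (suc p) → gap (suc p) ≡ gap p
      gap-step {p} k with mark? (suc p)
      ... | yes m = ⊥-elim (k m)
      ... | no _  = refl

      gap-skip : ∀ {a b} → a ≤ b → (∀ {p} → a < p → p ≤ b → ¬ Mark p) → gap a ≡ gap b
      gap-skip {a} {b} h k with m≤n⇒m<n∨m≡n h
      ... | inj₂ refl = refl
      gap-skip {a} {suc b} _ k | inj₁ (s≤s h) =
        trans (gap-skip h (λ l m → k l (≤-trans m (n≤1+n b)))) (sym (gap-step (k (s≤s h) ≤-refl)))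

      even-step : ∀ i → gap (dbl (suc i)) ≡ gap (suc (dbl i))
      even-step i = gap-step {suc (dbl i)} (λ m → even (trans (sym (proj₁ m)) (odd-dbl (suc i))))
        where
        even : true ≢ false
        even ()

      gap-ε : ∀ p → gap (ε p) ≡ gap p
      gap-ε zero = refl
      gap-ε (suc q) with dbl-half q
      ... | inj₁ e = subst (λ z → gap (suc (partner z)) ≡ gap (suc z)) (sym e)
        (trans (cong (gap ∘ suc) (partner-dbl ⌊ q /2⌋)) (even-step ⌊ q /2⌋))
      ... | inj₂ e = subst (λ z → gap (suc (partner z)) ≡ gap (suc z)) (sym e)
        (trans (cong (gap ∘ suc) (partner-sdbl ⌊ q /2⌋)) (sym (even-step ⌊ q /2⌋)))

      gap-partner : ∀ i → ¬ S (κ (lab (suc (dbl i)))) → gap (suc (dbl i)) ≡ gap (dbl i)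
      gap-partner i m = gap-step {dbl i} (m ∘ proj₂)

      pos-ε : ∀ x → pos (ε x) ≡ ε (pos x)
      pos-ε x = trans (cong (pos ∘ ε) (sym (lab-pos x))) (trans (cong pos (sym (lab-ε (pos x)))) (pos-lab _))

      -- By `Outside` no mark lies strictly between the ends of a grey edge off S, and its own ends
      -- carry none.
      gap-grey : ∀ x → ¬ S (κ x) → gap (pos (partner x)) ≡ gap (pos x)
      gap-grey x nS = gap-between (≤-total (pos (partner x)) (pos x))
        where
        blocked : ∀ x → ¬ S (κ x) → ∀ {p} → pos (partner x) < p → p ≤ pos x → ¬ Mark p
        blocked x nS {p} l h (_ , m) with κ x ≤? Walks.n P
        ... | yes k with m≤n⇒m<n∨m≡n h
        ... | inj₂ refl = nS (subst (S ∘ κ) (lab-pos x) m)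
        ... | inj₁ h′ = Outside.out k nS {lab p} m (subst (Bet (κ x)) (sym (pos-lab p)) (conv (ends-of {x} refl)))
          where
          conv : (x ≡ dbl (κ x) × partner x ≡ suc (dbl (κ x))) ⊎ (x ≡ suc (dbl (κ x)) × partner x ≡ dbl (κ x)) → Bet (κ x) p
          conv (inj₁ (e , f)) = inj₂ (subst (λ z → pos z < p) f l , subst (λ z → p < pos z) e h′)
          conv (inj₂ (e , f)) = inj₁ (subst (λ z → pos z < p) f l , subst (λ z → p < pos z) e h′)
        blocked x nS {p} l h (_ , m) | no k = k (≤-trans (κ-mono x≤p) (S-bound (subst (S ∘ κ) (lab-fixed P far-p) m)))
          where
          far-x : Walks.N P ≤ x
          far-x = ≤-trans (dbl-mono-≤ (≰⇒> k)) (half-lower x)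
          far-y : Walks.N P ≤ partner x
          far-y = partner-≥ (suc (Walks.n P)) far-x
          y<p : partner x < p
          y<p = subst (_< p) (pos-fixed P far-y) l
          far-p : Walks.N P ≤ p
          far-p = ≤-trans far-y (<⇒≤ y<p)
          x≤p : x ≤ p
          x≤p = ≤-trans (subst (_≤ suc (partner x)) (partner-involutive x) (partner-≤ (partner x))) y<p
          κ-mono : x ≤ p → κ x ≤ κ p
          κ-mono = ⌊n/2⌋-mono
        gap-between : pos (partner x) ≤ pos x ⊎ pos x ≤ pos (partner x) → gap (pos (partner x)) ≡ gap (pos x)
        gap-between (inj₁ h) = gap-skip h (blocked x nS)
        gap-between (inj₂ h) = sym (gap-skip h λ {p} l → blocked (partner x) (nS ∘ subst S (half-partner x))
          (subst (λ z → pos z < p) (sym (partner-involutive x)) l))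

      inn-flip : ∀ x → S (κ x) → odd (pos (partner x)) ≡ not (odd (pos x))
      inn-flip x h = ¬-not λ e → non (κ x) h (oriented⇐ (S-bound h) (same-parity e (ends-of {x} refl)))
        where
        same-parity : odd (pos (partner x)) ≡ odd (pos x) →
          (x ≡ dbl (κ x) × partner x ≡ suc (dbl (κ x))) ⊎ (x ≡ suc (dbl (κ x)) × partner x ≡ dbl (κ x)) →
          odd (posL (κ x)) ≡ odd (posR (κ x))
        same-parity e (inj₁ (p , q)) = trans (cong (odd ∘ pos) (sym p)) (trans (sym e) (cong (odd ∘ pos) q))
        same-parity e (inj₂ (p , q)) = trans (cong (odd ∘ pos) (sym q)) (trans e (cong (odd ∘ pos) p))

      -- `enter` holds because a label of S at an odd position is the mark of its own region. Label
      -- 1 is inn because 0 stands at an even position and the edge between them is nonoriented.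
      coherence : Coherence
      coherence = record
        { S = S ; S? = S? ; inn = odd ∘ pos ; φ = gap ∘ pos
        ; φ-ε = λ x → trans (cong gap (pos-ε x)) (gap-ε (pos x))
        ; φ-grey = gap-grey
        ; inn-grey = inn-flip
        ; enter = λ x y Sx Sy ix iy e → pos-injective
            (trans (sym (gap-mark (ix , subst (S ∘ κ) (sym (lab-pos x)) Sx)))
              (trans e (gap-mark (iy , subst (S ∘ κ) (sym (lab-pos y)) Sy))))
        ; S-0 = nil
        ; inn-1 = trans (inn-flip 0 nil) (cong (not ∘ odd) pos-0)
        }

      -- The black edge of a 1-cycle runs along its grey edge. Any other has both ends in S or
      -- neither; in the latter case its right end is no mark and both ends share a region.
      coherent : β 0 ≢ 1 → Coherent coherence β [ lab 1 ]
      coherent b = (λ x _ → compat x) , [] , lab 1 , refl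
        , subst (S ∘ κ) β0 (S-black {0} b nil) , cong odd (pos-lab 1)
        where
        gap-black : ∀ x → ¬ S (κ x) → ¬ S (κ (β x)) → gap (pos (β x)) ≡ gap (pos x)
        gap-black x m m′ with dbl-half (pos x)
        ... | inj₁ e = trans (cong gap p′) (trans (gap-partner _ (m′ ∘ subst (S ∘ κ) lab′)) (cong gap (sym e)))
          where
          p′ : pos (β x) ≡ suc (dbl ⌊ pos x /2⌋)
          p′ = trans (pos-β x) (trans (cong partner e) (partner-dbl _))
          lab′ : lab (suc (dbl ⌊ pos x /2⌋)) ≡ β x
          lab′ = lab-of p′
        ... | inj₂ e = trans (cong gap (trans (pos-β x) (trans (cong partner e) (partner-sdbl _))))
          (trans (sym (gap-partner _ (m ∘ subst (S ∘ κ) (lab-of e)))) (cong gap (sym e)))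
        compat : ∀ x → Compat coherence x (β x)
        compat x with β x ≟ partner x
        ... | yes e = subst (Compat coherence x) (sym e) (compat-grey coherence x)
        ... | no nt with S? (κ x)
        ... | yes h = inj₂ (h , S-black nt h , trans (cong odd (pos-β x)) (odd-partner (pos x)))
        ... | no m = inj₁ (m , m′ , gap-black x m m′)
          where
          m′ : ¬ S (κ (β x))
          m′ h = m (subst (S ∘ κ) (β-involutive x) (S-black (nontrivial-β nt) h))

open Components

-- The distance, and its expression by the numbers of cycles.

open import Data.Nat as ℕ using (ℕ; zero; suc; _≤_; _<_; z≤n; s≤s; _≤?_; _<?_; _∸_)
open import Data.Nat.Properties as ℕ using (≤-refl; ≤-antisym; ≰⇒>; <⇒≱; anyUpTo?)
open import Data.Integer using (_+_; _-_; _*_)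
import Data.Integer.Properties as ℤ
open import Data.Integer.Tactic.RingSolver using (solve-∀)
open import Data.Maybe using (just)

-- An exhaustive search, which chooses between the two candidate distances without deciding whether
-- the leftmost component is oriented.
sortable? : ∀ k σ → Dec (Sortable σ k)
sortable? k σ with ≡-dec ℤ._≟_ σ (ι (length σ))
sortable? k σ | yes e = yes ([] , [] , e , z≤n)
sortable? zero σ | no n = no λ { ([] , _ , e , _) → n e ; (_ ∷ _ , _ , _ , ()) }
sortable? (suc k) σ | no n = map′ to from
    (anyUpTo? (λ j → (1 ≤? j) ×-dec sortable? k (prefixRev j σ)) (suc (length σ)))
  where
  to : (∃ λ j → j < suc (length σ) × 1 ≤ j × Sortable (prefixRev j σ) k) → Sortable σ (suc k)
  to (j , s≤s h , l , js , v , e , m) = j ∷ js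
    , (l , h) ∷ subst (λ n → All (λ i → 1 ≤ i × i ≤ n) js) (length-prefixRev j σ) v
    , trans e (cong ι (length-prefixRev j σ)) , s≤s m
  from : Sortable σ (suc k) → ∃ λ j → j < suc (length σ) × 1 ≤ j × Sortable (prefixRev j σ) k
  from ([] , _ , e , _) = ⊥-elim (n e)
  from (j ∷ js , (l , h) ∷ v , e , s≤s m) = j , s≤s h , l , js
    , subst (λ n → All (λ i → 1 ≤ i × i ≤ n) js) (sym (length-prefixRev j σ)) v
    , trans e (cong ι (sym (length-prefixRev j σ))) , m

-- Supplies the decidability of component membership that `Nonoriented` assumes: a component
-- consists of finitely many grey edges, and the goal there is a contradiction.
¬¬-decide : ∀ (P : ℕ → Set) n → ¬ ¬ (∀ k → k < n → Dec (P k))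
¬¬-decide P zero    c = c λ _ ()
¬¬-decide P (suc n) c = ¬¬-decide P n λ f → ¬¬-excluded-middle λ d → c λ k h → extend f d k h
  where
  extend : (∀ k → k < n → Dec (P k)) → Dec (P n) → ∀ k → k < suc n → Dec (P k)
  extend f d k (s≤s h) with ℕ.m≤n⇒m<n∨m≡n h
  ... | inj₁ l    = f k l
  ... | inj₂ refl = d

isPsrd : ∀ {σ d} → Sortable σ d → (∀ js → Sorts σ js → d ≤ length js) → IsPsrd σ d
isPsrd (js , v , e , l) lb = (js , (v , e) , ≤-antisym l (lb js (v , e))) , lb

module Bounds {π} (P : Perm π) (s : Simp (Cfg.β (cfg P))) where
  open Links P s

  m = length later

  fixed : β 0 ≡ 1 → IsPsrd π (3 ℕ.* twoCycles)
  fixed b = isPsrd (sort-fixed-first twoCycles twoCycles ≤-refl P s b initial-meas)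
    λ js (v , e) → subst (_≤ length js) (trans weights-others (cong (3 ℕ.*_) (sym (twoCycles-fixed b))))
      (lower-bound js P (decomp-fixed b) v e)

  module _ (b : β 0 ≢ 1) where
    meas : Meas β (suc m)
    meas = subst (Meas β) (twoCycles-moved b) initial-meas

    lower : ∀ js → Sorts π js → 1 ℕ.+ 3 ℕ.* m ≤ length js
    lower js (v , e) = subst (λ z → suc z ≤ length js) weights-others (lower-bound js P (decomp-moved b) v e)

    non⇒lower : LeftmostNonoriented π → ¬ Sortable π (1 ℕ.+ 3 ℕ.* m)
    non⇒lower non (js , v , e , l) = ¬¬-decide (Star (Link π) 0) (suc n) λ dec →
      <⇒≱ (subst (λ z → suc z < length js) weights-others
        (strict-lower-bound (Nonoriented.coherence (S? dec) non) js P (decomp-moved b)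
          (Nonoriented.coherent (S? dec) non b) v e)) l
      where
      S? : (∀ k → k < suc n → Dec (Star (Link π) 0 k)) → ∀ k → Dec (Star (Link π) 0 k)
      S? dec k with k <? suc n
      ... | yes h = dec k h
      ... | no h  = no λ c → h (s≤s (component-bound z≤n c))

    -- The hypothesis does not exhibit an oriented edge. But sortability is decidable, hence stable
    -- under double negation, so one may be assumed.
    sortable⇐oriented : ¬ LeftmostNonoriented π → Sortable π (1 ℕ.+ 3 ℕ.* m)
    sortable⇐oriented or = decidable-stable (sortable? _ π) λ ns → or λ k c o →
      ns (sort-oriented m P s b meas (component⇒path c) (oriented⇒ (component-bound z≤n c) o))

    distance : ∃ λ d → IsPsrd π d × (LeftmostNonoriented π → d ≡ 2 ℕ.+ 3 ℕ.* m)
                                  × (¬ LeftmostNonoriented π → d ≡ 1 ℕ.+ 3 ℕ.* m)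
    distance with sortable? (1 ℕ.+ 3 ℕ.* m) π
    ... | yes h = _ , isPsrd h lower , (λ non → ⊥-elim (non⇒lower non h)) , λ _ → refl
    ... | no n′ = _ , isPsrd (sort-simple m P s b meas) lower′ , (λ _ → refl) , (⊥-elim ∘ n′ ∘ sortable⇐oriented)
      where
      lower′ : ∀ js → Sorts π js → 2 ℕ.+ 3 ℕ.* m ≤ length js
      lower′ js (v , e) = ≰⇒> (λ l → n′ (js , v , e , l))

first-one⇒ : ∀ {π} (P : Perm π) → 1 ≤ length π → FirstIsOne π → Cfg.β (cfg P) 0 ≡ 1
first-one⇒ {z ∷ π} P h refl = trans (cong (labOf (z ∷ π) ∘ partner) (Cfg.pos-0 (cfg P))) (labOf-< {z ∷ π} (s≤s (s≤s z≤n)))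

first-one⇐ : ∀ {π} (P : Perm π) → 1 ≤ length π → Cfg.β (cfg P) 0 ≡ 1 → FirstIsOne π
first-one⇐ {z ∷ π} P h b = go z (trans (sym (labOf-< {z ∷ π} (s≤s (s≤s z≤n)))) (trans (sym (cong (labOf (z ∷ π) ∘ partner) (Cfg.pos-0 (cfg P)))) b))
  where
  go : ∀ z → label (z ∷ π) 1 ≡ 1 → just z ≡ just (+ 1)
  go (+ zero)        ()
  go (+ suc zero)    e = refl
  go (+ suc (suc k)) e with trans (sym (cong (_∸ 1) (2*≡dbl (suc (suc k))))) e
  ... | ()
  go -[1+ k ]        e with trans (sym (2*≡dbl (suc k))) e
  ... | ()

-- k is what the distance d lacks to three times the number of 2-cycles: 0 if π₁ = 1, otherwise 1 or
-- 2.
subtract : ∀ n c₀ c₁ d k → n ℕ.+ 1 ℕ.+ c₀ ≡ d ℕ.+ k ℕ.+ 2 ℕ.* c₁ →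
  + n + + 1 + + c₀ - + 2 * + c₁ - + k ≡ + d
subtract n c₀ c₁ d k e = trans (cong (λ z → z - + 2 * + c₁ - + k) (trans (cong +_ e) expand-+)) (cancel (+ d) (+ k) (+ 2 * + c₁))
  where
  expand-+ : + (d ℕ.+ k ℕ.+ 2 ℕ.* c₁) ≡ + d + + k + + 2 * + c₁
  expand-+ = cong (_+_ (+ d + + k)) (ℤ.pos-* 2 c₁)
  cancel : ∀ x y z → x + y + z - z - y ≡ x
  cancel = solve-∀

theorem3 : ∀ (n : ℕ) (π : List ℤ) → 1 ≤ n → IsSignedPerm n π → Simple π →
    ∃[ d ] (IsPsrd π d
    × (FirstIsOne π →
    + d ≡ + n + + 1 + + cyc π - + 2 * + cyc₁ π)
    × (¬ FirstIsOne π → LeftmostNonoriented π →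
    + d ≡ + n + + 1 + + cyc π - + 2 * + cyc₁ π + + 1 - + 2)
    × (¬ FirstIsOne π → ¬ LeftmostNonoriented π →
    + d ≡ + n + + 1 + + cyc π - + 2 * + cyc₁ π + + 0 - + 2))
theorem3 n π 1≤n P S with trans (sym (length-map ∣_∣ π)) (trans (↭.↭-length P) (trans (length-map suc (upTo n)) (length-upTo n)))
... | refl = go (Cfg.β (cfg P) 0 ℕ.≟ 1)
  where
  s = Walks.simple⇒Simp P 1≤n S
  open Bounds P s
  open Initial P s using (twoCycles; twoCycles-moved; cycle-formula)
  X = + n + + 1 + + cyc π - + 2 * + cyc₁ π

  go : Dec (Cfg.β (cfg P) 0 ≡ 1) → _
  go (yes b) = 3 ℕ.* twoCycles , fixed b
    , (λ _ → trans (sym (subtract n (cyc π) (cyc₁ π) (3 ℕ.* twoCycles) 0 (trans cycle-formula (cong (ℕ._+ 2 ℕ.* cyc₁ π) (sym (ℕ.+-identityʳ (3 ℕ.* twoCycles))))))) (ℤ.+-identityʳ X))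
    , (λ f → ⊥-elim (f (first-one⇐ P 1≤n b))) , (λ f → ⊥-elim (f (first-one⇐ P 1≤n b)))
  go (no b) with distance b
  ... | d , psrd , d₂ , d₁ = d , psrd , (λ f → ⊥-elim (b (first-one⇒ P 1≤n f)))
    , (λ _ non → trans (sym (subtract n (cyc π) (cyc₁ π) d 1 (formula 1 (cong (1 ℕ.+_) (d₂ non))))) (minus-one X))
    , (λ _ or → trans (sym (subtract n (cyc π) (cyc₁ π) d 2 (formula 2 (cong (2 ℕ.+_) (d₁ or))))) (minus-two X))
    where
    formula : ∀ k → k ℕ.+ d ≡ 3 ℕ.+ 3 ℕ.* m → n ℕ.+ 1 ℕ.+ cyc π ≡ d ℕ.+ k ℕ.+ 2 ℕ.* cyc₁ π
    formula k e = trans cycle-formula (cong (ℕ._+ 2 ℕ.* cyc₁ π) (trans (cong (3 ℕ.*_) (twoCycles-moved b))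
      (trans (ℕ.*-suc 3 m) (trans (sym e) (ℕ.+-comm k d)))))
    minus-one : ∀ x → x - + 1 ≡ x + + 1 - + 2
    minus-one = solve-∀
    minus-two : ∀ x → x - + 2 ≡ x + + 0 - + 2
    minus-two = solve-∀
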